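{- Let $I:\mathcal{C}_0\to\mathcal{C}$ be a functor into an ind-closed category $\mathcal{C}$. Then there are a pro-monoid $M$ and a pro-group $G$ in $\mathrm{Ind}(\mathcal{C})$, such that for any closed functor $H:\mathcal{C}\to\mathcal{E}$, $$\mathrm{End}(H/I)=\Gamma(H(M))\quad\text{and}\quad\mathrm{Aut}(H/I)=\Gamma(H(G)).$$
   Context: Categories are essentially small (except for the categories $\mathrm{Ind}$ and $\mathrm{Pro}$ built from them) and $\mathcal{C}$, $\mathcal{E}$ have all finite (inverse) limits; $\mathbf{1}$ is the terminal object. $\mathrm{Ind}(\mathcal{C})$ and $\mathrm{Pro}(\mathcal{C})$ are the usual categories of ind-objects (formal filtered colimits) and pro-objects (formal cofiltered limits); functors are extended to ind- and pro-objects termwise (so $H(M)$ and $H(G)$ are pro-objects of $\mathrm{Ind}(\mathcal{E})$). A pro-monoid (pro-group) in a category is a pro-object of it that can be represented by a cofiltered inverse system of monoid (group) objects and homomorphisms. For objects $X,Y$ of $\mathcal{C}$, $\underline{Hom}(X,Y)$ is the presheaf $Z\mapsto Hom(Z\times X,Y)$ on $\mathcal{C}$. The category $\mathcal{C}$ is ind-closed if it has finite limits and $\underline{Hom}(X,Y)$ is representable by an ind-object for all objects $X,Y$; there is then an evaluation map $\underline{Hom}(X,Y)\times X\to Y$ in $\mathrm{Ind}(\mathcal{C})$. A functor $H:\mathcal{C}\to\mathcal{E}$ is closed if it preserves finite limits and, for all $X,Y$, the map $H(\underline{Hom}(X,Y))\to\underline{Hom}(H(X),H(Y))$ induced by applying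 $H$ to the evaluation map is an isomorphism. $\Gamma$ denotes global sections, $\Gamma(-)=Hom(\mathbf{1},-)$. $\mathrm{End}(H/I)$ (resp. $\mathrm{Aut}(H/I)$) is the monoid of natural endomorphisms (resp. group of natural automorphisms) $t$ of $H$ such that $t_{I(X_0)}$ is the identity for every object $X_0$ of $\mathcal{C}_0$. Equalities mean isomorphisms of monoids, respectively groups. -}

module Defs where

open import Level using (Level; _⊔_; suc; 0ℓ)
open import Algebra.Bundles using (Monoid; Group)
open import Algebra.Morphism.Structures using (module MonoidMorphisms; module GroupMorphisms)
open import Data.Fin.Base using (Fin) renaming (zero to fzero; suc to fsuc)
open import Data.Fin.Properties using (_≟_)
open import Axiom.UniquenessOfIdentityProofs using (module Decidable⇒UIP)
open import Data.Nat.Base using (ℕ)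
open import Data.Product.Base using (Σ; Σ-syntax; _×_; _,_; proj₁; proj₂)
open import Data.Unit.Polymorphic.Base using (⊤; tt)
open import Function.Base using (_on_) renaming (_∘_ to _∘′_)
open import Function.Bundles using (Func; Inverse; _↔_)
open import Relation.Binary.Bundles using (Setoid)
open import Relation.Binary.Structures using (IsEquivalence)
open import Relation.Binary.PropositionalEquality.Core as ≡ using (_≡_)
open import Relation.Binary.PropositionalEquality.Properties as ≡ₚ using ()
open import Relation.Nullary using (yes; no; contradiction)
import Function.Construct.Identity as Identity
import Relation.Binary.Construct.On as On
import Relation.Binary.Reasoning.Setoid as SetoidReasoning

private
  variable
    o o′ o″ ℓ ℓ′ ℓ″ κ : Level

record Category (o ℓ : Level) : Set (suc (o ⊔ ℓ)) where
  constructor mkCategory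
  no-eta-equality
  infix  4 _≈_ _⇒_
  infixr 9 _∘_
  field
    Obj       : Set o
    _⇒_       : Obj → Obj → Set ℓ
    _≈_       : ∀ {A B} → A ⇒ B → A ⇒ B → Set ℓ
    id        : ∀ {A} → A ⇒ A
    _∘_       : ∀ {A B C} → B ⇒ C → A ⇒ B → A ⇒ C
    equiv     : ∀ {A B} → IsEquivalence (_≈_ {A} {B})
    assoc     : ∀ {A B C D} {f : A ⇒ B} {g : B ⇒ C} {h : C ⇒ D} →
                (h ∘ g) ∘ f ≈ h ∘ (g ∘ f)
    identityˡ : ∀ {A B} {f : A ⇒ B} → id ∘ f ≈ f
    identityʳ : ∀ {A B} {f : A ⇒ B} → f ∘ id ≈ f
    ∘-resp-≈  : ∀ {A B C} {f f′ : B ⇒ C} {g g′ : A ⇒ B} →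
                f ≈ f′ → g ≈ g′ → f ∘ g ≈ f′ ∘ g′

  hom-setoid : Obj → Obj → Setoid ℓ ℓ
  hom-setoid A B = record { isEquivalence = equiv {A} {B} }

  module ≈ {A B : Obj} = IsEquivalence (equiv {A} {B})
  module HomReasoning {A B : Obj} = SetoidReasoning (hom-setoid A B)

  ∘-resp-≈ˡ : ∀ {A B C} {f f′ : B ⇒ C} {g : A ⇒ B} → f ≈ f′ → f ∘ g ≈ f′ ∘ g
  ∘-resp-≈ˡ p = ∘-resp-≈ p ≈.refl

  ∘-resp-≈ʳ : ∀ {A B C} {f : B ⇒ C} {g g′ : A ⇒ B} → g ≈ g′ → f ∘ g ≈ f ∘ g′
  ∘-resp-≈ʳ p = ∘-resp-≈ ≈.refl p

  record IsIso {A B : Obj} (f : A ⇒ B) : Set ℓ where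
    field
      inv  : B ⇒ A
      isoˡ : inv ∘ f ≈ id
      isoʳ : f ∘ inv ≈ id

-- The INLINE pragmas turn record expressions into copattern definitions;
-- together with the opaque blocks they only keep conversion checking cheap.
{-# INLINE mkCategory #-}

infix 10 _[_,_] _[_≈_]

_[_,_] : (C : Category o ℓ) → Category.Obj C → Category.Obj C → Set ℓ
C [ A , B ] = Category._⇒_ C A B

_[_≈_] : (C : Category o ℓ) {A B : Category.Obj C} → C [ A , B ] → C [ A , B ] → Set ℓ
C [ f ≈ g ] = Category._≈_ C f g

op : Category o ℓ → Category o ℓ
op C = record
  { Obj = Obj ; _⇒_ = λ A B → B ⇒ A ; _≈_ = _≈_ ; id = id ; _∘_ = λ f g → g ∘ f
  ; equiv = equiv ; assoc = ≈.sym assoc ; identityˡ = identityʳ ; identityʳ = identityˡ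
  ; ∘-resp-≈ = λ p q → ∘-resp-≈ q p }
  where open Category C

One : Category κ κ
One = record
  { Obj = ⊤ ; _⇒_ = λ _ _ → ⊤ ; _≈_ = λ _ _ → ⊤
  ; id = tt ; _∘_ = λ _ _ → tt
  ; equiv = record { refl = tt ; sym = λ _ → tt ; trans = λ _ _ → tt }
  ; assoc = tt ; identityˡ = tt ; identityʳ = tt ; ∘-resp-≈ = λ _ _ → tt }

_×ᶜ_ : Category o ℓ → Category o′ ℓ′ → Category (o ⊔ o′) (ℓ ⊔ ℓ′)
C ×ᶜ D = record
  { Obj = C.Obj × D.Obj
  ; _⇒_ = λ (A , B) (A′ , B′) → C [ A , A′ ] × D [ B , B′ ]
  ; _≈_ = λ (f , g) (f′ , g′) → C [ f ≈ f′ ] × D [ g ≈ g′ ]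
  ; id = C.id , D.id
  ; _∘_ = λ (f , g) (f′ , g′) → f C.∘ f′ , g D.∘ g′
  ; equiv = record
    { refl = C.≈.refl , D.≈.refl
    ; sym = λ (p , q) → C.≈.sym p , D.≈.sym q
    ; trans = λ (p , q) (p′ , q′) → C.≈.trans p p′ , D.≈.trans q q′ }
  ; assoc = C.assoc , D.assoc
  ; identityˡ = C.identityˡ , D.identityˡ
  ; identityʳ = C.identityʳ , D.identityʳ
  ; ∘-resp-≈ = λ (p , q) (p′ , q′) → C.∘-resp-≈ p p′ , D.∘-resp-≈ q q′ }
  where module C = Category C
        module D = Category D

Setoids : ∀ κ → Category (suc κ) κ
Setoids κ = record
  { Obj = Setoid κ κ
  ; _⇒_ = Func
  ; _≈_ = λ {A} {B} f g → ∀ x → Setoid._≈_ B (Func.to f x) (Func.to g x)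
  ; id = λ {A} → record { to = λ x → x ; cong = λ p → p }
  ; _∘_ = λ f g → record
    { to = λ x → Func.to f (Func.to g x) ; cong = λ p → Func.cong f (Func.cong g p) }
  ; equiv = λ {A} {B} → record
    { refl = λ _ → Setoid.refl B
    ; sym = λ p x → Setoid.sym B (p x)
    ; trans = λ p q x → Setoid.trans B (p x) (q x) }
  ; assoc = λ {A} {B} {C} {D} _ → Setoid.refl D
  ; identityˡ = λ {A} {B} _ → Setoid.refl B
  ; identityʳ = λ {A} {B} _ → Setoid.refl B
  ; ∘-resp-≈ = λ {A} {B} {C} {f} {f′} {g} {g′} p q x →
      Setoid.trans C (Func.cong f (q x)) (p (Func.to g′ x)) }

record Functor (C : Category o ℓ) (D : Category o′ ℓ′) : Set (o ⊔ ℓ ⊔ o′ ⊔ ℓ′) where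
  constructor mkFunctor
  no-eta-equality
  private
    module C = Category C
    module D = Category D
  field
    F₀           : C.Obj → D.Obj
    F₁           : ∀ {A B} → C [ A , B ] → D [ F₀ A , F₀ B ]
    identity     : ∀ {A} → D [ F₁ (C.id {A}) ≈ D.id ]
    homomorphism : ∀ {X Y Z} {f : C [ X , Y ]} {g : C [ Y , Z ]} →
                   D [ F₁ (g C.∘ f) ≈ F₁ g D.∘ F₁ f ]
    F-resp-≈     : ∀ {A B} {f g : C [ A , B ]} → C [ f ≈ g ] → D [ F₁ f ≈ F₁ g ]

{-# INLINE mkFunctor #-}

infixr 9 _∘F_

_∘F_ : {C : Category o ℓ} {D : Category o′ ℓ′} {E : Category o″ ℓ″} →
       Functor D E → Functor C D → Functor C E
_∘F_ {E = E} G F = record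
  { F₀ = G.F₀ ∘′ F.F₀
  ; F₁ = G.F₁ ∘′ F.F₁
  ; identity = ≈.trans (G.F-resp-≈ F.identity) G.identity
  ; homomorphism = ≈.trans (G.F-resp-≈ F.homomorphism) G.homomorphism
  ; F-resp-≈ = G.F-resp-≈ ∘′ F.F-resp-≈ }
  where module F = Functor F
        module G = Functor G
        open Category E

Fst : {C : Category o ℓ} {D : Category o′ ℓ′} → Functor (C ×ᶜ D) C
Fst {C = C} = record
  { F₀ = proj₁ ; F₁ = proj₁ ; identity = ≈.refl ; homomorphism = ≈.refl ; F-resp-≈ = proj₁ }
  where open Category C

Snd : {C : Category o ℓ} {D : Category o′ ℓ′} → Functor (C ×ᶜ D) D
Snd {D = D} = record
  { F₀ = proj₂ ; F₁ = proj₂ ; identity = ≈.refl ; homomorphism = ≈.refl ; F-resp-≈ = proj₂ }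
  where open Category D

_×F_ : {C D : Category o ℓ} {C′ D′ : Category o′ ℓ′} →
       Functor C C′ → Functor D D′ → Functor (C ×ᶜ D) (C′ ×ᶜ D′)
F ×F G = record
  { F₀ = λ (A , B) → F.F₀ A , G.F₀ B
  ; F₁ = λ (f , g) → F.F₁ f , G.F₁ g
  ; identity = F.identity , G.identity
  ; homomorphism = F.homomorphism , G.homomorphism
  ; F-resp-≈ = λ (p , q) → F.F-resp-≈ p , G.F-resp-≈ q }
  where module F = Functor F
        module G = Functor G

opF : {C : Category o ℓ} {D : Category o′ ℓ′} → Functor C D → Functor (op C) (op D)
opF F = record
  { F₀ = F₀ ; F₁ = F₁ ; identity = identity ; homomorphism = homomorphism ; F-resp-≈ = F-resp-≈ }
  where open Functor F

const : {C : Category o ℓ} (D : Category o′ ℓ′) → Category.Obj D → Functor C D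
const D X = record
  { F₀ = λ _ → X ; F₁ = λ _ → id ; identity = ≈.refl
  ; homomorphism = ≈.sym identityˡ ; F-resp-≈ = λ _ → ≈.refl }
  where open Category D

record NatTrans {C : Category o ℓ} {D : Category o′ ℓ′} (F G : Functor C D)
                : Set (o ⊔ ℓ ⊔ o′ ⊔ ℓ′) where
  private
    module C = Category C
    module D = Category D
    module F = Functor F
    module G = Functor G
  field
    η       : ∀ X → D [ F.F₀ X , G.F₀ X ]
    commute : ∀ {X Y} (f : C [ X , Y ]) → D [ η Y D.∘ F.F₁ f ≈ G.F₁ f D.∘ η X ]

IsNatIso : {C : Category o ℓ} {D : Category o′ ℓ′} {F G : Functor C D} →
           NatTrans F G → Set (o ⊔ ℓ′)
IsNatIso {C = C} {D = D} α = ∀ (X : Category.Obj C) → Category.IsIso D (NatTrans.η α X)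

-- Smallness is relative to the universe Set κ.  A category in
-- Category o κ is locally small; it is essentially small if every
-- object is isomorphic to a member of a small family of objects.
record EssentiallySmall (C : Category o κ) : Set (o ⊔ suc κ) where
  open Category C
  field
    Index : Set κ
    rep   : Index → Obj
    cover : ∀ X → Σ[ i ∈ Index ] Σ[ f ∈ rep i ⇒ X ] IsIso f

record Cone {J : Category o ℓ} {C : Category o′ ℓ′} (F : Functor J C)
            : Set (o ⊔ ℓ ⊔ o′ ⊔ ℓ′) where
  open Category C
  open Functor F
  field
    apex    : Obj
    ψ       : ∀ j → apex ⇒ F₀ j
    commute : ∀ {i j} (u : J [ i , j ]) → F₁ u ∘ ψ i ≈ ψ j

record IsLimit {J : Category o ℓ} {C : Category o′ ℓ′} {F : Functor J C} (L : Cone F)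
               : Set (o ⊔ ℓ ⊔ o′ ⊔ ℓ′) where
  open Category C
  private module L = Cone L
  field
    factor   : (K : Cone F) → Cone.apex K ⇒ L.apex
    factor-ψ : (K : Cone F) → ∀ j → L.ψ j ∘ factor K ≈ Cone.ψ K j
    unique   : (K : Cone F) (h : Cone.apex K ⇒ L.apex) →
               (∀ j → L.ψ j ∘ h ≈ Cone.ψ K j) → factor K ≈ h

mapCone : {J : Category o ℓ} {C : Category o′ ℓ′} {D : Category o″ ℓ″} {F : Functor J C}
          (H : Functor C D) → Cone F → Cone (H ∘F F)
mapCone {D = D} H K = record
  { apex = F₀ K.apex
  ; ψ = λ j → F₁ (K.ψ j)
  ; commute = λ u → ≈.trans (≈.sym homomorphism) (F-resp-≈ (K.commute u)) }
  where module K = Cone K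
        open Functor H
        open Category D

record IsFinite (J : Category 0ℓ 0ℓ) : Set where
  open Category J
  field
    #Obj : ℕ
    obj  : Fin #Obj ↔ Obj
    #hom : Obj → Obj → ℕ
    hom  : ∀ i j → Inverse (≡ₚ.setoid (Fin (#hom i j))) (hom-setoid i j)

HasFiniteLimits : Category o ℓ → Set (suc 0ℓ ⊔ o ⊔ ℓ)
HasFiniteLimits C =
  ∀ (J : Category 0ℓ 0ℓ) → IsFinite J → (F : Functor J C) → Σ (Cone F) IsLimit

PreservesFiniteLimits : {C : Category o ℓ} {D : Category o′ ℓ′} →
                        Functor C D → Set (suc 0ℓ ⊔ o ⊔ ℓ ⊔ o′ ⊔ ℓ′)
PreservesFiniteLimits {C = C} H =
  ∀ (J : Category 0ℓ 0ℓ) → IsFinite J → (F : Functor J C) (L : Cone F) →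
  IsLimit L → IsLimit (mapCone H L)

module _ (C : Category o ℓ) where
  open Category C

  record IsTerminal (T : Obj) : Set (o ⊔ ℓ) where
    field
      !        : ∀ {A} → A ⇒ T
      !-unique : ∀ {A} (f : A ⇒ T) → ! ≈ f

  record IsProduct {P A B : Obj} (p : P ⇒ A) (q : P ⇒ B) : Set (o ⊔ ℓ) where
    field
      ⟨_,_⟩    : ∀ {Z} → Z ⇒ A → Z ⇒ B → Z ⇒ P
      project₁ : ∀ {Z} {f : Z ⇒ A} {g : Z ⇒ B} → p ∘ ⟨ f , g ⟩ ≈ f
      project₂ : ∀ {Z} {f : Z ⇒ A} {g : Z ⇒ B} → q ∘ ⟨ f , g ⟩ ≈ g
      unique   : ∀ {Z} {f : Z ⇒ A} {g : Z ⇒ B} {h : Z ⇒ P} →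
                 p ∘ h ≈ f → q ∘ h ≈ g → ⟨ f , g ⟩ ≈ h

    ⟨⟩-cong : ∀ {Z} {f f′ : Z ⇒ A} {g g′ : Z ⇒ B} →
              f ≈ f′ → g ≈ g′ → ⟨ f , g ⟩ ≈ ⟨ f′ , g′ ⟩
    ⟨⟩-cong r s = unique (≈.trans project₁ (≈.sym r)) (≈.trans project₂ (≈.sym s))

    ⟨⟩∘ : ∀ {Y Z} {f : Z ⇒ A} {g : Z ⇒ B} {h : Y ⇒ Z} →
          ⟨ f , g ⟩ ∘ h ≈ ⟨ f ∘ h , g ∘ h ⟩
    ⟨⟩∘ = ≈.sym (unique (≈.trans (≈.sym assoc) (∘-resp-≈ˡ project₁))
                        (≈.trans (≈.sym assoc) (∘-resp-≈ˡ project₂)))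

    jointly-monic : ∀ {Z} {h k : Z ⇒ P} → p ∘ h ≈ p ∘ k → q ∘ h ≈ q ∘ k → h ≈ k
    jointly-monic r s = ≈.trans (≈.sym (unique r s)) (unique ≈.refl ≈.refl)

  record Cartesian : Set (o ⊔ ℓ) where
    constructor mkCartesian
    infixr 5 _⊗_
    field
      𝟏          : Obj
      isTerminal : IsTerminal 𝟏
      _⊗_        : Obj → Obj → Obj
      π₁         : ∀ {A B} → A ⊗ B ⇒ A
      π₂         : ∀ {A B} → A ⊗ B ⇒ B
      isProduct  : ∀ {A B} → IsProduct (π₁ {A} {B}) (π₂ {A} {B})

    open IsTerminal isTerminal public
    module _ {A B : Obj} where
      open IsProduct (isProduct {A} {B}) public

    infixr 8 _⁂_
    _⁂_ : ∀ {A B A′ B′} → A ⇒ A′ → B ⇒ B′ → A ⊗ B ⇒ A′ ⊗ B′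
    f ⁂ g = ⟨ f ∘ π₁ , g ∘ π₂ ⟩

    ⁂∘⟨⟩ : ∀ {Z A B A′ B′} {f : A ⇒ A′} {g : B ⇒ B′} {h : Z ⇒ A} {k : Z ⇒ B} →
           (f ⁂ g) ∘ ⟨ h , k ⟩ ≈ ⟨ f ∘ h , g ∘ k ⟩
    ⁂∘⟨⟩ = ≈.trans ⟨⟩∘ (⟨⟩-cong (≈.trans assoc (∘-resp-≈ʳ project₁))
                                 (≈.trans assoc (∘-resp-≈ʳ project₂)))

{-# INLINE mkCartesian #-}

private
  ≡-irrelevant : ∀ {n} {i j : Fin n} (p q : i ≡ j) → p ≡ q
  ≡-irrelevant = Decidable⇒UIP.≡-irrelevant _≟_

Discrete : ℕ → Category 0ℓ 0ℓ
Discrete n = record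
  { Obj = Fin n ; _⇒_ = _≡_ ; _≈_ = _≡_ ; id = ≡.refl ; _∘_ = λ p q → ≡.trans q p
  ; equiv = ≡ₚ.isEquivalence
  ; assoc = ≡-irrelevant _ _ ; identityˡ = ≡-irrelevant _ _ ; identityʳ = ≡-irrelevant _ _
  ; ∘-resp-≈ = λ _ _ → ≡-irrelevant _ _ }

Discrete-finite : ∀ n → IsFinite (Discrete n)
Discrete-finite n = record
  { #Obj = n ; obj = Identity.↔-id (Fin n)
  ; #hom = λ i j → proj₁ (homs i j) ; hom = λ i j → proj₂ (homs i j) }
  where
  homs : ∀ (i j : Fin n) → Σ[ k ∈ ℕ ] Inverse (≡ₚ.setoid (Fin k)) (≡ₚ.setoid (i ≡ j))
  homs i j with i ≟ j
  ... | yes i≡j = 1 , record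
    { to = λ _ → i≡j ; from = λ _ → fzero
    ; to-cong = λ _ → ≡.refl ; from-cong = λ _ → ≡.refl
    ; inverse = (λ _ → ≡-irrelevant _ _) , λ { {fzero} _ → ≡.refl } }
  ... | no i≢j = 0 , record
    { to = λ () ; from = λ i≡j → contradiction i≡j i≢j
    ; to-cong = λ { {()} } ; from-cong = λ { {i≡j} → contradiction i≡j i≢j }
    ; inverse = (λ { {i≡j} → contradiction i≡j i≢j }) , λ { {()} } }

module _ {C : Category o ℓ} where
  open Category C

  Discrete-functor : ∀ {n} → (Fin n → Obj) → Functor (Discrete n) C
  Discrete-functor X = record
    { F₀ = X
    ; F₁ = λ { ≡.refl → id }
    ; identity = ≈.refl
    ; homomorphism = λ { {f = ≡.refl} {g = ≡.refl} → ≈.sym identityˡ }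
    ; F-resp-≈ = λ { ≡.refl → ≈.refl } }

  Discrete-cone : ∀ {n} (F : Functor (Discrete n) C) {Z : Obj} →
                  (∀ i → Z ⇒ Functor.F₀ F i) → Cone F
  Discrete-cone F {Z} f = record
    { apex = Z ; ψ = f
    ; commute = λ { ≡.refl → ≈.trans (∘-resp-≈ˡ (Functor.identity F)) identityˡ } }

  limit⇒terminal : {F : Functor (Discrete 0) C} {L : Cone F} → IsLimit L →
                   IsTerminal C (Cone.apex L)
  limit⇒terminal {F} lim = record
    { ! = factor (Discrete-cone F λ ())
    ; !-unique = λ f → unique (Discrete-cone F λ ()) f λ () }
    where open IsLimit lim

  limit⇒product : {F : Functor (Discrete 2) C} {L : Cone F} → IsLimit L →
                  IsProduct C (Cone.ψ L fzero) (Cone.ψ L (fsuc fzero))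
  limit⇒product {F} lim = record
    { ⟨_,_⟩ = λ f g → factor (cone f g)
    ; project₁ = factor-ψ (cone _ _) fzero
    ; project₂ = factor-ψ (cone _ _) (fsuc fzero)
    ; unique = λ p q → unique (cone _ _) _ λ { fzero → p ; (fsuc fzero) → q } }
    where
    open IsLimit lim
    cone : ∀ {Z} → Z ⇒ Functor.F₀ F fzero → Z ⇒ Functor.F₀ F (fsuc fzero) → Cone F
    cone f g = Discrete-cone F λ { fzero → f ; (fsuc fzero) → g }

  pair : Obj → Obj → Functor (Discrete 2) C
  pair A B = Discrete-functor λ { fzero → A ; (fsuc fzero) → B }

  empty : Functor (Discrete 0) C
  empty = Discrete-functor λ ()

cartesian : {C : Category o ℓ} → HasFiniteLimits C → Cartesian C
cartesian {C = C} lim = record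
  { 𝟏 = Cone.apex (proj₁ lim₀)
  ; isTerminal = limit⇒terminal (proj₂ lim₀)
  ; _⊗_ = λ A B → Cone.apex (proj₁ (lim₂ A B))
  ; π₁ = λ {A} {B} → Cone.ψ (proj₁ (lim₂ A B)) fzero
  ; π₂ = λ {A} {B} → Cone.ψ (proj₁ (lim₂ A B)) (fsuc fzero)
  ; isProduct = λ {A} {B} → limit⇒product (proj₂ (lim₂ A B)) }
  where
  lim₀ : Σ (Cone empty) IsLimit
  lim₀ = lim (Discrete 0) (Discrete-finite 0) empty
  lim₂ : ∀ A B → Σ (Cone (pair {C = C} A B)) IsLimit
  lim₂ A B = lim (Discrete 2) (Discrete-finite 2) (pair A B)

record PreservesProducts {C : Category o ℓ} {D : Category o′ ℓ′}
                         (cC : Cartesian C) (F : Functor C D) : Set (o ⊔ ℓ ⊔ o′ ⊔ ℓ′) where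
  open Cartesian cC using (𝟏; π₁; π₂)
  open Functor F
  field
    F-terminal : IsTerminal D (F₀ 𝟏)
    F-product  : ∀ {A B} → IsProduct D (F₁ (π₁ {A} {B})) (F₁ (π₂ {A} {B}))

preservesProducts : {C : Category o ℓ} {D : Category o′ ℓ′} {H : Functor C D}
                    (lim : HasFiniteLimits C) → PreservesFiniteLimits H →
                    PreservesProducts (cartesian lim) H
preservesProducts lim pres = record
  { F-terminal = limit⇒terminal (pres _ fin₀ empty _ (proj₂ (lim _ fin₀ empty)))
  ; F-product = limit⇒product (pres _ fin₂ (pair _ _) _ (proj₂ (lim _ fin₂ (pair _ _)))) }
  where
  fin₀ : IsFinite (Discrete 0)
  fin₀ = Discrete-finite 0
  fin₂ : IsFinite (Discrete 2)
  fin₂ = Discrete-finite 2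

module _ {C : Category o ℓ} (cC : Cartesian C) where
  open Category C
  open Cartesian cC

  record MonoidObject : Set (o ⊔ ℓ) where
    field
      Carrier    : Obj
      μ          : Carrier ⊗ Carrier ⇒ Carrier
      η          : 𝟏 ⇒ Carrier
      μ-assoc    : μ ∘ ⟨ μ ∘ ⟨ π₁ ∘ π₁ , π₂ ∘ π₁ ⟩ , π₂ ⟩
                   ≈ μ ∘ ⟨ π₁ ∘ π₁ , μ ∘ ⟨ π₂ ∘ π₁ , π₂ {Carrier ⊗ Carrier} ⟩ ⟩
      μ-identityˡ : μ ∘ ⟨ η ∘ ! , id ⟩ ≈ id
      μ-identityʳ : μ ∘ ⟨ id , η ∘ ! ⟩ ≈ id

  record GroupObject : Set (o ⊔ ℓ) where
    field
      monoid : MonoidObject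
    open MonoidObject monoid public
    field
      ι         : Carrier ⇒ Carrier
      μ-inverseˡ : μ ∘ ⟨ ι , id ⟩ ≈ η ∘ !
      μ-inverseʳ : μ ∘ ⟨ id , ι ⟩ ≈ η ∘ !

  record MonoidObjectHom (M N : MonoidObject) : Set ℓ where
    private
      module M = MonoidObject M
      module N = MonoidObject N
    field
      hom   : M.Carrier ⇒ N.Carrier
      hom-μ : hom ∘ M.μ ≈ N.μ ∘ (hom ⁂ hom)
      hom-η : hom ∘ M.η ≈ N.η

  open MonoidObjectHom

  private
    compose : ∀ {L M N} → MonoidObjectHom M N → MonoidObjectHom L M → MonoidObjectHom L N
    compose {L} {M} {N} g f = record
      { hom = hom g ∘ hom f
      ; hom-μ = begin
          (hom g ∘ hom f) ∘ L.μ                        ≈⟨ assoc ⟩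
          hom g ∘ (hom f ∘ L.μ)                        ≈⟨ ∘-resp-≈ʳ (hom-μ f) ⟩
          hom g ∘ (M.μ ∘ (hom f ⁂ hom f))              ≈⟨ assoc ⟨
          (hom g ∘ M.μ) ∘ (hom f ⁂ hom f)              ≈⟨ ∘-resp-≈ˡ (hom-μ g) ⟩
          (N.μ ∘ (hom g ⁂ hom g)) ∘ (hom f ⁂ hom f)    ≈⟨ assoc ⟩
          N.μ ∘ ((hom g ⁂ hom g) ∘ (hom f ⁂ hom f))    ≈⟨ ∘-resp-≈ʳ ⁂∘⟨⟩ ⟩
          N.μ ∘ ⟨ hom g ∘ (hom f ∘ π₁) , hom g ∘ (hom f ∘ π₂) ⟩
            ≈⟨ ∘-resp-≈ʳ (⟨⟩-cong assoc assoc) ⟨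
          N.μ ∘ (hom g ∘ hom f ⁂ hom g ∘ hom f)        ∎
      ; hom-η = ≈.trans assoc (≈.trans (∘-resp-≈ʳ (hom-η f)) (hom-η g)) }
      where
      module L = MonoidObject L
      module M = MonoidObject M
      module N = MonoidObject N
      open HomReasoning

  Mon : Category (o ⊔ ℓ) ℓ
  Mon = record
    { Obj = MonoidObject
    ; _⇒_ = MonoidObjectHom
    ; _≈_ = _≈_ on hom
    ; id = record
      { hom = id
      ; hom-μ = ≈.trans identityˡ (≈.sym (≈.trans
          (∘-resp-≈ʳ (unique (≈.trans identityʳ (≈.sym identityˡ))
                             (≈.trans identityʳ (≈.sym identityˡ)))) identityʳ))
      ; hom-η = identityˡ }
    ; _∘_ = compose
    ; equiv = On.isEquivalence hom equiv
    ; assoc = assoc ; identityˡ = identityˡ ; identityʳ = identityʳ ; ∘-resp-≈ = ∘-resp-≈ }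

  -- A homomorphism of the underlying monoid objects preserves inverses.
  Grp : Category (o ⊔ ℓ) ℓ
  Grp = record
    { Obj = GroupObject
    ; _⇒_ = λ G K → Mon [ GroupObject.monoid G , GroupObject.monoid K ]
    ; _≈_ = λ {G} {K} → Category._≈_ Mon {GroupObject.monoid G} {GroupObject.monoid K}
    ; id = λ {G} → Category.id Mon {GroupObject.monoid G}
    ; _∘_ = Category._∘_ Mon
    ; equiv = On.isEquivalence hom equiv
    ; assoc = assoc ; identityˡ = identityˡ ; identityʳ = identityʳ ; ∘-resp-≈ = ∘-resp-≈ }

  Mon⇒C : Functor Mon C
  Mon⇒C = record
    { F₀ = MonoidObject.Carrier ; F₁ = hom
    ; identity = ≈.refl ; homomorphism = ≈.refl ; F-resp-≈ = λ p → p }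

  Grp⇒Mon : Functor Grp Mon
  Grp⇒Mon = record
    { F₀ = GroupObject.monoid ; F₁ = λ f → f
    ; identity = ≈.refl ; homomorphism = ≈.refl ; F-resp-≈ = λ p → p }

module _ {C : Category o ℓ} {D : Category o′ ℓ′} {cC : Cartesian C} (cD : Cartesian D)
         {F : Functor C D} (pres : PreservesProducts cC F) where
  private
    module C = Category C
    module cC = Cartesian cC
    module T = IsTerminal (PreservesProducts.F-terminal pres)
    module P {A B : C.Obj} = IsProduct (PreservesProducts.F-product pres {A} {B})
  open Category D
  open Cartesian cD
  open Functor F
  open HomReasoning

  φ : ∀ {A B} → F₀ A ⊗ F₀ B ⇒ F₀ (A cC.⊗ B)
  φ = P.⟨ π₁ , π₂ ⟩

  φ∘⟨⟩ : ∀ {Z A B} {f : Z ⇒ F₀ A} {g : Z ⇒ F₀ B} → φ ∘ ⟨ f , g ⟩ ≈ P.⟨ f , g ⟩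
  φ∘⟨⟩ = ≈.trans P.⟨⟩∘ (P.⟨⟩-cong project₁ project₂)

  φ-natural : ∀ {Z X A B} {f : X C.⇒ A} {g : X C.⇒ B} {k : Z ⇒ F₀ X} →
              φ ∘ ⟨ F₁ f ∘ k , F₁ g ∘ k ⟩ ≈ F₁ cC.⟨ f , g ⟩ ∘ k
  φ-natural = ≈.trans φ∘⟨⟩ (P.unique
    (≈.trans (≈.sym assoc) (∘-resp-≈ˡ (≈.trans (≈.sym homomorphism) (F-resp-≈ cC.project₁))))
    (≈.trans (≈.sym assoc) (∘-resp-≈ˡ (≈.trans (≈.sym homomorphism) (F-resp-≈ cC.project₂)))))

  private
    F-mult : ∀ {Z X A B K} {m : A cC.⊗ B C.⇒ K} {f : X C.⇒ A} {g : X C.⇒ B} {k : Z ⇒ F₀ X}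
             {f′ : Z ⇒ F₀ A} {g′ : Z ⇒ F₀ B} → f′ ≈ F₁ f ∘ k → g′ ≈ F₁ g ∘ k →
             (F₁ m ∘ φ) ∘ ⟨ f′ , g′ ⟩ ≈ F₁ (m C.∘ cC.⟨ f , g ⟩) ∘ k
    F-mult {m = m} {f} {g} {k} {f′} {g′} p q = begin
      (F₁ m ∘ φ) ∘ ⟨ f′ , g′ ⟩               ≈⟨ assoc ⟩
      F₁ m ∘ (φ ∘ ⟨ f′ , g′ ⟩)               ≈⟨ ∘-resp-≈ʳ (∘-resp-≈ʳ (⟨⟩-cong p q)) ⟩
      F₁ m ∘ (φ ∘ ⟨ F₁ f ∘ k , F₁ g ∘ k ⟩)   ≈⟨ ∘-resp-≈ʳ φ-natural ⟩
      F₁ m ∘ (F₁ cC.⟨ f , g ⟩ ∘ k)           ≈⟨ assoc ⟨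
      (F₁ m ∘ F₁ cC.⟨ f , g ⟩) ∘ k           ≈⟨ ∘-resp-≈ˡ homomorphism ⟨
      F₁ (m C.∘ cC.⟨ f , g ⟩) ∘ k            ∎

    F-id : ∀ {A} → id ≈ F₁ (C.id {A}) ∘ id
    F-id = ≈.sym (≈.trans identityʳ identity)

    F-unit : ∀ {A} {e : cC.𝟏 C.⇒ A} → (F₁ e ∘ T.!) ∘ ! ≈ F₁ (e C.∘ cC.! {A}) ∘ id
    F-unit {e = e} = begin
      (F₁ e ∘ T.!) ∘ !          ≈⟨ assoc ⟩
      F₁ e ∘ (T.! ∘ !)          ≈⟨ ∘-resp-≈ʳ (≈.trans (≈.sym (T.!-unique _)) (T.!-unique _)) ⟩
      F₁ e ∘ F₁ cC.!            ≈⟨ homomorphism ⟨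
      F₁ (e C.∘ cC.!)           ≈⟨ identityʳ ⟨
      F₁ (e C.∘ cC.!) ∘ id      ∎

  mapMonoidObject : MonoidObject cC → MonoidObject cD
  mapMonoidObject M = record
    { Carrier = F₀ M.Carrier
    ; μ = F₁ M.μ ∘ φ
    ; η = F₁ M.η ∘ T.!
    ; μ-assoc = begin
        (F₁ M.μ ∘ φ) ∘ ⟨ (F₁ M.μ ∘ φ) ∘ ⟨ π₁ ∘ π₁ , π₂ ∘ π₁ ⟩ , π₂ ⟩
          ≈⟨ F-mult (F-mult x y) z ⟩
        F₁ (M.μ C.∘ cC.⟨ M.μ C.∘ cC.⟨ cC.π₁ C.∘ cC.π₁ , cC.π₂ C.∘ cC.π₁ ⟩ , cC.π₂ ⟩) ∘ k
          ≈⟨ ∘-resp-≈ˡ (F-resp-≈ M.μ-assoc) ⟩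
        F₁ (M.μ C.∘ cC.⟨ cC.π₁ C.∘ cC.π₁ , M.μ C.∘ cC.⟨ cC.π₂ C.∘ cC.π₁ , cC.π₂ ⟩ ⟩) ∘ k
          ≈⟨ F-mult x (F-mult y z) ⟨
        (F₁ M.μ ∘ φ) ∘ ⟨ π₁ ∘ π₁ , (F₁ M.μ ∘ φ) ∘ ⟨ π₂ ∘ π₁ , π₂ ⟩ ⟩ ∎
    ; μ-identityˡ = ≈.trans (F-mult F-unit F-id)
        (≈.trans (∘-resp-≈ˡ (≈.trans (F-resp-≈ M.μ-identityˡ) identity)) identityˡ)
    ; μ-identityʳ = ≈.trans (F-mult F-id F-unit)
        (≈.trans (∘-resp-≈ˡ (≈.trans (F-resp-≈ M.μ-identityʳ) identity)) identityˡ) }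
    where
    module M = MonoidObject M
    X : C.Obj
    X = M.Carrier
    k : (F₀ X ⊗ F₀ X) ⊗ F₀ X ⇒ F₀ ((X cC.⊗ X) cC.⊗ X)
    k = P.⟨ φ ∘ π₁ , π₂ ⟩
    x : π₁ ∘ π₁ ≈ F₁ (cC.π₁ C.∘ cC.π₁) ∘ k
    x = begin
      π₁ ∘ π₁                      ≈⟨ ∘-resp-≈ˡ P.project₁ ⟨
      (F₁ cC.π₁ ∘ φ) ∘ π₁          ≈⟨ assoc ⟩
      F₁ cC.π₁ ∘ (φ ∘ π₁)          ≈⟨ ∘-resp-≈ʳ P.project₁ ⟨
      F₁ cC.π₁ ∘ (F₁ cC.π₁ ∘ k)    ≈⟨ assoc ⟨
      (F₁ cC.π₁ ∘ F₁ cC.π₁) ∘ k    ≈⟨ ∘-resp-≈ˡ homomorphism ⟨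
      F₁ (cC.π₁ C.∘ cC.π₁) ∘ k     ∎
    y : π₂ ∘ π₁ ≈ F₁ (cC.π₂ C.∘ cC.π₁) ∘ k
    y = begin
      π₂ ∘ π₁                      ≈⟨ ∘-resp-≈ˡ P.project₂ ⟨
      (F₁ cC.π₂ ∘ φ) ∘ π₁          ≈⟨ assoc ⟩
      F₁ cC.π₂ ∘ (φ ∘ π₁)          ≈⟨ ∘-resp-≈ʳ P.project₁ ⟨
      F₁ cC.π₂ ∘ (F₁ cC.π₁ ∘ k)    ≈⟨ assoc ⟨
      (F₁ cC.π₂ ∘ F₁ cC.π₁) ∘ k    ≈⟨ ∘-resp-≈ˡ homomorphism ⟨
      F₁ (cC.π₂ C.∘ cC.π₁) ∘ k     ∎
    z : π₂ ≈ F₁ cC.π₂ ∘ k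
    z = ≈.sym P.project₂

  private
    factors : ∀ {Z A B X} {f : A C.⇒ B} {p : X C.⇒ A} {k : Z ⇒ F₀ X} {q : Z ⇒ F₀ A} →
              F₁ p ∘ k ≈ q → F₁ f ∘ q ≈ F₁ (f C.∘ p) ∘ k
    factors r = ≈.trans (∘-resp-≈ʳ (≈.sym r))
                        (≈.trans (≈.sym assoc) (∘-resp-≈ˡ (≈.sym homomorphism)))

  mapMonoidObjectHom : ∀ {M N} → MonoidObjectHom cC M N →
                       MonoidObjectHom cD (mapMonoidObject M) (mapMonoidObject N)
  mapMonoidObjectHom {M} {N} f = record
    { hom = F₁ hom
    ; hom-μ = begin
        F₁ hom ∘ (F₁ M.μ ∘ φ)                        ≈⟨ assoc ⟨
        (F₁ hom ∘ F₁ M.μ) ∘ φ                        ≈⟨ ∘-resp-≈ˡ homomorphism ⟨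
        F₁ (hom C.∘ M.μ) ∘ φ                         ≈⟨ ∘-resp-≈ˡ (F-resp-≈ hom-μ) ⟩
        F₁ (N.μ C.∘ (hom cC.⁂ hom)) ∘ φ
          ≈⟨ F-mult (factors P.project₁) (factors P.project₂) ⟨
        (F₁ N.μ ∘ φ) ∘ (F₁ hom ⁂ F₁ hom)             ∎
    ; hom-η = ≈.trans (≈.sym assoc) (∘-resp-≈ˡ
        (≈.trans (≈.sym homomorphism) (F-resp-≈ hom-η))) }
    where
    module M = MonoidObject M
    module N = MonoidObject N
    open MonoidObjectHom f

  mapMon : Functor (Mon cC) (Mon cD)
  mapMon = record
    { F₀ = mapMonoidObject
    ; F₁ = mapMonoidObjectHom
    ; identity = identity ; homomorphism = homomorphism ; F-resp-≈ = F-resp-≈ }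

  mapGroupObject : GroupObject cC → GroupObject cD
  mapGroupObject G = record
    { monoid = mapMonoidObject G.monoid
    ; ι = F₁ G.ι
    ; μ-inverseˡ = ≈.trans (F-mult (≈.sym identityʳ) F-id)
        (≈.trans (∘-resp-≈ˡ (F-resp-≈ G.μ-inverseˡ)) (≈.sym F-unit))
    ; μ-inverseʳ = ≈.trans (F-mult F-id (≈.sym identityʳ))
        (≈.trans (∘-resp-≈ˡ (F-resp-≈ G.μ-inverseʳ)) (≈.sym F-unit)) }
    where module G = GroupObject G

  mapGrp : Functor (Grp cC) (Grp cD)
  mapGrp = record
    { F₀ = mapGroupObject
    ; F₁ = Functor.F₁ mapMon
    ; identity = identity ; homomorphism = homomorphism ; F-resp-≈ = F-resp-≈ }

record IsFiltered (J : Category κ κ) : Set κ where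
  open Category J
  field
    point : Obj
    bound : ∀ i j → Σ[ k ∈ Obj ] (i ⇒ k) × (j ⇒ k)
    coeq  : ∀ {i j} (u v : i ⇒ j) → Σ[ k ∈ Obj ] Σ[ w ∈ j ⇒ k ] w ∘ u ≈ w ∘ v

One-filtered : IsFiltered (One {κ})
One-filtered = record
  { point = tt ; bound = λ _ _ → tt , tt , tt ; coeq = λ _ _ → tt , tt , tt }

×ᶜ-filtered : {J K : Category κ κ} → IsFiltered J → IsFiltered K → IsFiltered (J ×ᶜ K)
×ᶜ-filtered fJ fK = record
  { point = J.point , K.point
  ; bound = λ (i , i′) (j , j′) →
      let k , u , v = J.bound i j ; k′ , u′ , v′ = K.bound i′ j′
      in (k , k′) , (u , u′) , (v , v′)
  ; coeq = λ (u , u′) (v , v′) →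
      let k , w , p = J.coeq u v ; k′ , w′ , p′ = K.coeq u′ v′
      in (k , k′) , (w , w′) , (p , p′) }
  where module J = IsFiltered fJ
        module K = IsFiltered fK

module _ (C : Category o κ) where
  open Category C

  record IndObject : Set (o ⊔ suc κ) where
    no-eta-equality
    field
      index    : Category κ κ
      filtered : IsFiltered index
      diagram  : Functor index C
    module J = Category index
    open IsFiltered filtered public
    open Functor diagram public

module _ {C : Category o κ} where
  open Category C
  open HomReasoning

  -- Germ Z W modulo _∼_ is colimᵢ Hom (Z , Wᵢ), so that
  -- IndHom V W is limᵢ colimⱼ Hom (Vᵢ , Wⱼ).
  record Germ (Z : Obj) (W : IndObject C) : Set κ where
    constructor germ
    open IndObject W
    field
      at  : J.Obj
      arr : Z ⇒ F₀ at

  infix 4 _∼_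

  record _∼_ {Z : Obj} {W : IndObject C} (x y : Germ Z W) : Set κ where
    constructor agree
    open IndObject W
    private
      module x = Germ x
      module y = Germ y
    field
      {at}  : J.Obj
      left  : x.at J.⇒ at
      right : y.at J.⇒ at
      equal : F₁ left ∘ x.arr ≈ F₁ right ∘ y.arr

  module _ {Z : Obj} {W : IndObject C} where
    open IndObject W

    opaque
      ∼-refl : {x : Germ Z W} → x ∼ x
      ∼-refl = agree J.id J.id ≈.refl

      ∼-sym : {x y : Germ Z W} → x ∼ y → y ∼ x
      ∼-sym (agree u v p) = agree v u (≈.sym p)

      ∼-trans : {x y z : Germ Z W} → x ∼ y → y ∼ z → x ∼ z
      ∼-trans {germ i f} {germ j g} {germ k h} (agree {l} u v p) (agree {m} u′ v′ q)
        with n , a , b ← bound l m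
        with n′ , w , r ← coeq (a J.∘ v) (b J.∘ u′) = agree (w J.∘ (a J.∘ u)) (w J.∘ (b J.∘ v′))
        (begin
          F₁ (w J.∘ (a J.∘ u)) ∘ f       ≈⟨ push ⟩
          F₁ (w J.∘ a) ∘ (F₁ u ∘ f)      ≈⟨ ∘-resp-≈ʳ p ⟩
          F₁ (w J.∘ a) ∘ (F₁ v ∘ g)      ≈⟨ push ⟨
          F₁ (w J.∘ (a J.∘ v)) ∘ g       ≈⟨ ∘-resp-≈ˡ (F-resp-≈ r) ⟩
          F₁ (w J.∘ (b J.∘ u′)) ∘ g      ≈⟨ push ⟩
          F₁ (w J.∘ b) ∘ (F₁ u′ ∘ g)     ≈⟨ ∘-resp-≈ʳ q ⟩
          F₁ (w J.∘ b) ∘ (F₁ v′ ∘ h)     ≈⟨ push ⟨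
          F₁ (w J.∘ (b J.∘ v′)) ∘ h      ∎)
        where
        push : ∀ {i l n n′} {w : n J.⇒ n′} {a : l J.⇒ n} {u : i J.⇒ l} {f : Z ⇒ F₀ i} →
               F₁ (w J.∘ (a J.∘ u)) ∘ f ≈ F₁ (w J.∘ a) ∘ (F₁ u ∘ f)
        push = ≈.trans (∘-resp-≈ˡ (≈.trans (F-resp-≈ (J.≈.sym J.assoc)) homomorphism)) assoc

    ∼-isEquivalence : IsEquivalence (_∼_ {Z} {W})
    ∼-isEquivalence = record { refl = ∼-refl ; sym = ∼-sym ; trans = ∼-trans }

    opaque
      ≈⇒∼ : ∀ {i} {f g : Z ⇒ F₀ i} → f ≈ g → _∼_ {W = W} (germ i f) (germ i g)
      ≈⇒∼ p = agree J.id J.id (∘-resp-≈ʳ p)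

      transition : ∀ {i j} (u : i J.⇒ j) {f : Z ⇒ F₀ i} →
                   _∼_ {W = W} (germ j (F₁ u ∘ f)) (germ i f)
      transition u = agree J.id u (≈.trans (∘-resp-≈ˡ identity) identityˡ)

  infixl 9 _·_

  _·_ : ∀ {Z Z′ W} → Germ Z W → Z′ ⇒ Z → Germ Z′ W
  germ i f · h = germ i (f ∘ h)

  opaque
    ·-resp : ∀ {Z Z′ W} {x y : Germ Z W} {h k : Z′ ⇒ Z} → x ∼ y → h ≈ k → x · h ∼ y · k
    ·-resp (agree u v p) q =
      agree u v (≈.trans (≈.sym assoc) (≈.trans (∘-resp-≈ p q) assoc))

  record IndHom (V W : IndObject C) : Set κ where
    private
      module V = IndObject V
    field
      comp   : ∀ i → Germ (V.F₀ i) W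
      natural : ∀ {i j} (u : i V.J.⇒ j) → comp j · V.F₁ u ∼ comp i

  infixr 9 _⊙_

  _⊙_ : ∀ {Z V W} → IndHom V W → Germ Z V → Germ Z W
  g ⊙ germ i f = IndHom.comp g i · f

  opaque
    ⊙-respʳ : ∀ {Z V W} (g : IndHom V W) {x y : Germ Z V} → x ∼ y → g ⊙ x ∼ g ⊙ y
    ⊙-respʳ {V = V} g {germ i f} {germ j f′} (agree u v p) =
      ∼-trans (∼-sym (along u)) (∼-trans (·-resp ∼-refl p) (along v))
      where
      open IndHom g
      module V = IndObject V
      along : ∀ {Z i k} (u : i V.J.⇒ k) {f : Z ⇒ V.F₀ i} →
              comp k · (V.F₁ u ∘ f) ∼ comp i · f
      along u = ∼-trans (≈⇒∼ (≈.sym assoc)) (·-resp (natural u) ≈.refl)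

Ind : Category o κ → Category (o ⊔ suc κ) κ
Ind C = record
  { Obj = IndObject C
  ; _⇒_ = IndHom
  ; _≈_ = λ f g → ∀ i → comp f i ∼ comp g i
  ; id = record
    { comp = λ i → germ i id
    ; natural = λ u → ∼-trans (≈⇒∼ (≈.trans identityˡ (≈.sym identityʳ))) (transition u) }
  ; _∘_ = λ g f → record
    { comp = λ i → g ⊙ comp f i
    ; natural = λ u → ∼-trans (≈⇒∼ assoc) (⊙-respʳ g (natural f u)) }
  ; equiv = record
    { refl = λ _ → ∼-refl
    ; sym = λ p i → ∼-sym (p i)
    ; trans = λ p q i → ∼-trans (p i) (q i) }
  ; assoc = λ _ → ≈⇒∼ assoc
  ; identityˡ = λ _ → ≈⇒∼ identityˡ
  ; identityʳ = λ _ → ≈⇒∼ identityʳ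
  ; ∘-resp-≈ = λ {_} {_} {_} {f} {f′} {g} {g′} p q i →
      ∼-trans (⊙-respʳ f (q i)) (·-resp (p (Germ.at (comp g′ i))) ≈.refl) }
  where
  open Category C
  open IndHom

y₀ : (C : Category o κ) → Category.Obj C → IndObject C
y₀ C X = record { index = One ; filtered = One-filtered ; diagram = const C X }

module _ {C : Category o κ} where
  open Category C

  opaque
    ∼⇒≈ : ∀ {Z X : Obj} {f g : Z ⇒ X} → _∼_ {W = y₀ C X} (germ tt f) (germ tt g) → f ≈ g
    ∼⇒≈ (agree _ _ p) = ≈.trans (≈.sym identityˡ) (≈.trans p identityˡ)

    ≈⇒∼y : ∀ {Z X : Obj} {f g : Z ⇒ X} → f ≈ g → _∼_ {W = y₀ C X} (germ tt f) (germ tt g)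
    ≈⇒∼y p = agree tt tt (∘-resp-≈ʳ p)

  mapIndObject : {D : Category o′ κ} → Functor C D → IndObject C → IndObject D
  mapIndObject F W = record
    { index = W.index ; filtered = W.filtered ; diagram = F ∘F W.diagram }
    where module W = IndObject W

  mapGerm : {D : Category o′ κ} (F : Functor C D) {Z : Obj} {W : IndObject C} →
            Germ Z W → Germ (Functor.F₀ F Z) (mapIndObject F W)
  mapGerm F (germ i f) = germ i (Functor.F₁ F f)

  opaque
    mapGerm-resp : {D : Category o′ κ} (F : Functor C D) {Z : Obj} {W : IndObject C}
                   {x y : Germ Z W} → x ∼ y → mapGerm F x ∼ mapGerm F y
    mapGerm-resp {D = D} F (agree u v p) =
      agree u v (D.≈.trans (D.≈.sym homomorphism) (D.≈.trans (F-resp-≈ p) homomorphism))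
      where open Functor F
            module D = Category D

mapInd : {C : Category o κ} {D : Category o′ κ} → Functor C D → Functor (Ind C) (Ind D)
mapInd {D = D} F = record
  { F₀ = mapIndObject F
  ; F₁ = λ f → record
    { comp = λ i → mapGerm F (comp f i)
    ; natural = λ u → ∼-trans (≈⇒∼ (≈.sym homomorphism)) (mapGerm-resp F (natural f u)) }
  ; identity = λ _ → ≈⇒∼ identity
  ; homomorphism = λ _ → ≈⇒∼ homomorphism
  ; F-resp-≈ = λ p i → mapGerm-resp F (p i) }
  where
  open Functor F
  open IndHom
  open Category D

-- A cofiltered inverse system in D is a filtered system in op D.
Pro : Category o κ → Category (o ⊔ suc κ) κ
Pro D = op (Ind (op D))

mapPro : {C : Category o κ} {D : Category o′ κ} → Functor C D → Functor (Pro C) (Pro D)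
mapPro F = opF (mapInd (opF F))

-- Products of ind-objects are computed termwise over the product of the
-- index categories.
module _ {C : Category o κ} (V W : IndObject C) where
  private
    module V = IndObject V
    module W = IndObject W
  open Category C

  module TermwiseProduct
    (P : Functor (V.index ×ᶜ W.index) C)
    (p : NatTrans P (V.diagram ∘F Fst {C = V.index} {D = W.index}))
    (q : NatTrans P (W.diagram ∘F Snd {C = V.index} {D = W.index}))
    (prod : ∀ ij → IsProduct C (NatTrans.η p ij) (NatTrans.η q ij)) where

    private
      module P = Functor P
      module p = NatTrans p
      module q = NatTrans q
      module × {ij} = IsProduct (prod ij)

    object : IndObject C
    object = record
      { index = V.index ×ᶜ W.index ; filtered = ×ᶜ-filtered V.filtered W.filtered ; diagram = P }

    proj₁ᵢ : IndHom object V
    proj₁ᵢ = record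
      { comp = λ (i , j) → germ i (p.η (i , j))
      ; natural = λ (u , v) → ∼-trans (≈⇒∼ (p.commute (u , v))) (transition u) }

    proj₂ᵢ : IndHom object W
    proj₂ᵢ = record
      { comp = λ (i , j) → germ j (q.η (i , j))
      ; natural = λ (u , v) → ∼-trans (≈⇒∼ (q.commute (u , v))) (transition v) }

    private
      ⟪_,_⟫ : ∀ {Z} → Germ Z V → Germ Z W → Germ Z object
      ⟪ germ i f , germ j g ⟫ = germ (i , j) ×.⟨ f , g ⟩

      ⟪⟫-resp : ∀ {Z} {x x′ : Germ Z V} {y y′ : Germ Z W} →
                x ∼ x′ → y ∼ y′ → ⟪ x , y ⟫ ∼ ⟪ x′ , y′ ⟫
      ⟪⟫-resp (agree u v r) (agree u′ v′ s) = agree (u , u′) (v , v′) (×.jointly-monic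
        (≈.trans step₁ (≈.trans r (≈.sym step₁)))
        (≈.trans step₂ (≈.trans s (≈.sym step₂))))
        where
        step₁ : ∀ {Z ij kl} {w : (V.index ×ᶜ W.index) [ ij , kl ]}
                {f : Z ⇒ V.F₀ (proj₁ ij)} {g : Z ⇒ W.F₀ (proj₂ ij)} →
                p.η kl ∘ (P.F₁ w ∘ ×.⟨ f , g ⟩) ≈ V.F₁ (proj₁ w) ∘ f
        step₁ {w = w} = ≈.trans (≈.sym assoc) (≈.trans (∘-resp-≈ˡ (p.commute w))
          (≈.trans assoc (∘-resp-≈ʳ ×.project₁)))
        step₂ : ∀ {Z ij kl} {w : (V.index ×ᶜ W.index) [ ij , kl ]}
                {f : Z ⇒ V.F₀ (proj₁ ij)} {g : Z ⇒ W.F₀ (proj₂ ij)} →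
                q.η kl ∘ (P.F₁ w ∘ ×.⟨ f , g ⟩) ≈ W.F₁ (proj₂ w) ∘ g
        step₂ {w = w} = ≈.trans (≈.sym assoc) (≈.trans (∘-resp-≈ˡ (q.commute w))
          (≈.trans assoc (∘-resp-≈ʳ ×.project₂)))

    isProductᵢ : IsProduct (Ind C) proj₁ᵢ proj₂ᵢ
    isProductᵢ = record
      { ⟨_,_⟩ = λ f g → record
        { comp = λ i → ⟪ comp f i , comp g i ⟫
        ; natural = λ u → ∼-trans (≈⇒∼ ×.⟨⟩∘) (⟪⟫-resp (natural f u) (natural g u)) }
      ; project₁ = λ _ → ≈⇒∼ ×.project₁
      ; project₂ = λ _ → ≈⇒∼ ×.project₂
      ; unique = λ r s i → ∼-sym
          (∼-trans (≈⇒∼ (≈.sym (×.unique ≈.refl ≈.refl))) (⟪⟫-resp (r i) (s i))) }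
      where open IndHom

y-terminal : {C : Category o κ} {X : Category.Obj C} →
             IsTerminal C X → IsTerminal (Ind C) (y₀ C X)
y-terminal {C = C} t = record
  { ! = record { comp = λ _ → germ tt ! ; natural = λ _ → ≈⇒∼ (≈.sym (!-unique _)) }
  ; !-unique = λ f i → ≈⇒∼ (!-unique _) }
  where open IsTerminal t
        open Category C

module _ {C : Category o κ} (cC : Cartesian C) where
  private
    module C = Category C
  open Cartesian cC

  ⊗-functor : Functor (C ×ᶜ C) C
  ⊗-functor = record
    { F₀ = λ (A , B) → A ⊗ B
    ; F₁ = λ (f , g) → f ⁂ g
    ; identity = unique (C.≈.trans C.identityʳ (C.≈.sym C.identityˡ))
                        (C.≈.trans C.identityʳ (C.≈.sym C.identityˡ))
    ; homomorphism = C.≈.sym (C.≈.trans ⁂∘⟨⟩ (⟨⟩-cong (C.≈.sym C.assoc) (C.≈.sym C.assoc)))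
    ; F-resp-≈ = λ (p , q) → ⟨⟩-cong (C.∘-resp-≈ˡ p) (C.∘-resp-≈ˡ q) }

  private
    module _ (V W : IndObject C) where
      private
        module V = IndObject V
        module W = IndObject W

      diagram⊗ : Functor (V.index ×ᶜ W.index) C
      diagram⊗ = ⊗-functor ∘F (V.diagram ×F W.diagram)

      π₁-nat : NatTrans diagram⊗ (V.diagram ∘F Fst {C = V.index} {D = W.index})
      π₁-nat = record { η = λ _ → π₁ ; commute = λ _ → project₁ }

      π₂-nat : NatTrans diagram⊗ (W.diagram ∘F Snd {C = V.index} {D = W.index})
      π₂-nat = record { η = λ _ → π₂ ; commute = λ _ → project₂ }

      module ⊗ᵢ = TermwiseProduct V W diagram⊗ π₁-nat π₂-nat (λ _ → isProduct)

  Ind-cartesian : Cartesian (Ind C)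
  Ind-cartesian = record
    { 𝟏 = y₀ C 𝟏
    ; isTerminal = y-terminal isTerminal
    ; _⊗_ = ⊗ᵢ.object
    ; π₁ = λ {V} {W} → ⊗ᵢ.proj₁ᵢ V W
    ; π₂ = λ {V} {W} → ⊗ᵢ.proj₂ᵢ V W
    ; isProduct = λ {V} {W} → ⊗ᵢ.isProductᵢ V W }

  mapInd-preserves : {D : Category o′ κ} {F : Functor C D} → PreservesProducts cC F →
                     PreservesProducts Ind-cartesian (mapInd F)
  mapInd-preserves {D = D} {F} pres = record
    { F-terminal = record
      { ! = λ {A} → record
        { comp = λ _ → germ tt T.!
        ; natural = λ _ → ≈⇒∼ (D.≈.sym (T.!-unique _)) }
      ; !-unique = λ f i → ≈⇒∼ (T.!-unique _) }
    ; F-product = λ {V} {W} → product V W }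
    where
    module D = Category D
    module F = Functor F
    module T = IsTerminal (PreservesProducts.F-terminal pres)
    square : ∀ {W X Y Z} {f : X C.⇒ Y} {g : W C.⇒ X} {h : Z C.⇒ Y} {k : W C.⇒ Z} →
             f C.∘ g C.≈ h C.∘ k → F.F₁ f D.∘ F.F₁ g D.≈ F.F₁ h D.∘ F.F₁ k
    square p = D.≈.trans (D.≈.sym F.homomorphism)
                         (D.≈.trans (F.F-resp-≈ p) F.homomorphism)
    module Indᶜ = Cartesian Ind-cartesian
    product : ∀ V W → IsProduct (Ind D)
      (Functor.F₁ (mapInd F) {V Indᶜ.⊗ W} {V} (Indᶜ.π₁ {V} {W}))
      (Functor.F₁ (mapInd F) {V Indᶜ.⊗ W} {W} (Indᶜ.π₂ {V} {W}))
    product V W = record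
      { ⟨_,_⟩ = λ {Z} → P.⟨_,_⟩ {Z}
      ; project₁ = λ {Z} {f} {g} → P.project₁ {Z} {f} {g}
      ; project₂ = λ {Z} {f} {g} → P.project₂ {Z} {f} {g}
      ; unique = λ {Z} {f} {g} {h} → P.unique {Z} {f} {g} {h} }
      where
      module V = IndObject V
      module W = IndObject W
      diagram : Functor (V.index ×ᶜ W.index) D
      diagram = F ∘F diagram⊗ V W
      Fπ₁ : NatTrans diagram ((F ∘F V.diagram) ∘F Fst {C = V.index} {D = W.index})
      Fπ₁ = record { η = λ _ → F.F₁ π₁ ; commute = λ _ → square project₁ }
      Fπ₂ : NatTrans diagram ((F ∘F W.diagram) ∘F Snd {C = V.index} {D = W.index})
      Fπ₂ = record { η = λ _ → F.F₁ π₂ ; commute = λ _ → square project₂ }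
      module P = IsProduct (TermwiseProduct.isProductᵢ (mapIndObject F V) (mapIndObject F W)
        diagram Fπ₁ Fπ₂ (λ _ → PreservesProducts.F-product pres))

module _ {C : Category o ℓ} (cC : Cartesian C) where
  open Category C
  open Cartesian cC
  open HomReasoning

  module MonoidElements (M : MonoidObject cC) where
    open MonoidObject M

    infixl 7 _∙_
    _∙_ : ∀ {Z} → Z ⇒ Carrier → Z ⇒ Carrier → Z ⇒ Carrier
    x ∙ y = μ ∘ ⟨ x , y ⟩

    ε : ∀ {Z} → Z ⇒ Carrier
    ε = η ∘ !

    ∙-cong : ∀ {Z} {x x′ y y′ : Z ⇒ Carrier} → x ≈ x′ → y ≈ y′ → x ∙ y ≈ x′ ∙ y′
    ∙-cong p q = ∘-resp-≈ʳ (⟨⟩-cong p q)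

    ∙∘ : ∀ {Y Z} {x y : Z ⇒ Carrier} {h : Y ⇒ Z} → (x ∙ y) ∘ h ≈ (x ∘ h) ∙ (y ∘ h)
    ∙∘ = ≈.trans assoc (∘-resp-≈ʳ ⟨⟩∘)

    ε∘ : ∀ {Y Z} {h : Y ⇒ Z} → ε ∘ h ≈ ε
    ε∘ = ≈.trans assoc (∘-resp-≈ʳ (≈.sym (!-unique _)))

    ∙-assoc : ∀ {Z} (x y z : Z ⇒ Carrier) → (x ∙ y) ∙ z ≈ x ∙ (y ∙ z)
    ∙-assoc x y z = begin
      (x ∙ y) ∙ z                                   ≈⟨ ∙-cong (∙-cong p₁ p₂) project₂ ⟨
      ((π₁ ∘ π₁) ∘ h ∙ (π₂ ∘ π₁) ∘ h) ∙ (π₂ ∘ h)    ≈⟨ ∙-cong ∙∘ ≈.refl ⟨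
      ((π₁ ∘ π₁) ∙ (π₂ ∘ π₁)) ∘ h ∙ (π₂ ∘ h)        ≈⟨ ∙∘ ⟨
      (((π₁ ∘ π₁) ∙ (π₂ ∘ π₁)) ∙ π₂) ∘ h            ≈⟨ ∘-resp-≈ˡ μ-assoc ⟩
      ((π₁ ∘ π₁) ∙ ((π₂ ∘ π₁) ∙ π₂)) ∘ h            ≈⟨ ∙∘ ⟩
      (π₁ ∘ π₁) ∘ h ∙ ((π₂ ∘ π₁) ∙ π₂) ∘ h          ≈⟨ ∙-cong ≈.refl ∙∘ ⟩
      (π₁ ∘ π₁) ∘ h ∙ ((π₂ ∘ π₁) ∘ h ∙ (π₂ ∘ h))    ≈⟨ ∙-cong p₁ (∙-cong p₂ project₂) ⟩
      x ∙ (y ∙ z)                                   ∎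
      where
      h : _ ⇒ (Carrier ⊗ Carrier) ⊗ Carrier
      h = ⟨ ⟨ x , y ⟩ , z ⟩
      p₁ : (π₁ ∘ π₁) ∘ h ≈ x
      p₁ = ≈.trans assoc (≈.trans (∘-resp-≈ʳ project₁) project₁)
      p₂ : (π₂ ∘ π₁) ∘ h ≈ y
      p₂ = ≈.trans assoc (≈.trans (∘-resp-≈ʳ project₁) project₂)

    ∙-identityˡ : ∀ {Z} (x : Z ⇒ Carrier) → ε ∙ x ≈ x
    ∙-identityˡ x = ≈.trans (∙-cong (≈.sym ε∘) (≈.sym identityˡ))
      (≈.trans (≈.sym ∙∘) (≈.trans (∘-resp-≈ˡ μ-identityˡ) identityˡ))

    ∙-identityʳ : ∀ {Z} (x : Z ⇒ Carrier) → x ∙ ε ≈ x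
    ∙-identityʳ x = ≈.trans (∙-cong (≈.sym identityˡ) (≈.sym ε∘))
      (≈.trans (≈.sym ∙∘) (≈.trans (∘-resp-≈ˡ μ-identityʳ) identityˡ))

  module GroupElements (G : GroupObject cC) where
    open GroupObject G
    open MonoidElements monoid public

    infix 8 _⁻¹
    _⁻¹ : ∀ {Z} → Z ⇒ Carrier → Z ⇒ Carrier
    x ⁻¹ = ι ∘ x

    ∙-inverseˡ : ∀ {Z} (x : Z ⇒ Carrier) → x ⁻¹ ∙ x ≈ ε
    ∙-inverseˡ x = ≈.trans (∙-cong ≈.refl (≈.sym identityˡ))
      (≈.trans (≈.sym ∙∘) (≈.trans (∘-resp-≈ˡ μ-inverseˡ) ε∘))

    ∙-inverseʳ : ∀ {Z} (x : Z ⇒ Carrier) → x ∙ x ⁻¹ ≈ ε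
    ∙-inverseʳ x = ≈.trans (∙-cong (≈.sym identityˡ) ≈.refl)
      (≈.trans (≈.sym ∙∘) (≈.trans (∘-resp-≈ˡ μ-inverseʳ) ε∘))

  module HomElements {M N : MonoidObject cC} (f : MonoidObjectHom cC M N) where
    open MonoidObjectHom f
    private
      module M = MonoidElements M
      module N = MonoidElements N

    hom-∙ : ∀ {Z} {x y : Z ⇒ MonoidObject.Carrier M} →
            hom ∘ (x M.∙ y) ≈ (hom ∘ x) N.∙ (hom ∘ y)
    hom-∙ = ≈.trans (≈.sym assoc) (≈.trans (∘-resp-≈ˡ hom-μ)
              (≈.trans assoc (∘-resp-≈ʳ ⁂∘⟨⟩)))

    hom-ε : ∀ {Z} → hom ∘ M.ε {Z} ≈ N.ε
    hom-ε = ≈.trans (≈.sym assoc) (∘-resp-≈ˡ hom-η)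

  module _ {M N : GroupObject cC}
           (f : MonoidObjectHom cC (GroupObject.monoid M) (GroupObject.monoid N)) where
    open MonoidObjectHom f
    open HomElements f
    private
      module M = GroupElements M
      module N = GroupElements N

    hom-⁻¹ : ∀ {Z} {x : Z ⇒ GroupObject.Carrier M} → hom ∘ (x M.⁻¹) ≈ (hom ∘ x) N.⁻¹
    hom-⁻¹ {x = x} = begin
      hom ∘ (x M.⁻¹)                                       ≈⟨ N.∙-identityʳ _ ⟨
      (hom ∘ (x M.⁻¹)) N.∙ N.ε                             ≈⟨ N.∙-cong ≈.refl (N.∙-inverseʳ _) ⟨
      (hom ∘ (x M.⁻¹)) N.∙ ((hom ∘ x) N.∙ (hom ∘ x) N.⁻¹)  ≈⟨ N.∙-assoc _ _ _ ⟨
      ((hom ∘ (x M.⁻¹)) N.∙ (hom ∘ x)) N.∙ (hom ∘ x) N.⁻¹  ≈⟨ N.∙-cong hom-∙ ≈.refl ⟨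
      (hom ∘ (x M.⁻¹ M.∙ x)) N.∙ (hom ∘ x) N.⁻¹
        ≈⟨ N.∙-cong (≈.trans (∘-resp-≈ʳ (M.∙-inverseˡ x)) hom-ε) ≈.refl ⟩
      N.ε N.∙ (hom ∘ x) N.⁻¹                               ≈⟨ N.∙-identityˡ _ ⟩
      (hom ∘ x) N.⁻¹                                       ∎

-- A pro-monoid (pro-group) is given by a cofiltered inverse system of
-- monoid (group) objects; the pro-object it represents is obtained by
-- forgetting the structure termwise.
ProMonoid : {D : Category o κ} → Cartesian D → Set (o ⊔ suc κ)
ProMonoid cD = Category.Obj (Pro (Mon cD))

ProGroup : {D : Category o κ} → Cartesian D → Set (o ⊔ suc κ)
ProGroup cD = Category.Obj (Pro (Grp cD))

module _ {D : Category o κ} (cD : Cartesian D) where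
  open Category D
  open Cartesian cD

  𝟏ₚ : Category.Obj (Pro D)
  𝟏ₚ = y₀ (op D) 𝟏

  𝟏ₚ-isTerminal : IsTerminal (Pro D) 𝟏ₚ
  𝟏ₚ-isTerminal = record
    { ! = λ {A} → record
      { comp = λ _ → germ (IndObject.point A) ! ; natural = λ _ → ≈⇒∼ (≈.sym (!-unique _)) }
    ; !-unique = λ {A} f i →
        let _ , u , v = IndObject.bound A (IndObject.point A) (Germ.at (IndHom.comp f i))
        in agree u v (≈.trans (≈.sym (!-unique _)) (!-unique _)) }

  private
    at : ∀ {N} → Pro D [ 𝟏ₚ , N ] → ∀ j → 𝟏 ⇒ IndObject.F₀ N j
    at x j = Germ.arr (IndHom.comp x j)

    compatible : ∀ {N} (x : Pro D [ 𝟏ₚ , N ]) {i j} (u : IndObject.J._⇒_ N i j) →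
                 IndObject.F₁ N u ∘ at x j ≈ at x i
    compatible x u = ∼⇒≈ (IndHom.natural x u)

    element : ∀ {N} (x : ∀ j → 𝟏 ⇒ IndObject.F₀ N j) →
              (∀ {i j} (u : IndObject.J._⇒_ N i j) → IndObject.F₁ N u ∘ x j ≈ x i) →
              Pro D [ 𝟏ₚ , N ]
    element x p = record { comp = λ j → germ tt (x j) ; natural = λ u → ≈⇒∼y (p u) }

  Γᴹ : ProMonoid cD → Monoid κ κ
  Γᴹ N = record
    { Carrier = Pro D [ 𝟏ₚ , ∣N∣ ]
    ; _≈_ = Category._≈_ (Pro D) {𝟏ₚ} {∣N∣}
    ; _∙_ = λ x y → element (λ j → E._∙_ j (at x j) (at y j))
        (λ u → ≈.trans (H.hom-∙ u) (E.∙-cong _ (compatible x u) (compatible y u)))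
    ; ε = element (λ j → E.ε j) (λ u → H.hom-ε u)
    ; isMonoid = record
      { isSemigroup = record
        { isMagma = record
          { isEquivalence = Category.equiv (Pro D) {𝟏ₚ} {∣N∣}
          ; ∙-cong = λ p q j → ≈⇒∼y (E.∙-cong j (∼⇒≈ (p j)) (∼⇒≈ (q j))) }
        ; assoc = λ x y z j → ≈⇒∼y (E.∙-assoc j _ _ _) }
      ; identity = (λ x j → ≈⇒∼y (E.∙-identityˡ j _)) , (λ x j → ≈⇒∼y (E.∙-identityʳ j _)) } }
    where
    ∣N∣ : Category.Obj (Pro D)
    ∣N∣ = Functor.F₀ (mapPro (Mon⇒C cD)) N
    module N = IndObject N
    module E j = MonoidElements cD (N.F₀ j)
    module H {i j} (u : i N.J.⇒ j) = HomElements cD (N.F₁ u)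

  Γᴳ : ProGroup cD → Group κ κ
  Γᴳ N = record
    { Carrier = Pro D [ 𝟏ₚ , ∣N∣ ]
    ; _≈_ = Category._≈_ (Pro D) {𝟏ₚ} {∣N∣}
    ; _∙_ = Monoid._∙_ ΓN
    ; ε = Monoid.ε ΓN
    ; _⁻¹ = λ x → element (λ j → E._⁻¹ j (at x j))
        (λ {i} {j} u → ≈.trans (hom-⁻¹ cD {N.F₀ j} {N.F₀ i} (N.F₁ u)) (∘-resp-≈ʳ (compatible {∣N∣} x u)))
    ; isGroup = record
      { isMonoid = Monoid.isMonoid ΓN
      ; inverse = (λ x j → ≈⇒∼y (E.∙-inverseˡ j _)) , (λ x j → ≈⇒∼y (E.∙-inverseʳ j _))
      ; ⁻¹-cong = λ p j → ≈⇒∼y (∘-resp-≈ʳ {f = GroupObject.ι (N.F₀ j)} (∼⇒≈ (p j))) } }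
    where
    ΓN : Monoid κ κ
    ΓN = Γᴹ (Functor.F₀ (mapPro (Grp⇒Mon cD)) N)
    ∣N∣ : Category.Obj (Pro D)
    ∣N∣ = Functor.F₀ (mapPro (Mon⇒C cD)) (Functor.F₀ (mapPro (Grp⇒Mon cD)) N)
    module N = IndObject N
    module E j = GroupElements cD (N.F₀ j)

Presheaf : Category o κ → Set (o ⊔ suc κ)
Presheaf {κ = κ} C = Functor (op C) (Setoids κ)

⟦_⟧ : {C : Category o κ} → IndObject C → Presheaf C
⟦_⟧ {C = C} W = record
  { F₀ = λ Z → record { isEquivalence = ∼-isEquivalence {Z = Z} {W} }
  ; F₁ = λ f → record { to = _· f ; cong = λ p → ·-resp p ≈.refl }
  ; identity = λ _ → ≈⇒∼ identityʳ
  ; homomorphism = λ _ → ≈⇒∼ (≈.sym assoc)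
  ; F-resp-≈ = λ p _ → ·-resp ∼-refl p }
  where open Category C

module _ {C : Category o κ} (cC : Cartesian C) where
  open Category C
  open Cartesian cC

  Hom : Obj → Obj → Presheaf C
  Hom X Y = record
    { F₀ = λ Z → hom-setoid (Z ⊗ X) Y
    ; F₁ = λ f → record { to = _∘ (f ⁂ id) ; cong = ∘-resp-≈ˡ }
    ; identity = λ _ → ≈.trans (∘-resp-≈ʳ (Functor.identity (⊗-functor cC))) identityʳ
    ; homomorphism = λ _ → ≈.trans (∘-resp-≈ʳ (≈.trans
        (⟨⟩-cong ≈.refl (∘-resp-≈ˡ (≈.sym identityˡ)))
        (Functor.homomorphism (⊗-functor cC)))) (≈.sym assoc)
    ; F-resp-≈ = λ p _ → ∘-resp-≈ʳ (⟨⟩-cong (∘-resp-≈ˡ p) ≈.refl) }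

record IndClosed (C : Category o κ) : Set (suc 0ℓ ⊔ o ⊔ suc κ) where
  open Category C
  field
    finiteLimits : HasFiniteLimits C

  cart : Cartesian C
  cart = cartesian finiteLimits

  field
    hom            : Obj → Obj → IndObject C
    represents     : ∀ X Y → NatTrans ⟦ hom X Y ⟧ (Hom cart X Y)
    represents-iso : ∀ X Y → IsNatIso (represents X Y)

  cartᵢ : Cartesian (Ind C)
  cartᵢ = Ind-cartesian cart

  open Cartesian cartᵢ using (_⊗_)

  eval : ∀ X Y → Ind C [ hom X Y ⊗ y₀ C X , y₀ C Y ]
  eval X Y = record
    { comp = λ (i , _) → germ tt (Func.to (η (W.F₀ i)) (germ i id))
    ; natural = λ {(i , _)} {(j , _)} (u , _) → ≈⇒∼y (≈.trans
        (≈.sym (commute (W.F₁ u) (germ j id)))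
        (Func.cong (η (W.F₀ i)) (∼-trans
          (≈⇒∼ (≈.trans identityˡ (≈.sym identityʳ))) (transition u)))) }
    where
    module W = IndObject (hom X Y)
    open NatTrans (represents X Y)

module _ {C : Category o κ} {E : Category o′ κ} (closed : IndClosed C)
         (cE : Cartesian E) {H : Functor C E} (pres : PreservesProducts (IndClosed.cart closed) H)
         where
  private
    module C = Category C
  open IndClosed closed using (hom; eval)
  open Category E
  open Cartesian cE
  open Functor H
  open HomReasoning

  -- A generalised element f : Z → H (hom X Y) goes to the composite
  -- Z × H X → H (hom X Y) × H X ≅ H (hom X Y × X) → H Y,
  -- whose last map is H applied to the evaluation.
  comparison : ∀ X Y → NatTrans ⟦ mapIndObject H (hom X Y) ⟧ (Hom cE (F₀ X) (F₀ Y))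
  comparison X Y = record
    { η = λ Z → record
      { to = λ (germ i f) → ev i ∘ (φ cE pres ∘ (f ⁂ id))
      ; cong = λ { {germ i f} {germ j g} (agree u v p) → ≈.trans (along u)
          (≈.trans (∘-resp-≈ʳ (∘-resp-≈ʳ (⟨⟩-cong (∘-resp-≈ˡ p) ≈.refl))) (≈.sym (along v))) } }
    ; commute = λ f (germ i g) → ≈.trans
        (∘-resp-≈ʳ (≈.trans (∘-resp-≈ʳ (≈.sym (≈.trans ⁂∘⟨⟩
          (⟨⟩-cong (≈.sym assoc) (≈.trans (∘-resp-≈ʳ identityˡ) ≈.refl)))))
          (≈.sym assoc)))
        (≈.sym assoc) }
    where
    module W = IndObject (hom X Y)
    module cC = Cartesian (IndClosed.cart closed)

    hom×X : IndObject C
    hom×X = Cartesian._⊗_ (IndClosed.cartᵢ closed) (hom X Y) (y₀ C X)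

    H-eval : Ind E [ mapIndObject H hom×X , mapIndObject H (y₀ C Y) ]
    H-eval = Functor.F₁ (mapInd H) {hom×X} {y₀ C Y} (eval X Y)

    ev : ∀ i → F₀ (W.F₀ i cC.⊗ X) ⇒ F₀ Y
    ev i = Germ.arr (IndHom.comp H-eval (i , tt))

    ev-natural : ∀ {i j} (u : i W.J.⇒ j) → ev j ∘ F₁ (W.F₁ u cC.⁂ C.id) ≈ ev i
    ev-natural u = ≈.trans (≈.sym homomorphism)
      (F-resp-≈ (∼⇒≈ (IndHom.natural (eval X Y) (u , tt))))

    along : ∀ {Z i j} (u : i W.J.⇒ j) {f : Z ⇒ F₀ (W.F₀ i)} →
            ev i ∘ (φ cE pres ∘ (f ⁂ id)) ≈ ev j ∘ (φ cE pres ∘ ((F₁ (W.F₁ u) ∘ f) ⁂ id))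
    along {i = i} {j} u {f} = begin
      ev i ∘ k                                              ≈⟨ ∘-resp-≈ˡ (ev-natural u) ⟨
      (ev j ∘ F₁ (W.F₁ u cC.⁂ C.id)) ∘ k                    ≈⟨ assoc ⟩
      ev j ∘ (F₁ (W.F₁ u cC.⁂ C.id) ∘ k)                    ≈⟨ ∘-resp-≈ʳ (φ-natural cE pres) ⟨
      ev j ∘ (φ cE pres ∘ ⟨ F₁ (W.F₁ u C.∘ cC.π₁) ∘ k , F₁ (C.id C.∘ cC.π₂) ∘ k ⟩)
        ≈⟨ ∘-resp-≈ʳ (∘-resp-≈ʳ (⟨⟩-cong first second)) ⟩
      ev j ∘ (φ cE pres ∘ ((F₁ (W.F₁ u) ∘ f) ⁂ id))         ∎
      where
      module P {A B : C.Obj} = IsProduct (PreservesProducts.F-product pres {A} {B})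
      k : _ ⇒ F₀ (W.F₀ i cC.⊗ X)
      k = φ cE pres ∘ (f ⁂ id)
      first : F₁ (W.F₁ u C.∘ cC.π₁) ∘ k ≈ (F₁ (W.F₁ u) ∘ f) ∘ π₁
      first = begin
        F₁ (W.F₁ u C.∘ cC.π₁) ∘ k              ≈⟨ ∘-resp-≈ˡ homomorphism ⟩
        (F₁ (W.F₁ u) ∘ F₁ cC.π₁) ∘ k           ≈⟨ assoc ⟩
        F₁ (W.F₁ u) ∘ (F₁ cC.π₁ ∘ k)           ≈⟨ ∘-resp-≈ʳ (∘-resp-≈ʳ (φ∘⟨⟩ cE pres)) ⟩
        F₁ (W.F₁ u) ∘ (F₁ cC.π₁ ∘ P.⟨ f ∘ π₁ , id ∘ π₂ ⟩)  ≈⟨ ∘-resp-≈ʳ P.project₁ ⟩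
        F₁ (W.F₁ u) ∘ (f ∘ π₁)                 ≈⟨ assoc ⟨
        (F₁ (W.F₁ u) ∘ f) ∘ π₁                 ∎
      second : F₁ (C.id C.∘ cC.π₂) ∘ k ≈ id ∘ π₂
      second = begin
        F₁ (C.id C.∘ cC.π₂) ∘ k                ≈⟨ ∘-resp-≈ (F-resp-≈ C.identityˡ) (φ∘⟨⟩ cE pres) ⟩
        F₁ cC.π₂ ∘ P.⟨ f ∘ π₁ , id ∘ π₂ ⟩      ≈⟨ P.project₂ ⟩
        id ∘ π₂                                ∎

record IsClosed {C : Category o κ} {E : Category o′ κ} (closed : IndClosed C)
                (limE : HasFiniteLimits E) (H : Functor C E) : Set (suc 0ℓ ⊔ o ⊔ o′ ⊔ κ) where
  field
    preservesLimits : PreservesFiniteLimits H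

  preserves× : PreservesProducts (IndClosed.cart closed) H
  preserves× = preservesProducts (IndClosed.finiteLimits closed) preservesLimits

  field
    comparison-iso : ∀ X Y → IsNatIso (comparison closed (cartesian limE) preserves× X Y)

module _ {C : Category o κ} {E : Category o′ κ} (closed : IndClosed C)
         (limE : HasFiniteLimits E) {H : Functor C E} (H-closed : IsClosed closed limE H) where
  private
    presᵢ : PreservesProducts (IndClosed.cartᵢ closed) (mapInd H)
    presᵢ = mapInd-preserves (IndClosed.cart closed) {F = H} (IsClosed.preserves× H-closed)

    cEᵢ : Cartesian (Ind E)
    cEᵢ = Ind-cartesian (cartesian limE)

  mapProMonoid : ProMonoid (IndClosed.cartᵢ closed) → ProMonoid cEᵢ
  mapProMonoid = Functor.F₀ (mapPro (mapMon cEᵢ {F = mapInd H} presᵢ))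

  mapProGroup : ProGroup (IndClosed.cartᵢ closed) → ProGroup cEᵢ
  mapProGroup = Functor.F₀ (mapPro (mapGrp cEᵢ {F = mapInd H} presᵢ))

module _ {C₀ : Category o″ ℓ″} {C : Category o ℓ} {E : Category o′ ℓ′}
         (H : Functor C E) (I : Functor C₀ C) where
  private
    module C = Category C
    module C₀ = Category C₀
    module I = Functor I
  open Category E
  open Functor H

  record RelativeEnd : Set (o ⊔ ℓ ⊔ o′ ⊔ ℓ′ ⊔ o″) where
    field
      transformation : NatTrans H H
    open NatTrans transformation public
    field
      fixes : ∀ (X₀ : C₀.Obj) → η (I.F₀ X₀) ≈ id

  record RelativeAut : Set (o ⊔ ℓ ⊔ o′ ⊔ ℓ′ ⊔ o″) where
    field
      end   : RelativeEnd
    open RelativeEnd end public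
    field
      isIso : IsNatIso transformation
    module isIso X = IsIso (isIso X)

  private
    idᴱ : RelativeEnd
    idᴱ = record
      { transformation = record
        { η = λ _ → id ; commute = λ _ → ≈.trans identityˡ (≈.sym identityʳ) }
      ; fixes = λ _ → ≈.refl }

    _∘ᴱ_ : RelativeEnd → RelativeEnd → RelativeEnd
    t ∘ᴱ s = record
      { transformation = record
        { η = λ X → t.η X ∘ s.η X
        ; commute = λ f → ≈.trans assoc (≈.trans (∘-resp-≈ʳ (s.commute f))
            (≈.trans (≈.sym assoc) (≈.trans (∘-resp-≈ˡ (t.commute f)) assoc))) }
      ; fixes = λ X₀ → ≈.trans (∘-resp-≈ (t.fixes X₀) (s.fixes X₀)) identityˡ }
      where module t = RelativeEnd t
            module s = RelativeEnd s

    cancel : ∀ {A B} {f : A ⇒ B} {g : B ⇒ A} {X Y} {h : Y ⇒ B} {k : B ⇒ X} →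
             f ∘ g ≈ id → (k ∘ f) ∘ (g ∘ h) ≈ k ∘ h
    cancel p = ≈.trans assoc (∘-resp-≈ʳ
      (≈.trans (≈.sym assoc) (≈.trans (∘-resp-≈ˡ p) identityˡ)))

    idᴬ : RelativeAut
    idᴬ = record
      { end = idᴱ ; isIso = λ _ → record { inv = id ; isoˡ = identityˡ ; isoʳ = identityˡ } }

    _∘ᴬ_ : RelativeAut → RelativeAut → RelativeAut
    t ∘ᴬ s = record
      { end = t.end ∘ᴱ s.end
      ; isIso = λ X → record
        { inv = s.isIso.inv X ∘ t.isIso.inv X
        ; isoˡ = ≈.trans (cancel (t.isIso.isoˡ X)) (s.isIso.isoˡ X)
        ; isoʳ = ≈.trans (cancel (s.isIso.isoʳ X)) (t.isIso.isoʳ X) } }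
      where module t = RelativeAut t
            module s = RelativeAut s

    _⁻¹ᴬ : RelativeAut → RelativeAut
    t ⁻¹ᴬ = record
      { end = record
        { transformation = record
          { η = inv
          ; commute = λ {X} {Y} f → begin
              inv Y ∘ F₁ f                      ≈⟨ identityʳ ⟨
              (inv Y ∘ F₁ f) ∘ id               ≈⟨ ∘-resp-≈ʳ (isoʳ X) ⟨
              (inv Y ∘ F₁ f) ∘ (η X ∘ inv X)    ≈⟨ assoc ⟨
              ((inv Y ∘ F₁ f) ∘ η X) ∘ inv X    ≈⟨ ∘-resp-≈ˡ assoc ⟩
              (inv Y ∘ (F₁ f ∘ η X)) ∘ inv X    ≈⟨ ∘-resp-≈ˡ (∘-resp-≈ʳ (commute f)) ⟨
              (inv Y ∘ (η Y ∘ F₁ f)) ∘ inv X    ≈⟨ ∘-resp-≈ˡ assoc ⟨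
              ((inv Y ∘ η Y) ∘ F₁ f) ∘ inv X    ≈⟨ ∘-resp-≈ˡ (∘-resp-≈ˡ (isoˡ Y)) ⟩
              (id ∘ F₁ f) ∘ inv X               ≈⟨ ∘-resp-≈ˡ identityˡ ⟩
              F₁ f ∘ inv X                      ∎ }
        ; fixes = λ X₀ → ≈.trans (≈.sym identityʳ)
            (≈.trans (∘-resp-≈ʳ (≈.sym (fixes X₀))) (isoˡ (I.F₀ X₀))) }
      ; isIso = λ X → record { inv = η X ; isoˡ = isoʳ X ; isoʳ = isoˡ X } }
      where open RelativeAut t
            open isIso
            open HomReasoning

  End : Monoid (o ⊔ ℓ ⊔ o′ ⊔ ℓ′ ⊔ o″) (o ⊔ ℓ′)
  End = record
    { Carrier = RelativeEnd
    ; _≈_ = λ t s → ∀ X → RelativeEnd.η t X ≈ RelativeEnd.η s X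
    ; _∙_ = _∘ᴱ_
    ; ε = idᴱ
    ; isMonoid = record
      { isSemigroup = record
        { isMagma = record
          { isEquivalence = record
            { refl = λ _ → ≈.refl ; sym = λ p X → ≈.sym (p X)
            ; trans = λ p q X → ≈.trans (p X) (q X) }
          ; ∙-cong = λ p q X → ∘-resp-≈ (p X) (q X) }
        ; assoc = λ _ _ _ _ → assoc }
      ; identity = (λ _ _ → identityˡ) , (λ _ _ → identityʳ) } }

  Aut : Group (o ⊔ ℓ ⊔ o′ ⊔ ℓ′ ⊔ o″) (o ⊔ ℓ′)
  Aut = record
    { Carrier = RelativeAut
    ; _≈_ = λ t s → ∀ X → RelativeAut.η t X ≈ RelativeAut.η s X
    ; _∙_ = _∘ᴬ_
    ; ε = idᴬ
    ; _⁻¹ = _⁻¹ᴬ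
    ; isGroup = record
      { isMonoid = record
        { isSemigroup = record
          { isMagma = record
            { isEquivalence = record
              { refl = λ _ → ≈.refl ; sym = λ p X → ≈.sym (p X)
              ; trans = λ p q X → ≈.trans (p X) (q X) }
            ; ∙-cong = λ p q X → ∘-resp-≈ (p X) (q X) }
          ; assoc = λ _ _ _ _ → assoc }
        ; identity = (λ _ _ → identityˡ) , (λ _ _ → identityʳ) }
      ; inverse = (λ t X → RelativeAut.isIso.isoˡ t X) , (λ t X → RelativeAut.isIso.isoʳ t X)
      ; ⁻¹-cong = λ {t} {s} p X → inv-unique
          (RelativeAut.isIso.isoˡ t X) (RelativeAut.isIso.isoʳ s X) (p X) } }
    where
    inv-unique : ∀ {A B} {f f′ : A ⇒ B} {g g′ : B ⇒ A} →
                 g ∘ f ≈ id → f′ ∘ g′ ≈ id → f ≈ f′ → g ≈ g′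
    inv-unique p q r = ≈.trans (≈.sym identityʳ) (≈.trans (∘-resp-≈ʳ (≈.sym q))
      (≈.trans (≈.sym assoc) (≈.trans (∘-resp-≈ˡ
        (≈.trans (∘-resp-≈ʳ (≈.sym r)) p)) identityˡ)))

infix 4 _≅ᴹ_ _≅ᴳ_

_≅ᴹ_ : Monoid o ℓ → Monoid o′ ℓ′ → Set (o ⊔ ℓ ⊔ o′ ⊔ ℓ′)
M ≅ᴹ N = Σ[ f ∈ (M.Carrier → N.Carrier) ]
         MonoidMorphisms.IsMonoidIsomorphism M.rawMonoid N.rawMonoid f
  where module M = Monoid M
        module N = Monoid N

_≅ᴳ_ : Group o ℓ → Group o′ ℓ′ → Set (o ⊔ ℓ ⊔ o′ ⊔ ℓ′)
G ≅ᴳ K = Σ[ f ∈ (G.Carrier → K.Carrier) ]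
         GroupMorphisms.IsGroupIsomorphism G.rawGroup K.rawGroup f
  where module G = Group G
        module K = Group K

module Submission where

-- A natural endomorphism of H fixing I is a family of endomorphisms of the
-- objects H X, with X in a small set of representatives, subject to equations
-- each of which involves at most two members.  For a finite set of such X and
-- of such equations, the families in question are the points of H (M₀), where
-- the monoid object M₀ in ind-objects is an iterated equalizer between finite
-- products of internal Homs: H preserves all of these.  The finite systems of
-- unknowns and equations form a cofiltered category, whose inverse system of
-- monoids is M.  For cofilteredness one adds equations identifying two unknowns
-- attached to the same X.  The terms of G are the objects of units of those of
-- M, that is, equalizers in M₀ × M₀.
--
-- The universal property of M₀ is a case of that of F M₀, for any functor F
-- that preserves these constructions: the one where F is the identity.

open import Defs
open import Level using (Level; _⊔_; 0ℓ)
open import Algebra.Bundles using (Monoid; Group)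
open import Algebra.Morphism.Structures using (module MonoidMorphisms; module GroupMorphisms)
import Algebra.Properties.Group as GroupProperties
open import Data.Empty.Polymorphic using (⊥)
open import Data.Fin.Base using (Fin) renaming (zero to fzero; suc to fsuc)
open import Data.List.Base using (List; []; _∷_; _++_; map)
open import Data.List.Relation.Unary.All as All using (All; []; _∷_)
import Data.List.Relation.Unary.All.Properties as Allₚ
open import Data.Nat.Base using (ℕ)
open import Data.Product.Base using (Σ; Σ-syntax; _×_; _,_; proj₁; proj₂)
open import Data.Sum.Base using (_⊎_; inj₁; inj₂; [_,_]′)
open import Data.Unit.Polymorphic.Base using (⊤; tt)
open import Function.Bundles using (Inverse; Func)
import Function.Construct.Identity as Identity
open import Relation.Binary.PropositionalEquality.Core as ≡ using (_≡_)
open import Relation.Binary.PropositionalEquality.Properties as ≡ₚ using ()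

-- The obstacle is that `Ind C` is closed only in part: internal Homs are given only between objects
-- of `C`, and only there is `H` known to respect them. So exponentials are axiomatized for a family
-- of objects `X` indexed by vertices, with one universal property to be verified twice, for `Ind C`
-- and for `mapInd H`. Representability speaks of parameters in `C` or `E`; it passes to ind-objects
-- as parameters term by term. Equalizers of ind-objects need an index category of their own,
-- because two parallel ind-maps have no common level to begin with.
--
-- An arrow between systems is a map between objects of solutions, not a map between sets of
-- unknowns. Two different maps of unknowns stay different whatever equations are added, whereas the
-- restrictions that they induce become equal as soon as the unknowns are equated.
--
-- The group case is formal: an endomorphism is invertible exactly when its point of `M` is, and its
-- inverse again fixes the values of `I`. It remains to see that the points of `G` are the
-- invertible points of `M`.

private
  variable
    o o′ κ : Level

-- Equalizers, and maps depending on a parameter.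

module _ (D : Category o κ) where
  open Category D

  record IsEqualizer {E A B : Obj} (f g : A ⇒ B) (e : E ⇒ A) : Set (o ⊔ κ) where
    field
      equality : f ∘ e ≈ g ∘ e
      factor   : ∀ {Z} (h : Z ⇒ A) → f ∘ h ≈ g ∘ h → Z ⇒ E
      factor-β : ∀ {Z} {h : Z ⇒ A} (p : f ∘ h ≈ g ∘ h) → e ∘ factor h p ≈ h
      monic    : ∀ {Z} {h k : Z ⇒ E} → e ∘ h ≈ e ∘ k → h ≈ k

idF : {D : Category o κ} → Functor D D
idF {D = D} = record
  { F₀ = λ X → X ; F₁ = λ f → f
  ; identity = ≈.refl ; homomorphism = ≈.refl ; F-resp-≈ = λ p → p }
  where open Category D

idF-preserves× : {D : Category o κ} (cD : Cartesian D) → PreservesProducts cD (idF {D = D})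
idF-preserves× cD = record { F-terminal = isTerminal ; F-product = isProduct }
  where open Cartesian cD

-- A map W × A → B is a map A → B parametrised by W.
module Slice {D : Category o κ} (cD : Cartesian D) where
  open Category D
  open Cartesian cD
  open HomReasoning

  infixr 8 _⋆_

  -- Composition in the co-Kleisli category of the comonad `W ⊗ -`: its identities are the `π₂`, and
  -- `lift` is the functor to it from the base category.
  _⋆_ : ∀ {W A B C} → W ⊗ B ⇒ C → W ⊗ A ⇒ B → W ⊗ A ⇒ C
  g ⋆ f = g ∘ ⟨ π₁ , f ⟩

  lift : ∀ {W A B} → A ⇒ B → W ⊗ A ⇒ B
  lift f = f ∘ π₂

  module _ {W : Obj} where

    ⋆-cong : ∀ {A B C} {g g′ : W ⊗ B ⇒ C} {f f′ : W ⊗ A ⇒ B} → g ≈ g′ → f ≈ f′ → g ⋆ f ≈ g′ ⋆ f′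
    ⋆-cong p q = ∘-resp-≈ p (⟨⟩-cong ≈.refl q)

    ⋆-assoc : ∀ {A B C E} {h : W ⊗ C ⇒ E} {g : W ⊗ B ⇒ C} {f : W ⊗ A ⇒ B} →
              (h ⋆ g) ⋆ f ≈ h ⋆ (g ⋆ f)
    ⋆-assoc = ≈.trans assoc (∘-resp-≈ʳ (≈.trans ⟨⟩∘ (⟨⟩-cong project₁ ≈.refl)))

    ⋆-identityˡ : ∀ {A B} {f : W ⊗ A ⇒ B} → π₂ ⋆ f ≈ f
    ⋆-identityˡ = project₂

    ⋆-identityʳ : ∀ {A B} {f : W ⊗ A ⇒ B} → f ⋆ π₂ ≈ f
    ⋆-identityʳ = ≈.trans (∘-resp-≈ʳ (unique identityʳ identityʳ)) identityʳ

    lift-∘ : ∀ {A B C} {g : B ⇒ C} {f : A ⇒ B} → lift {W} (g ∘ f) ≈ lift g ⋆ lift f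
    lift-∘ = ≈.sym (≈.trans assoc (≈.trans (∘-resp-≈ʳ project₂) (≈.sym assoc)))

    lift-id : ∀ {A} → lift {W} (id {A}) ≈ π₂
    lift-id = identityˡ

-- An element x : W → F A of a parameter object turns maps parametrised
-- by A into maps parametrised by W, functorially.
module Transport {D : Category o κ} {D′ : Category o′ κ} (cD : Cartesian D) (cD′ : Cartesian D′)
                 (F : Functor D D′) (pres : PreservesProducts cD F) where
  private
    module D = Category D
    module cD = Cartesian cD
    module S = Slice cD
    module P {A B : D.Obj} = IsProduct (PreservesProducts.F-product pres {A} {B})
  open Category D′
  open Cartesian cD′
  open Functor F
  open HomReasoning
  open Slice cD′

  infixl 10 _⟪_⟫

  -- The pairing lands in `F₀ (A ⊗ A₁)`, whose product cone is the image of that in `D`, so that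
  -- `F₁ s` applies to it directly. For `F` the identity this is reindexing of the parameter along
  -- `x`.
  _⟪_⟫ : ∀ {W A A₁ A₂} → A cD.⊗ A₁ D.⇒ A₂ → W ⇒ F₀ A → W ⊗ F₀ A₁ ⇒ F₀ A₂
  s ⟪ x ⟫ = F₁ s ∘ P.⟨ x ∘ π₁ , π₂ ⟩

  ⟪⟫-cong : ∀ {W A A₁ A₂} {s r : A cD.⊗ A₁ D.⇒ A₂} {x y : W ⇒ F₀ A} →
            s D.≈ r → x ≈ y → s ⟪ x ⟫ ≈ r ⟪ y ⟫
  ⟪⟫-cong p q = ∘-resp-≈ (F-resp-≈ p) (P.⟨⟩-cong (∘-resp-≈ˡ q) ≈.refl)

  private
    F-pair : ∀ {Z A B₁ B₂} {f : A D.⇒ B₁} {g : A D.⇒ B₂} {k : Z ⇒ F₀ A} →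
             F₁ cD.⟨ f , g ⟩ ∘ k ≈ P.⟨ F₁ f ∘ k , F₁ g ∘ k ⟩
    F-pair = ≈.sym (P.unique
      (≈.trans (≈.sym assoc) (∘-resp-≈ˡ (≈.trans (≈.sym homomorphism) (F-resp-≈ cD.project₁))))
      (≈.trans (≈.sym assoc) (∘-resp-≈ˡ (≈.trans (≈.sym homomorphism) (F-resp-≈ cD.project₂)))))

  ⟪⟫-⋆ : ∀ {W A A₁ A₂ A₃} {g : A cD.⊗ A₂ D.⇒ A₃} {f : A cD.⊗ A₁ D.⇒ A₂} {x : W ⇒ F₀ A} →
         (g S.⋆ f) ⟪ x ⟫ ≈ g ⟪ x ⟫ ⋆ f ⟪ x ⟫
  ⟪⟫-⋆ {g = g} {f} {x} = begin
    F₁ (g D.∘ cD.⟨ cD.π₁ , f ⟩) ∘ P.⟨ x ∘ π₁ , π₂ ⟩      ≈⟨ ≈.trans (∘-resp-≈ˡ homomorphism) assoc ⟩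
    F₁ g ∘ (F₁ cD.⟨ cD.π₁ , f ⟩ ∘ P.⟨ x ∘ π₁ , π₂ ⟩)     ≈⟨ ∘-resp-≈ʳ F-pair ⟩
    F₁ g ∘ P.⟨ F₁ cD.π₁ ∘ P.⟨ x ∘ π₁ , π₂ ⟩ , f ⟪ x ⟫ ⟩  ≈⟨ ∘-resp-≈ʳ (P.⟨⟩-cong P.project₁ ≈.refl) ⟩
    F₁ g ∘ P.⟨ x ∘ π₁ , f ⟪ x ⟫ ⟩
      ≈⟨ ∘-resp-≈ʳ (P.⟨⟩-cong (≈.trans assoc (∘-resp-≈ʳ project₁)) project₂) ⟨
    F₁ g ∘ P.⟨ (x ∘ π₁) ∘ ⟨ π₁ , f ⟪ x ⟫ ⟩ , π₂ ∘ ⟨ π₁ , f ⟪ x ⟫ ⟩ ⟩  ≈⟨ ∘-resp-≈ʳ P.⟨⟩∘ ⟨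
    F₁ g ∘ (P.⟨ x ∘ π₁ , π₂ ⟩ ∘ ⟨ π₁ , f ⟪ x ⟫ ⟩)        ≈⟨ assoc ⟨
    g ⟪ x ⟫ ⋆ f ⟪ x ⟫                                    ∎

  ⟪⟫-π₂ : ∀ {W A A₁} {x : W ⇒ F₀ A} → cD.π₂ {A} {A₁} ⟪ x ⟫ ≈ π₂
  ⟪⟫-π₂ = P.project₂

  ⟪⟫-lift : ∀ {W A A₁ A₂} {f : A₁ D.⇒ A₂} {x : W ⇒ F₀ A} → S.lift f ⟪ x ⟫ ≈ lift (F₁ f)
  ⟪⟫-lift = ≈.trans (∘-resp-≈ˡ homomorphism) (≈.trans assoc (∘-resp-≈ʳ P.project₂))

module Compose {D : Category o κ} {D′ : Category o′ κ} (cD : Cartesian D) (cD′ : Cartesian D′)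
               (F : Functor D D′) (pres : PreservesProducts cD F) where
  private
    module D = Category D
    module cD = Cartesian cD
    module P {A B : D.Obj} = IsProduct (PreservesProducts.F-product pres {A} {B})
    module T₀ = Transport cD cD idF (idF-preserves× cD)
    open module T = Transport cD cD′ F pres
  open Category D′
  open Cartesian cD′
  open Functor F
  open HomReasoning

  -- Transport along a composite is done in two steps, one in `D` and one at a point of `F₀ B`.
  -- Universal families are built by successive pullbacks in `D`; this rule evaluates them at points
  -- one layer at a time.
  ⟪⟫-∘ : ∀ {W A B A₁ A₂} {s : A cD.⊗ A₁ D.⇒ A₂} {m : B D.⇒ A} {x : W ⇒ F₀ B} →
         s T.⟪ F₁ m ∘ x ⟫ ≈ s T₀.⟪ m ⟫ T.⟪ x ⟫
  ⟪⟫-∘ {s = s} {m} {x} = ≈.sym (begin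
    F₁ (s D.∘ cD.⟨ m D.∘ cD.π₁ , cD.π₂ ⟩) ∘ k  ≈⟨ ≈.trans (∘-resp-≈ˡ homomorphism) assoc ⟩
    F₁ s ∘ (F₁ cD.⟨ m D.∘ cD.π₁ , cD.π₂ ⟩ ∘ k) ≈⟨ ∘-resp-≈ʳ (P.unique
      (≈.trans (F-∘ cD.project₁) (≈.trans (∘-resp-≈ˡ homomorphism)
        (≈.trans assoc (≈.trans (∘-resp-≈ʳ P.project₁) (≈.sym assoc)))))
      (≈.trans (F-∘ cD.project₂) P.project₂)) ⟨
    F₁ s ∘ P.⟨ (F₁ m ∘ x) ∘ π₁ , π₂ ⟩          ∎)
    where
    k = P.⟨ x ∘ π₁ , π₂ ⟩
    F-∘ : ∀ {Z A B C} {f : B D.⇒ C} {g : A D.⇒ B} {h : A D.⇒ C} {k : Z ⇒ F₀ A} →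
          f D.∘ g D.≈ h → F₁ f ∘ (F₁ g ∘ k) ≈ F₁ h ∘ k
    F-∘ p = ≈.trans (≈.sym assoc) (∘-resp-≈ˡ (≈.trans (≈.sym homomorphism) (F-resp-≈ p)))

-- Data only: the universal property is stated relative to a functor, in `PreservesExponentials`, so
-- that a single formulation covers an object and its image.
record Exponentials {D : Category o κ} (cD : Cartesian D) {V : Set κ}
                    (X : V → Category.Obj D) : Set (o ⊔ κ) where
  open Category D
  open Cartesian cD
  field
    hom : V → V → Obj
    ev  : ∀ {a b} → hom a b ⊗ X a ⇒ X b

record Equalizers (D : Category o κ) : Set (o ⊔ κ) where
  open Category D
  field
    Eq  : ∀ {A B} → A ⇒ B → A ⇒ B → Obj
    arr : ∀ {A B} (f g : A ⇒ B) → Eq f g ⇒ A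

module _ {D : Category o κ} {D′ : Category o′ κ} (equalizers : Equalizers D) (F : Functor D D′) where
  open Equalizers equalizers
  open Functor F

  PreservesEqualizers : Set (o ⊔ o′ ⊔ κ)
  PreservesEqualizers = ∀ {A B} (f g : Category._⇒_ D A B) → IsEqualizer D′ (F₁ f) (F₁ g) (F₁ (arr f g))

module _ {D : Category o κ} {D′ : Category o′ κ} (cD : Cartesian D) (cD′ : Cartesian D′)
         (F : Functor D D′) (pres : PreservesProducts cD F)
         {V : Set κ} {X : V → Category.Obj D} (exp : Exponentials cD X) where
  open Category D′
  open Cartesian cD′
  open Functor F
  open Exponentials exp
  open Transport cD cD′ F pres

  record PreservesExponentials : Set (o ⊔ o′ ⊔ κ) where
    field
      curry    : ∀ {a b W} → W ⊗ F₀ (X a) ⇒ F₀ (X b) → W ⇒ F₀ (hom a b)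
      curry-β  : ∀ {a b W} {s : W ⊗ F₀ (X a) ⇒ F₀ (X b)} → ev ⟪ curry s ⟫ ≈ s
      ev-monic : ∀ {a b W} {x y : W ⇒ F₀ (hom a b)} → ev ⟪ x ⟫ ≈ ev ⟪ y ⟫ → x ≈ y

-- Finite systems of unknowns and equations.

-- A binary tree instead of a list: the union of two families of unknowns is a constructor, its
-- positions are a disjoint sum, and the product of internal Homs over it unfolds to a binary
-- product.
data Shape {κ} (V : Set κ) : Set κ where
  leaf  : V → Shape V
  nil   : Shape V
  _⊕_   : Shape V → Shape V → Shape V

module _ {V : Set κ} where

  Pos : Shape V → Set κ
  Pos (leaf a) = ⊤
  Pos nil      = ⊥
  Pos (S ⊕ S′) = Pos S ⊎ Pos S′

  vertex : (S : Shape V) → Pos S → V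
  vertex (leaf a) _        = a
  vertex (S ⊕ S′) (inj₁ p) = vertex S p
  vertex (S ⊕ S′) (inj₂ p) = vertex S′ p

  tabulate : ∀ {Y : Set κ} (S : Shape V) → (Pos S → Y) → List Y
  tabulate (leaf a) f = f tt ∷ []
  tabulate nil      f = []
  tabulate (S ⊕ S′) f = tabulate S (λ p → f (inj₁ p)) ++ tabulate S′ (λ p → f (inj₂ p))

module Systems (D : Category o κ) {V : Set κ} (X : V → Category.Obj D) (Fixed : V → Set κ) where
  open Category D

  data Constraint (S : Shape V) : Set κ where
    commutes : ∀ p q → X (vertex S p) ⇒ X (vertex S q) → Constraint S
    fixes    : ∀ p → Fixed (vertex S p) → Constraint S

  -- Both sides of an equation go from the object at `source` to that at `target`. They are
  -- therefore two maps into the same internal Hom, and the equation cuts out an equalizer.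
  source target : ∀ {S} → Constraint S → Pos S
  source (commutes p q f) = p
  source (fixes p _)      = p
  target (commutes p q f) = q
  target (fixes p _)      = p

  record System : Set κ where
    constructor system
    field
      shape       : Shape V
      constraints : List (Constraint shape)

  module Families {D′ : Category o′ κ} (cD′ : Cartesian D′) (F : Functor D D′) where
    private
      module D′ = Category D′
    open Cartesian cD′
    open Functor F
    open Slice cD′

    Family : Shape V → D′.Obj → Set κ
    Family S W = ∀ p → W ⊗ F₀ (X (vertex S p)) D′.⇒ F₀ (X (vertex S p))

    left right : ∀ {S W} (c : Constraint S) → Family S W →
                 W ⊗ F₀ (X (vertex S (source c))) D′.⇒ F₀ (X (vertex S (target c)))
    left  (commutes p q f) t = t q ⋆ lift (F₁ f)
    left  (fixes p _)      t = t p
    right (commutes p q f) t = lift (F₁ f) ⋆ t p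
    right (fixes p _)      t = π₂

    Satisfies : ∀ {S W} → Family S W → Constraint S → Set κ
    Satisfies t c = left c t D′.≈ right c t

    Solves : ∀ {W} (A : System) → Family (System.shape A) W → Set κ
    Solves A t = All (Satisfies t) (System.constraints A)

    left-cong : ∀ {S W} (c : Constraint S) {t s : Family S W} → (∀ p → t p D′.≈ s p) →
                left c t D′.≈ left c s
    left-cong (commutes p q f) e = ⋆-cong (e q) D′.≈.refl
    left-cong (fixes p _)      e = e p

    right-cong : ∀ {S W} (c : Constraint S) {t s : Family S W} → (∀ p → t p D′.≈ s p) →
                 right c t D′.≈ right c s
    right-cong (commutes p q f) e = ⋆-cong D′.≈.refl (e p)
    right-cong (fixes p _)      e = D′.≈.refl

    Satisfies-cong : ∀ {S W} (c : Constraint S) {t s : Family S W} → (∀ p → t p D′.≈ s p) →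
                     Satisfies t c → Satisfies s c
    Satisfies-cong c e x =
      D′.≈.trans (D′.≈.sym (left-cong c e)) (D′.≈.trans x (right-cong c e))

    identity-satisfies : ∀ {S W} (c : Constraint S) → Satisfies {S} {W} (λ _ → π₂) c
    identity-satisfies (commutes p q f) = D′.≈.trans ⋆-identityˡ (D′.≈.sym ⋆-identityʳ)
    identity-satisfies (fixes p _)      = D′.≈.refl

    -- Commuting squares paste and identities compose. With `identity-satisfies`, this is where the
    -- monoid structure on solutions comes from.
    ⋆-satisfies : ∀ {S W} (c : Constraint S) {t s : Family S W} → Satisfies t c → Satisfies s c →
                  Satisfies (λ p → t p ⋆ s p) c
    ⋆-satisfies (commutes p q f) x y = D′.≈.trans ⋆-assoc (D′.≈.trans (⋆-cong D′.≈.refl y)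
      (D′.≈.trans (D′.≈.sym ⋆-assoc) (D′.≈.trans (⋆-cong x D′.≈.refl) ⋆-assoc)))
    ⋆-satisfies (fixes p _) x y = D′.≈.trans (⋆-cong x y) ⋆-identityˡ

  module _ {D′ : Category o′ κ} (cD : Cartesian D) (cD′ : Cartesian D′)
           (F : Functor D D′) (pres : PreservesProducts cD F) where
    private
      module cD = Cartesian cD
      module D′ = Category D′
      module F₀ = Families cD idF
      module F′ = Families cD′ F
    open Transport cD cD′ F pres
    open Functor F using (F₀)
    open Slice cD′

    left-⟪⟫ : ∀ {S W A} (c : Constraint S) {u : F₀.Family S A} {x : W D′.⇒ F₀ A} →
              F₀.left c u ⟪ x ⟫ D′.≈ F′.left c (λ p → u p ⟪ x ⟫)
    left-⟪⟫ (commutes p q f) = D′.≈.trans ⟪⟫-⋆ (⋆-cong D′.≈.refl ⟪⟫-lift)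
    left-⟪⟫ (fixes p _)      = D′.≈.refl

    right-⟪⟫ : ∀ {S W A} (c : Constraint S) {u : F₀.Family S A} {x : W D′.⇒ F₀ A} →
               F₀.right c u ⟪ x ⟫ D′.≈ F′.right c (λ p → u p ⟪ x ⟫)
    right-⟪⟫ (commutes p q f) = D′.≈.trans ⟪⟫-⋆ (⋆-cong ⟪⟫-lift D′.≈.refl)
    right-⟪⟫ (fixes p _)      = ⟪⟫-π₂

    -- Both sides are made of `⋆`, `lift` and `π₂`, all respected by transport. This carries
    -- equations over to a further equalizer, and lets them be read off a point of `F₀ A`.
    Satisfies-⟪⟫ : ∀ {S W A} (c : Constraint S) {u : F₀.Family S A} {x : W D′.⇒ F₀ A} →
                   F₀.Satisfies u c → F′.Satisfies (λ p → u p ⟪ x ⟫) c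
    Satisfies-⟪⟫ c e = D′.≈.trans (D′.≈.sym (left-⟪⟫ c))
      (D′.≈.trans (⟪⟫-cong e D′.≈.refl) (right-⟪⟫ c))

-- Objects of solutions and their universal property.

record Closed {D : Category o κ} (cD : Cartesian D) {V : Set κ} (X : V → Category.Obj D)
              : Set (o ⊔ κ) where
  field
    exponentials            : Exponentials cD X
    equalizers              : Equalizers D
    isExponential           : PreservesExponentials cD cD idF (idF-preserves× cD) exponentials
    isEqualizer             : PreservesEqualizers equalizers (idF {D = D})

module Moduli {D : Category o κ} (cD : Cartesian D) {V : Set κ} {X : V → Category.Obj D}
              (K : Closed cD X) (Fixed : V → Set κ) where
  open Closed K
  open Exponentials exponentials
  open Equalizers equalizers
  open Systems D X Fixed
  open Category D
  open Cartesian cD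
  open Transport cD cD idF (idF-preserves× cD)
  open Families cD idF
  open PreservesExponentials isExponential

  Product : Shape V → Obj
  Product (leaf a) = hom a a
  Product nil      = 𝟏
  Product (S ⊕ S′) = Product S ⊗ Product S′

  component : ∀ S → Family S (Product S)
  component (leaf a) _        = ev
  component (S ⊕ S′) (inj₁ p) = component S p ⟪ π₁ ⟫
  component (S ⊕ S′) (inj₂ p) = component S′ p ⟪ π₂ ⟫

  -- Mutual, since an equation becomes a pair of maps into an internal Hom only once there is a
  -- universal family over the solutions of the remaining equations. The head of the list is imposed
  -- last.
  Solutions : ∀ S → List (Constraint S) → Obj
  universal : ∀ S cs → Family S (Solutions S cs)
  leftᶜ rightᶜ : ∀ S (c : Constraint S) cs →
                 Solutions S cs ⇒ hom (vertex S (source c)) (vertex S (target c))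

  Solutions S []       = Product S
  Solutions S (c ∷ cs) = Eq (leftᶜ S c cs) (rightᶜ S c cs)

  universal S [] p       = component S p
  universal S (c ∷ cs) p = universal S cs p ⟪ arr (leftᶜ S c cs) (rightᶜ S c cs) ⟫

  leftᶜ  S c cs = curry (left c (universal S cs))
  rightᶜ S c cs = curry (right c (universal S cs))

  open Compose cD cD idF (idF-preserves× cD)

  -- The sides of the head equation are the evaluations of `leftᶜ` and `rightᶜ`, which `arr`
  -- equalizes. The equations imposed earlier survive the pullback along `arr`.
  universal-satisfies : ∀ S cs → All (Satisfies (universal S cs)) cs
  universal-satisfies S []       = []
  universal-satisfies S (c ∷ cs) =
      ≈.trans (≈.sym (left-⟪⟫ cD cD idF (idF-preserves× cD) c)) (≈.trans
        (≈.trans (⟪⟫-cong (≈.sym curry-β) ≈.refl) (≈.trans (≈.sym ⟪⟫-∘) (≈.trans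
          (⟪⟫-cong ≈.refl (IsEqualizer.equality (isEqualizer (leftᶜ S c cs) (rightᶜ S c cs))))
          (≈.trans ⟪⟫-∘ (⟪⟫-cong curry-β ≈.refl)))))
        (right-⟪⟫ cD cD idF (idF-preserves× cD) c))
    ∷ All.map (λ {c′} → Satisfies-⟪⟫ cD cD idF (idF-preserves× cD) c′) (universal-satisfies S cs)

  module Represents {D′ : Category o′ κ} (cD′ : Cartesian D′) (F : Functor D D′)
                    (pres : PreservesProducts cD F)
                    (F-exp : PreservesExponentials cD cD′ F pres exponentials)
                    (F-eq : PreservesEqualizers equalizers F) where
    private
      module D′ = Category D′
      module cD′ = Cartesian cD′
      module F′ = Families cD′ F
      module T = IsTerminal (PreservesProducts.F-terminal pres)
      module P {A B : Obj} = IsProduct (PreservesProducts.F-product pres {A} {B})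
      module E = PreservesExponentials F-exp
      module T′ = Transport cD cD′ F pres
      module C = Compose cD cD′ F pres
    open Functor F

    element× : ∀ {W} S → F′.Family S W → W D′.⇒ F₀ (Product S)
    element× (leaf a) t = E.curry (t tt)
    element× nil      t = T.!
    element× (S ⊕ S′) t = P.⟨ element× S (λ p → t (inj₁ p)) , element× S′ (λ p → t (inj₂ p)) ⟩

    element×-β : ∀ {W} S {t : F′.Family S W} p → component S p T′.⟪ element× S t ⟫ D′.≈ t p
    element×-β (leaf a) p        = E.curry-β
    element×-β (S ⊕ S′) (inj₁ p) = D′.≈.trans (D′.≈.sym C.⟪⟫-∘)
      (D′.≈.trans (T′.⟪⟫-cong ≈.refl P.project₁) (element×-β S p))
    element×-β (S ⊕ S′) (inj₂ p) = D′.≈.trans (D′.≈.sym C.⟪⟫-∘)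
      (D′.≈.trans (T′.⟪⟫-cong ≈.refl P.project₂) (element×-β S′ p))

    component-monic : ∀ {W} S {x y : W D′.⇒ F₀ (Product S)} →
      (∀ p → component S p T′.⟪ x ⟫ D′.≈ component S p T′.⟪ y ⟫) → x D′.≈ y
    component-monic (leaf a) e = E.ev-monic (e tt)
    component-monic nil      e = D′.≈.trans (D′.≈.sym (T.!-unique _)) (T.!-unique _)
    component-monic (S ⊕ S′) e = P.jointly-monic
      (component-monic S λ p → D′.≈.trans C.⟪⟫-∘ (D′.≈.trans (e (inj₁ p)) (D′.≈.sym C.⟪⟫-∘)))
      (component-monic S′ λ p → D′.≈.trans C.⟪⟫-∘ (D′.≈.trans (e (inj₂ p)) (D′.≈.sym C.⟪⟫-∘)))

    -- Mutual again: to factor a point through the equalizer for `c` one needs `factors`; by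
    -- `ev-monic` that is the equation `c` for the family at the point, and `elementᴸ-β` identifies
    -- this family with `t`.
    elementᴸ : ∀ {W} S cs {t : F′.Family S W} → All (F′.Satisfies t) cs → W D′.⇒ F₀ (Solutions S cs)
    elementᴸ-β : ∀ {W} S cs {t : F′.Family S W} (sat : All (F′.Satisfies t) cs) p →
                 universal S cs p T′.⟪ elementᴸ S cs sat ⟫ D′.≈ t p
    factors : ∀ {W} S c cs {t : F′.Family S W} (s : F′.Satisfies t c) (sat : All (F′.Satisfies t) cs) →
              F₁ (leftᶜ S c cs) D′.∘ elementᴸ S cs sat D′.≈ F₁ (rightᶜ S c cs) D′.∘ elementᴸ S cs sat

    elementᴸ S []       {t} []        = element× S t
    elementᴸ S (c ∷ cs) (s ∷ sat) = IsEqualizer.factor (F-eq (leftᶜ S c cs) (rightᶜ S c cs))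
      (elementᴸ S cs sat) (factors S c cs s sat)

    elementᴸ-β S []       []        p = element×-β S p
    elementᴸ-β S (c ∷ cs) (s ∷ sat) p = D′.≈.trans (D′.≈.sym C.⟪⟫-∘) (D′.≈.trans
      (T′.⟪⟫-cong ≈.refl (IsEqualizer.factor-β (F-eq (leftᶜ S c cs) (rightᶜ S c cs)) (factors S c cs s sat)))
      (elementᴸ-β S cs sat p))

    factors S c cs s sat = E.ev-monic (D′.≈.trans C.⟪⟫-∘ (D′.≈.trans (T′.⟪⟫-cong curry-β D′.≈.refl)
      (D′.≈.trans (left-⟪⟫ cD cD′ F pres c) (D′.≈.trans
        (F′.Satisfies-cong c (λ p → D′.≈.sym (elementᴸ-β S cs sat p)) s)
        (D′.≈.trans (D′.≈.sym (right-⟪⟫ cD cD′ F pres c))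
          (D′.≈.trans (T′.⟪⟫-cong (≈.sym curry-β) D′.≈.refl) (D′.≈.sym C.⟪⟫-∘)))))))

    universal-monicᴸ : ∀ {W} S cs {x y : W D′.⇒ F₀ (Solutions S cs)} →
      (∀ p → universal S cs p T′.⟪ x ⟫ D′.≈ universal S cs p T′.⟪ y ⟫) → x D′.≈ y
    universal-monicᴸ S []       e = component-monic S e
    universal-monicᴸ S (c ∷ cs) e = IsEqualizer.monic (F-eq (leftᶜ S c cs) (rightᶜ S c cs))
      (universal-monicᴸ S cs λ p → D′.≈.trans C.⟪⟫-∘ (D′.≈.trans (e p) (D′.≈.sym C.⟪⟫-∘)))

-- Monoids of solutions, and the filtered category of systems.

All-tabulate⁻ : ∀ {V Y : Set κ} {P : Y → Set κ} (S : Shape V) {f : Pos S → Y} →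
                All P (tabulate S f) → ∀ p → P (f p)
All-tabulate⁻ (leaf a) (x ∷ []) p = x
All-tabulate⁻ (S ⊕ S′) {f} xs (inj₁ p) =
  All-tabulate⁻ S (Allₚ.++⁻ˡ (tabulate S λ p → f (inj₁ p)) xs) p
All-tabulate⁻ (S ⊕ S′) {f} xs (inj₂ p) =
  All-tabulate⁻ S′ (Allₚ.++⁻ʳ (tabulate S λ p → f (inj₁ p)) xs) p

module ModuliMonoids {D : Category o κ} (cD : Cartesian D) {V : Set κ} {X : V → Category.Obj D}
                     (K : Closed cD X) (Fixed : V → Set κ) where
  open Closed K
  open Systems D X Fixed public
  open Category D
  open Cartesian cD
  open Slice cD
  open Transport cD cD idF (idF-preserves× cD)
  open Compose cD cD idF (idF-preserves× cD)
  open Families cD idF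
  private
    module M = Moduli cD K Fixed
    module R = M.Represents cD idF (idF-preserves× cD) isExponential isEqualizer

  opaque
    -- Opaque, because from here on only the universal property matters: `u` and `u-solves`, with
    -- `element`, `element-β` and `u-monic` below.
    ⟦_⟧ₛ : System → Obj
    ⟦ A ⟧ₛ = M.Solutions (System.shape A) (System.constraints A)

    u : ∀ A → Family (System.shape A) ⟦ A ⟧ₛ
    u A = M.universal (System.shape A) (System.constraints A)

    u-solves : ∀ A → Solves A (u A)
    u-solves A = M.universal-satisfies (System.shape A) (System.constraints A)

  module Elements {D′ : Category o′ κ} (cD′ : Cartesian D′) (F : Functor D D′)
                  (pres : PreservesProducts cD F)
                  (F-exp : PreservesExponentials cD cD′ F pres exponentials)
                  (F-eq : PreservesEqualizers equalizers F) where
    private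
      module D′ = Category D′
      module cD′ = Cartesian cD′
      module F′ = Families cD′ F
      module T′ = Transport cD cD′ F pres
    open Functor F
    opaque
      unfolding ⟦_⟧ₛ
      element : ∀ {W} A (t : F′.Family (System.shape A) W) → F′.Solves A t → W D′.⇒ F₀ ⟦ A ⟧ₛ
      element A t = M.Represents.elementᴸ cD′ F pres F-exp F-eq (System.shape A) (System.constraints A) {t}

      element-β : ∀ {W} A {t : F′.Family (System.shape A) W} (sat : F′.Solves A t) p →
                  u A p T′.⟪ element A t sat ⟫ D′.≈ t p
      element-β A = M.Represents.elementᴸ-β cD′ F pres F-exp F-eq (System.shape A) (System.constraints A)

      u-monic : ∀ {W} A {x y : W D′.⇒ F₀ ⟦ A ⟧ₛ} →
                (∀ p → u A p T′.⟪ x ⟫ D′.≈ u A p T′.⟪ y ⟫) → x D′.≈ y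
      u-monic A = M.Represents.universal-monicᴸ cD′ F pres F-exp F-eq (System.shape A) (System.constraints A)

  open Elements cD idF (idF-preserves× cD) isExponential isEqualizer public

  module _ (A : System) where
    open System A

    products : Family shape (⟦ A ⟧ₛ ⊗ ⟦ A ⟧ₛ)
    products p = u A p ⟪ π₁ ⟫ ⋆ u A p ⟪ π₂ ⟫

    products-solve : Solves A products
    products-solve = All.map
      (λ {c} s → ⋆-satisfies c (Satisfies-⟪⟫ cD cD idF (idF-preserves× cD) c s)
                               (Satisfies-⟪⟫ cD cD idF (idF-preserves× cD) c s))
      (u-solves A)

    identities-solve : Solves {𝟏} A (λ _ → π₂)
    identities-solve = All.universal (λ c → identity-satisfies c) constraints

    mult : ⟦ A ⟧ₛ ⊗ ⟦ A ⟧ₛ ⇒ ⟦ A ⟧ₛ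
    mult = element A products products-solve

    unit : 𝟏 ⇒ ⟦ A ⟧ₛ
    unit = element A (λ _ → π₂) identities-solve

  module Products {D′ : Category o′ κ} (cD′ : Cartesian D′) (F : Functor D D′)
                  (pres : PreservesProducts cD F) where
    private
      module D′ = Category D′
      module S′ = Slice cD′
      module T′ = Transport cD cD′ F pres
      module C′ = Compose cD cD′ F pres
      module P {A B : Obj} = IsProduct (PreservesProducts.F-product pres {A} {B})
    open Functor F using (F₀; F₁)

    -- The argument `z` is described by its projections because it comes in two forms: a pairing in
    -- `D` when `F` is the identity, and `φ` after a pairing when points of `F₀ ⟦ A ⟧ₛ` are
    -- multiplied.
    mult-β : ∀ {W} A p {z : W D′.⇒ F₀ (⟦ A ⟧ₛ ⊗ ⟦ A ⟧ₛ)} {x y : W D′.⇒ F₀ ⟦ A ⟧ₛ} →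
             F₁ π₁ D′.∘ z D′.≈ x → F₁ π₂ D′.∘ z D′.≈ y →
             u A p T′.⟪ F₁ (mult A) D′.∘ z ⟫ D′.≈ u A p T′.⟪ x ⟫ S′.⋆ u A p T′.⟪ y ⟫
    mult-β A p {z} {x} {y} r s = begin
      u A p T′.⟪ F₁ (mult A) D′.∘ z ⟫                       ≈⟨ C′.⟪⟫-∘ ⟩
      u A p ⟪ mult A ⟫ T′.⟪ z ⟫
        ≈⟨ T′.⟪⟫-cong (element-β A (products-solve A) p) D′.≈.refl ⟩
      (u A p ⟪ π₁ ⟫ ⋆ u A p ⟪ π₂ ⟫) T′.⟪ z ⟫                ≈⟨ T′.⟪⟫-⋆ ⟩
      u A p ⟪ π₁ ⟫ T′.⟪ z ⟫ S′.⋆ u A p ⟪ π₂ ⟫ T′.⟪ z ⟫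
        ≈⟨ S′.⋆-cong (D′.≈.trans (D′.≈.sym C′.⟪⟫-∘) (T′.⟪⟫-cong ≈.refl r))
                     (D′.≈.trans (D′.≈.sym C′.⟪⟫-∘) (T′.⟪⟫-cong ≈.refl s)) ⟩
      u A p T′.⟪ x ⟫ S′.⋆ u A p T′.⟪ y ⟫                    ∎
      where open D′.HomReasoning

    unit-β : ∀ {W} A p {z : W D′.⇒ F₀ 𝟏} →
             u A p T′.⟪ F₁ (unit A) D′.∘ z ⟫ D′.≈ Cartesian.π₂ cD′
    unit-β A p {z} = D′.≈.trans C′.⟪⟫-∘ (D′.≈.trans
      (T′.⟪⟫-cong (element-β A (identities-solve A) p) D′.≈.refl) T′.⟪⟫-π₂)

  open Products cD idF (idF-preserves× cD) public

  private
    mult⟨⟩ : ∀ {W} A p {x y : W ⇒ ⟦ A ⟧ₛ} {s r} → u A p ⟪ x ⟫ ≈ s → u A p ⟪ y ⟫ ≈ r →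
             u A p ⟪ mult A ∘ ⟨ x , y ⟩ ⟫ ≈ s ⋆ r
    mult⟨⟩ A p e e′ = ≈.trans (mult-β A p project₁ project₂) (⋆-cong e e′)

    u-id : ∀ {A p} → u A p ⟪ id ⟫ ≈ u A p
    u-id = ≈.trans (∘-resp-≈ʳ (unique (≈.trans identityʳ (≈.sym identityˡ)) identityʳ)) identityʳ

  moduliMonoid : System → MonoidObject cD
  moduliMonoid A = record
    { Carrier = ⟦ A ⟧ₛ
    ; μ = mult A
    ; η = unit A
    ; μ-assoc = u-monic A λ p → ≈.trans (mult⟨⟩ A p (mult⟨⟩ A p ≈.refl ≈.refl) ≈.refl)
        (≈.trans ⋆-assoc (≈.sym (mult⟨⟩ A p ≈.refl (mult⟨⟩ A p ≈.refl ≈.refl))))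
    ; μ-identityˡ = u-monic A λ p → ≈.trans (mult⟨⟩ A p (unit-β A p) u-id)
        (≈.trans ⋆-identityˡ (≈.sym u-id))
    ; μ-identityʳ = u-monic A λ p → ≈.trans (mult⟨⟩ A p u-id (unit-β A p))
        (≈.trans ⋆-identityʳ (≈.sym u-id)) }

  -- The vertex is an index of this predicate, so that matching on it replaces
  -- transport along equalities between labels of positions.
  data Hits (A : System) : ∀ a → ⟦ A ⟧ₛ ⊗ X a ⇒ X a → Set κ where
    at : ∀ p {s} → u A p ≈ s → Hits A (vertex (System.shape A) p) s

  -- Each unknown of `A` must restrict to some unknown of `B` at the same vertex, but which one is
  -- not part of the identity of an arrow: `Index` compares arrows by `restrict`. Passing to objects
  -- of solutions is then functorial by definition.
  record _⟶_ (A B : System) : Set κ where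
    field
      restrict : ⟦ B ⟧ₛ ⇒ ⟦ A ⟧ₛ
      hits     : ∀ p → Hits B (vertex (System.shape A) p) (u A p ⟪ restrict ⟫)

  open _⟶_

  Hits-resp : ∀ {A a s r} → s ≈ r → Hits A a s → Hits A a r
  Hits-resp e (at p x) = at p (≈.trans x e)

  Hits-restrict : ∀ {A B a s} (f : A ⟶ B) → Hits A a s → Hits B a (s ⟪ restrict f ⟫)
  Hits-restrict f (at p x) = Hits-resp (⟪⟫-cong x ≈.refl) (hits f p)

  -- On components of the universal family multiplication is composition; for an arbitrary `s` this
  -- could fail. Hence `hits` is what makes a restriction map a homomorphism.
  Hits-mult : ∀ {A a s} → Hits A a s → s ⟪ mult A ⟫ ≈ s ⟪ π₁ ⟫ ⋆ s ⟪ π₂ ⟫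
  Hits-mult {A} (at p x) = ≈.trans (⟪⟫-cong (≈.sym x) ≈.refl)
    (≈.trans (element-β A (products-solve A) p) (⋆-cong (⟪⟫-cong x ≈.refl) (⟪⟫-cong x ≈.refl)))

  Hits-unit : ∀ {A a s} → Hits A a s → s ⟪ unit A ⟫ ≈ π₂
  Hits-unit {A} (at p x) = ≈.trans (⟪⟫-cong (≈.sym x) ≈.refl)
    (element-β A (identities-solve A) p)

  moduliHom : ∀ {A B} → A ⟶ B → MonoidObjectHom cD (moduliMonoid B) (moduliMonoid A)
  moduliHom {A} {B} f = record
    { hom = restrict f
    ; hom-μ = u-monic A λ p → ≈.trans ⟪⟫-∘ (≈.trans (Hits-mult (hits f p))
        (≈.sym (mult⟨⟩ A p ⟪⟫-∘ ⟪⟫-∘)))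
    ; hom-η = u-monic A λ p → ≈.trans ⟪⟫-∘ (≈.trans (Hits-unit (hits f p))
        (≈.sym (element-β A (identities-solve A) p))) }

  Index : Category κ κ
  Index = record
    { Obj = System
    ; _⇒_ = _⟶_
    ; _≈_ = λ f g → restrict f ≈ restrict g
    ; id = record { restrict = id ; hits = λ p → at p (≈.sym u-id) }
    ; _∘_ = λ g f → record
      { restrict = restrict f ∘ restrict g
      ; hits = λ p → Hits-resp (≈.sym ⟪⟫-∘) (Hits-restrict g (hits f p)) }
    ; equiv = record { refl = ≈.refl ; sym = ≈.sym ; trans = ≈.trans }
    ; assoc = ≈.sym assoc ; identityˡ = identityʳ ; identityʳ = identityˡ
    ; ∘-resp-≈ = λ p q → ∘-resp-≈ q p }

  induced : ∀ A {B} (t : Family (System.shape A) ⟦ B ⟧ₛ) → Solves A t →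
            (∀ p → Hits B (vertex (System.shape A) p) (t p)) → A ⟶ B
  induced A t sat h = record
    { restrict = element A t sat
    ; hits = λ p → Hits-resp (≈.sym (element-β A sat p)) (h p) }

  private
    renameˡ : ∀ {S S′} → Constraint S → Constraint (S ⊕ S′)
    renameˡ (commutes p q f) = commutes (inj₁ p) (inj₁ q) f
    renameˡ (fixes p h)      = fixes (inj₁ p) h

    renameʳ : ∀ {S S′} → Constraint S′ → Constraint (S ⊕ S′)
    renameʳ (commutes p q f) = commutes (inj₂ p) (inj₂ q) f
    renameʳ (fixes p h)      = fixes (inj₂ p) h

    satisfiesˡ : ∀ {S S′ W} {t : Family (S ⊕ S′) W} (c : Constraint S) →
                 Satisfies t (renameˡ c) → Satisfies (λ p → t (inj₁ p)) c
    satisfiesˡ (commutes p q f) e = e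
    satisfiesˡ (fixes p h)      e = e

    satisfiesʳ : ∀ {S S′ W} {t : Family (S ⊕ S′) W} (c : Constraint S′) →
                 Satisfies t (renameʳ c) → Satisfies (λ p → t (inj₂ p)) c
    satisfiesʳ (commutes p q f) e = e
    satisfiesʳ (fixes p h)      e = e

  _⊞_ : System → System → System
  system S cs ⊞ system S′ cs′ = system (S ⊕ S′)
    (map renameˡ cs ++ map renameʳ cs′)

  injectˡ : ∀ A B → A ⟶ (A ⊞ B)
  injectˡ A B = induced A (λ p → u (A ⊞ B) (inj₁ p))
    (All.map (λ {c} → satisfiesˡ c) (Allₚ.map⁻ (Allₚ.++⁻ˡ _ (u-solves (A ⊞ B)))))
    (λ p → at (inj₁ p) ≈.refl)

  injectʳ : ∀ A B → B ⟶ (A ⊞ B)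
  injectʳ A B = induced B (λ p → u (A ⊞ B) (inj₂ p))
    (All.map (λ {c} → satisfiesʳ c) (Allₚ.map⁻ (Allₚ.++⁻ʳ
      (map renameˡ (System.constraints A)) (u-solves (A ⊞ B)))))
    (λ p → at (inj₂ p) ≈.refl)

  infixl 6 _∣_

  _∣_ : ∀ A → List (Constraint (System.shape A)) → System
  system S cs ∣ ds = system S (ds ++ cs)

  refine : ∀ A ds → A ⟶ (A ∣ ds)
  refine A ds = induced A (u (A ∣ ds)) (Allₚ.++⁻ʳ ds (u-solves (A ∣ ds))) (λ p → at p ≈.refl)

  refine-β : ∀ A ds p → u A p ⟪ restrict (refine A ds) ⟫ ≈ u (A ∣ ds) p
  refine-β A ds p = element-β A (Allₚ.++⁻ʳ ds (u-solves (A ∣ ds))) p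

  private
    -- Two positions with the same label are identified by letting the
    -- identity map commute with the family.
    identify : ∀ A {a b s r} → Hits A a s → Hits A b r → (e : a ≡ b) →
      Σ[ c ∈ Constraint (System.shape A) ] (∀ ds → Satisfies (u (A ∣ ds)) c →
        ≡.subst (λ a → ⟦ A ∣ ds ⟧ₛ ⊗ X a ⇒ X a) e (s ⟪ restrict (refine A ds) ⟫)
        ≈ r ⟪ restrict (refine A ds) ⟫)
    identify A (at p x) (at q y) e = commutes p q (bridge e) , λ ds sat →
      bridged e (≈.trans (⟪⟫-cong (≈.sym x) ≈.refl) (refine-β A ds p))
                (≈.trans (⟪⟫-cong (≈.sym y) ≈.refl) (refine-β A ds q)) sat
      where
      bridge : ∀ {a b} → a ≡ b → X a ⇒ X b
      bridge ≡.refl = id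
      bridged : ∀ {W a b} (e : a ≡ b) {t t′ : W ⊗ X a ⇒ X a} {r r′ : W ⊗ X b ⇒ X b} →
                t ≈ t′ → r ≈ r′ → r′ ⋆ lift (bridge e) ≈ lift (bridge e) ⋆ t′ →
                ≡.subst (λ a → W ⊗ X a ⇒ X a) e t ≈ r
      bridged ≡.refl p q x = ≈.trans p (≈.sym (≈.trans q (≈.trans (≈.sym ⋆-identityʳ)
        (≈.trans (⋆-cong ≈.refl (≈.sym lift-id)) (≈.trans x
          (≈.trans (⋆-cong lift-id ≈.refl) ⋆-identityˡ))))))

  -- For each of the finitely many unknowns of `A`, the two arrows select unknowns of `B` at the
  -- same vertex. Once these are equated, the restrictions agree on every component, and `u-monic`
  -- applies.
  coequalizer : ∀ {A B} (f g : A ⟶ B) →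
                Σ[ C ∈ System ] Σ[ w ∈ B ⟶ C ] restrict f ∘ restrict w ≈ restrict g ∘ restrict w
  coequalizer {A} {B} f g = B ∣ ds , refine B ds , u-monic A λ p → ≈.trans ⟪⟫-∘
      (≈.trans (proj₂ (c p) ds (All-tabulate⁻ S (Allₚ.++⁻ˡ ds (u-solves (B ∣ ds))) p)) (≈.sym ⟪⟫-∘))
    where
    S = System.shape A
    -- Both selected positions carry the label of `p`, so the equality is trivial here. It is a
    -- variable in `identify` because matching on two hits requires independent labels.
    c = λ p → identify B (hits f p) (hits g p) ≡.refl
    ds = tabulate S λ p → proj₁ (c p)

  Index-filtered : IsFiltered Index
  Index-filtered = record
    { point = system nil []
    ; bound = λ A B → (A ⊞ B) , injectˡ A B , injectʳ A B
    ; coeq = coequalizer }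

  opaque
    moduli : ProMonoid cD
    moduli = record
      { index = Index
      ; filtered = Index-filtered
      ; diagram = record
        { F₀ = moduliMonoid ; F₁ = moduliHom
        ; identity = ≈.refl ; homomorphism = ≈.refl ; F-resp-≈ = λ p → p } }

-- Points of the pro-monoid as natural families.

module ProPoints {D : Category o κ} (cD : Cartesian D) (N : Category.Obj (Pro D)) where
  open Category D
  open Cartesian cD
  module N = IndObject N

  at : Pro D [ 𝟏ₚ cD , N ] → ∀ j → 𝟏 ⇒ N.F₀ j
  at x j = Germ.arr (IndHom.comp x j)

  opaque
    at-compatible : (x : Pro D [ 𝟏ₚ cD , N ]) → ∀ {i j} (f : i N.J.⇒ j) → N.F₁ f ∘ at x j ≈ at x i
    at-compatible x f = ∼⇒≈ (IndHom.natural x f)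

    at-cong : {x y : Pro D [ 𝟏ₚ cD , N ]} → Pro D [ x ≈ y ] → ∀ j → at x j ≈ at y j
    at-cong e j = ∼⇒≈ (e j)

    at-injective : {x y : Pro D [ 𝟏ₚ cD , N ]} → (∀ j → at x j ≈ at y j) → Pro D [ x ≈ y ]
    at-injective e j = ≈⇒∼y (e j)

  point : (x : ∀ j → 𝟏 ⇒ N.F₀ j) → (∀ {i j} (f : i N.J.⇒ j) → N.F₁ f ∘ x j ≈ x i) →
          Pro D [ 𝟏ₚ cD , N ]
  point x e = record { comp = λ j → germ tt (x j) ; natural = λ f → ≈⇒∼y (e f) }

module Points {D : Category o κ} {D′ : Category o′ κ} (cD : Cartesian D) (cD′ : Cartesian D′)
              {V : Set κ} {X : V → Category.Obj D} (K : Closed cD X) (Fixed : V → Set κ)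
              (F : Functor D D′) (pres : PreservesProducts cD F)
              (F-exp : PreservesExponentials cD cD′ F pres (Closed.exponentials K))
              (F-eq : PreservesEqualizers (Closed.equalizers K) F) where
  open ModuliMonoids cD K Fixed
  open Elements cD′ F pres F-exp F-eq renaming
    (element to element′; element-β to element′-β; u-monic to u′-monic)
  open Products cD′ F pres renaming (mult-β to mult′-β; unit-β to unit′-β)
  open Category D′
  open Cartesian cD′
  open Slice cD′
  open Functor F
  open Transport cD cD′ F pres
  open Compose cD cD′ F pres
  open Families cD′ F
  open _⟶_
  private
    module D = Category D
    module T₀ = Transport cD cD idF (idF-preserves× cD)
    module P {A B : D.Obj} = IsProduct (PreservesProducts.F-product pres {A} {B})
    module T = IsTerminal (PreservesProducts.F-terminal pres)

  -- The trace of a natural endomorphism on the full subcategory of the vertices. It lives in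
  -- `Set κ`, and for `mapInd H` it will be shown to determine, and to come from, a relative
  -- endomorphism of `H`.
  record NaturalFamily : Set κ where
    field
      τ       : ∀ a → F₀ (X a) ⇒ F₀ (X a)
      natural : ∀ {a b} (f : X a D.⇒ X b) → τ b ∘ F₁ f ≈ F₁ f ∘ τ a
      fixed   : ∀ a → Fixed a → τ a ≈ id

  open NaturalFamily

  private
    unlift : ∀ {A B} → 𝟏 ⊗ A ⇒ B → A ⇒ B
    unlift f = f ∘ ⟨ ! , id ⟩

    unlift-lift : ∀ {A B} {f : A ⇒ B} → unlift (lift f) ≈ f
    unlift-lift = ≈.trans assoc (≈.trans (∘-resp-≈ʳ project₂) identityʳ)

    lift-unlift : ∀ {A B} {f : 𝟏 ⊗ A ⇒ B} → lift (unlift f) ≈ f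
    lift-unlift = ≈.trans assoc (≈.trans (∘-resp-≈ʳ (≈.trans ⟨⟩∘ (unique
      (≈.trans identityʳ (≈.trans (≈.sym (!-unique _)) (!-unique _)))
      (≈.trans identityʳ (≈.sym identityˡ))))) identityʳ)

    lift-injective : ∀ {A B} {f g : A ⇒ B} → lift {𝟏} f ≈ lift g → f ≈ g
    lift-injective e = ≈.trans (≈.sym unlift-lift) (≈.trans (∘-resp-≈ˡ e) unlift-lift)

  constant : NaturalFamily → ∀ {W} S → Family S W
  constant t S p = lift (τ t (vertex S p))

  constant-satisfies : ∀ t {W} S (c : Constraint S) → Satisfies (constant t {W} S) c
  constant-satisfies t S (commutes p q f) =
    ≈.trans (≈.sym lift-∘) (≈.trans (∘-resp-≈ˡ (natural t f)) lift-∘)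
  constant-satisfies t S (fixes p h) =
    ≈.trans (∘-resp-≈ˡ (fixed t (vertex S p) h)) lift-id

  value : NaturalFamily → ∀ A → 𝟏 ⇒ F₀ ⟦ A ⟧ₛ
  value t A = element′ A (constant t (System.shape A))
    (All.universal (constant-satisfies t (System.shape A)) (System.constraints A))

  value-β : ∀ t A p → u A p ⟪ value t A ⟫ ≈ lift (τ t (vertex (System.shape A) p))
  value-β t A p = element′-β A
    (All.universal (constant-satisfies t (System.shape A)) (System.constraints A)) p

  private
    value-Hits : ∀ t A {a s} → Hits A a s → s ⟪ value t A ⟫ ≈ lift (τ t a)
    value-Hits t A (at p x) = ≈.trans (⟪⟫-cong (D.≈.sym x) ≈.refl) (value-β t A p)

  -- Arrows send unknowns to unknowns with the same label, and the value that `t` gives to an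
  -- unknown depends on its label only.
  value-compatible : ∀ t {A B} (f : A ⟶ B) → F₁ (restrict f) ∘ value t B ≈ value t A
  value-compatible t {A} {B} f = u′-monic A λ p → ≈.trans ⟪⟫-∘
    (≈.trans (value-Hits t B (hits f p)) (≈.sym (value-β t A p)))

  value-cong : ∀ {t s} → (∀ a → τ t a ≈ τ s a) → ∀ A → value t A ≈ value s A
  value-cong {t} {s} e A = u′-monic A λ p → ≈.trans (value-β t A p)
    (≈.trans (∘-resp-≈ˡ (e (vertex (System.shape A) p))) (≈.sym (value-β s A p)))

  private
    single : V → System
    single a = system (leaf a) []

  value-injective : ∀ {t s} → (∀ A → value t A ≈ value s A) → ∀ a → τ t a ≈ τ s a
  value-injective {t} {s} e a = lift-injective (≈.trans (≈.sym (value-β t (single a) tt))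
    (≈.trans (⟪⟫-cong D.≈.refl (e (single a))) (value-β s (single a) tt)))

  module _ (x : ∀ A → 𝟏 ⇒ F₀ ⟦ A ⟧ₛ)
           (x-compatible : ∀ {A B} (f : A ⟶ B) → F₁ (restrict f) ∘ x B ≈ x A) where

    private
      v : ∀ a → 𝟏 ⊗ F₀ (X a) ⇒ F₀ (X a)
      v a = u (single a) tt ⟪ x (single a) ⟫

      include : ∀ A p → single (vertex (System.shape A) p) ⟶ A
      include A p = induced (single (vertex (System.shape A) p)) (λ _ → u A p) [] (λ _ → at p D.≈.refl)

      -- The system whose single unknown is labelled like `p` has an arrow to `A` that hits `p`.
      -- Compatibility along this arrow makes the component of `x A` at `p` a function of the label
      -- alone.
      v-determines : ∀ A p → u A p ⟪ x A ⟫ ≈ v (vertex (System.shape A) p)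
      v-determines A p = ≈.trans
        (⟪⟫-cong (D.≈.sym (element-β (single (vertex (System.shape A) p)) [] tt)) ≈.refl)
        (≈.trans (≈.sym ⟪⟫-∘) (⟪⟫-cong D.≈.refl (x-compatible (include A p))))

      x-satisfies : ∀ A → All (Satisfies (λ p → v (vertex (System.shape A) p))) (System.constraints A)
      x-satisfies A = All.map
        (λ {c} s → Satisfies-cong c (v-determines A) (Satisfies-⟪⟫ cD cD′ F pres c s)) (u-solves A)

      -- The system used has two unknowns even when `a` and `b` coincide; `v-determines` gives both
      -- of them their values by label.
      square : ∀ {a b} (f : X a D.⇒ X b) → v b ⋆ lift (F₁ f) ≈ lift (F₁ f) ⋆ v a
      square {a} {b} f = All.head
        (x-satisfies (system (leaf a ⊕ leaf b) (commutes (inj₁ tt) (inj₂ tt) f ∷ [])))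

    family : NaturalFamily
    family = record
      { τ = λ a → unlift (v a)
      ; natural = λ f → lift-injective (≈.trans lift-∘ (≈.trans (⋆-cong lift-unlift ≈.refl)
          (≈.trans (square f) (≈.trans (⋆-cong ≈.refl (≈.sym lift-unlift)) (≈.sym lift-∘)))))
      ; fixed = λ a h → lift-injective (≈.trans lift-unlift (≈.trans
          (All.head (x-satisfies (system (leaf a) (fixes tt h ∷ [])))) (≈.sym lift-id))) }

    value-family : ∀ A → value family A ≈ x A
    value-family A = u′-monic A λ p → ≈.trans (value-β family A p)
      (≈.trans lift-unlift (≈.sym (v-determines A p)))

  moduli′ : ProMonoid cD′
  moduli′ = Functor.F₀ (mapPro (mapMon cD′ {F = F} pres)) moduli

  ∣moduli′∣ : Category.Obj (Pro D′)
  ∣moduli′∣ = Functor.F₀ (mapPro (Mon⇒C cD′)) moduli′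

  private
    module Γ = Monoid (Γᴹ cD′ moduli′)
    module Q = ProPoints cD′ ∣moduli′∣

  opaque
    unfolding moduli

    points : NaturalFamily → Γ.Carrier
    points t = Q.point (value t) (value-compatible t)

    points-cong : ∀ {t s} → (∀ a → τ t a ≈ τ s a) → points t Γ.≈ points s
    points-cong {t} {s} e = Q.at-injective {points t} {points s} (value-cong {t} {s} e)

    points-injective : ∀ {t s} → points t Γ.≈ points s → ∀ a → τ t a ≈ τ s a
    points-injective {t} {s} e = value-injective {t} {s} (Q.at-cong {points t} {points s} e)

    toFamily : Γ.Carrier → NaturalFamily
    toFamily x = family (Q.at x) (Q.at-compatible x)

    points-toFamily : ∀ x → points (toFamily x) Γ.≈ x
    points-toFamily x = Q.at-injective {points (toFamily x)} {x}
      (value-family (Q.at x) (Q.at-compatible x))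

    points-∙ : ∀ {r t s} → (∀ a → τ r a ≈ τ t a ∘ τ s a) → points r Γ.≈ (points t Γ.∙ points s)
    points-∙ {r} {t} {s} e = Q.at-injective {points r} {points t Γ.∙ points s} λ A →
      u′-monic A λ p → ≈.trans (value-β r A p) (≈.trans (∘-resp-≈ˡ (e (vertex (System.shape A) p)))
        (≈.trans lift-∘ (≈.sym (≈.trans (⟪⟫-cong D.≈.refl assoc)
          (≈.trans (mult′-β A p
              (≈.trans (≈.sym assoc) (≈.trans (∘-resp-≈ˡ P.project₁) project₁))
              (≈.trans (≈.sym assoc) (≈.trans (∘-resp-≈ˡ P.project₂) project₂)))
            (⋆-cong (value-β t A p) (value-β s A p)))))))

    points-ε : ∀ {t} → (∀ a → τ t a ≈ id) → points t Γ.≈ Γ.ε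
    points-ε {t} e = Q.at-injective {points t} {Γ.ε} λ A →
      u′-monic A λ p → ≈.trans (value-β t A p) (≈.trans (∘-resp-≈ˡ (e (vertex (System.shape A) p)))
        (≈.trans lift-id (≈.sym (≈.trans (⟪⟫-cong D.≈.refl assoc) (unit′-β A p)))))

-- Objects of units of monoid objects.

module UnitObjects {D : Category o κ} (cD : Cartesian D) (equalizers : Equalizers D)
                   (isEqualizer : PreservesEqualizers equalizers (idF {D = D})) where
  open Category D
  open Cartesian cD
  open Equalizers equalizers
  open HomReasoning

  module _ (M : MonoidObject cD) where
    open MonoidObject M
    open MonoidElements cD M

    -- Pairs of mutually inverse elements. Both products are equated with the unit at once, as a
    -- one-sided inverse in a monoid need not be two-sided.
    bothProducts bothUnits : Carrier ⊗ Carrier ⇒ Carrier ⊗ Carrier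
    bothProducts = ⟨ π₁ ∙ π₂ , π₂ ∙ π₁ ⟩
    bothUnits    = ⟨ ε , ε ⟩

    Units : Obj
    Units = Eq bothProducts bothUnits

    pairing : Units ⇒ Carrier ⊗ Carrier
    pairing = arr bothProducts bothUnits

    direct inverse : Units ⇒ Carrier
    direct  = π₁ ∘ pairing
    inverse = π₂ ∘ pairing

    private
      equality : bothProducts ∘ pairing ≈ bothUnits ∘ pairing
      equality = IsEqualizer.equality (isEqualizer bothProducts bothUnits)

    direct-inverse : direct ∙ inverse ≈ ε
    direct-inverse = begin
      direct ∙ inverse            ≈⟨ ∙∘ ⟨
      (π₁ ∙ π₂) ∘ pairing         ≈⟨ ≈.trans (≈.sym assoc) (∘-resp-≈ˡ project₁) ⟨
      π₁ ∘ bothProducts ∘ pairing ≈⟨ ∘-resp-≈ʳ equality ⟩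
      π₁ ∘ bothUnits ∘ pairing    ≈⟨ ≈.trans (≈.sym assoc) (∘-resp-≈ˡ project₁) ⟩
      ε ∘ pairing                 ≈⟨ ε∘ ⟩
      ε                           ∎

    inverse-direct : inverse ∙ direct ≈ ε
    inverse-direct = begin
      inverse ∙ direct            ≈⟨ ∙∘ ⟨
      (π₂ ∙ π₁) ∘ pairing         ≈⟨ ≈.trans (≈.sym assoc) (∘-resp-≈ˡ project₂) ⟨
      π₂ ∘ bothProducts ∘ pairing ≈⟨ ∘-resp-≈ʳ equality ⟩
      π₂ ∘ bothUnits ∘ pairing    ≈⟨ ≈.trans (≈.sym assoc) (∘-resp-≈ˡ project₂) ⟩
      ε ∘ pairing                 ≈⟨ ε∘ ⟩
      ε                           ∎

  module UnitElements {D′ : Category o′ κ} (F : Functor D D′) (pres : PreservesProducts cD F)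
                      (F-eq : PreservesEqualizers equalizers F) (M : MonoidObject cD) where
    private
      module D′ = Category D′
      module T = IsTerminal (PreservesProducts.F-terminal pres)
      module P {A B : Obj} = IsProduct (PreservesProducts.F-product pres {A} {B})
      module E = IsEqualizer (F-eq (bothProducts M) (bothUnits M))
    open Functor F
    open MonoidObject M
    open MonoidElements cD M

    Inverses : ∀ {W} → W D′.⇒ F₀ Carrier → W D′.⇒ F₀ Carrier → Set κ
    Inverses x y = F₁ μ D′.∘ P.⟨ x , y ⟩ D′.≈ F₁ η D′.∘ T.!

    private
      F-∘ : ∀ {W A B C} {f : B ⇒ C} {g : A ⇒ B} {h : A ⇒ C} {k : W D′.⇒ F₀ A} →
            f ∘ g ≈ h → F₁ f D′.∘ (F₁ g D′.∘ k) D′.≈ F₁ h D′.∘ k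
      F-∘ p = D′.≈.trans (D′.≈.sym D′.assoc)
        (D′.∘-resp-≈ˡ (D′.≈.trans (D′.≈.sym homomorphism) (F-resp-≈ p)))

      F-product : ∀ {W Z} {x y : Z ⇒ Carrier} {k : W D′.⇒ F₀ Z} {x′ y′ : W D′.⇒ F₀ Carrier} →
                  F₁ x D′.∘ k D′.≈ x′ → F₁ y D′.∘ k D′.≈ y′ →
                  F₁ (x ∙ y) D′.∘ k D′.≈ F₁ μ D′.∘ P.⟨ x′ , y′ ⟩
      F-product p q = D′.≈.trans (D′.≈.sym (F-∘ ≈.refl)) (D′.∘-resp-≈ʳ (D′.≈.sym (P.unique
        (D′.≈.trans (F-∘ project₁) p) (D′.≈.trans (F-∘ project₂) q))))

      F-ε : ∀ {W Z} {k : W D′.⇒ F₀ Z} → F₁ ε D′.∘ k D′.≈ F₁ η D′.∘ T.!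
      F-ε = D′.≈.trans (D′.≈.sym (F-∘ ≈.refl)) (D′.∘-resp-≈ʳ (D′.≈.sym (T.!-unique _)))

      equalizes : ∀ {W} {x y : W D′.⇒ F₀ Carrier} → Inverses x y → Inverses y x →
                  F₁ (bothProducts M) D′.∘ P.⟨ x , y ⟩ D′.≈ F₁ (bothUnits M) D′.∘ P.⟨ x , y ⟩
      equalizes p q = P.jointly-monic
        (D′.≈.trans (F-∘ project₁) (D′.≈.trans (F-product P.project₁ P.project₂)
          (D′.≈.trans p (D′.≈.sym (D′.≈.trans (F-∘ project₁) F-ε)))))
        (D′.≈.trans (F-∘ project₂) (D′.≈.trans (F-product P.project₂ P.project₁)
          (D′.≈.trans q (D′.≈.sym (D′.≈.trans (F-∘ project₂) F-ε)))))

    unitElement : ∀ {W} (x y : W D′.⇒ F₀ Carrier) → Inverses x y → Inverses y x → W D′.⇒ F₀ (Units M)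
    unitElement x y p q = E.factor P.⟨ x , y ⟩ (equalizes p q)

    module _ {W} {x y : W D′.⇒ F₀ Carrier} (p : Inverses x y) (q : Inverses y x) where
      direct-β : F₁ (direct M) D′.∘ unitElement x y p q D′.≈ x
      direct-β = D′.≈.trans (D′.≈.sym (F-∘ ≈.refl))
        (D′.≈.trans (D′.∘-resp-≈ʳ (E.factor-β (equalizes p q))) P.project₁)

      inverse-β : F₁ (inverse M) D′.∘ unitElement x y p q D′.≈ y
      inverse-β = D′.≈.trans (D′.≈.sym (F-∘ ≈.refl))
        (D′.≈.trans (D′.∘-resp-≈ʳ (E.factor-β (equalizes p q))) P.project₂)

    -- Testing both halves of a pair reduces every law for units to a law of `M` and its mirror
    -- image, as the second halves multiply in reverse order.
    unit-monic : ∀ {W} {x y : W D′.⇒ F₀ (Units M)} → F₁ (direct M) D′.∘ x D′.≈ F₁ (direct M) D′.∘ y →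
                 F₁ (inverse M) D′.∘ x D′.≈ F₁ (inverse M) D′.∘ y → x D′.≈ y
    unit-monic p q = E.monic (P.jointly-monic
      (D′.≈.trans (F-∘ ≈.refl) (D′.≈.trans p (D′.≈.sym (F-∘ ≈.refl))))
      (D′.≈.trans (F-∘ ≈.refl) (D′.≈.trans q (D′.≈.sym (F-∘ ≈.refl)))))

  private
    module I = UnitElements idF (idF-preserves× cD) isEqualizer

  module _ (M : MonoidObject cD) where
    open MonoidObject M
    open MonoidElements cD M
    open I M

    private
      cancel : ∀ {Z} {x y x′ y′ : Z ⇒ Carrier} → x ∙ y ≈ ε → x′ ∙ y′ ≈ ε → (x′ ∙ x) ∙ (y ∙ y′) ≈ ε
      cancel {x = x} {y} {x′} {y′} p q = begin
        (x′ ∙ x) ∙ (y ∙ y′)    ≈⟨ ∙-assoc _ _ _ ⟩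
        x′ ∙ (x ∙ (y ∙ y′))    ≈⟨ ∙-cong ≈.refl (∙-assoc _ _ _) ⟨
        x′ ∙ ((x ∙ y) ∙ y′)    ≈⟨ ∙-cong ≈.refl (≈.trans (∙-cong p ≈.refl) (∙-identityˡ _)) ⟩
        x′ ∙ y′                ≈⟨ q ⟩
        ε                      ∎

      at : ∀ {Y Z} {x y : Z ⇒ Carrier} {h : Y ⇒ Z} → x ∙ y ≈ ε → (x ∘ h) ∙ (y ∘ h) ≈ ε
      at p = ≈.trans (≈.sym ∙∘) (≈.trans (∘-resp-≈ˡ p) ε∘)

      d i : Units M ⇒ Carrier
      d = direct M
      i = inverse M

      d∙ : Units M ⊗ Units M ⇒ Carrier
      d∙ = (d ∘ π₁) ∙ (d ∘ π₂)

      i∙ : Units M ⊗ Units M ⇒ Carrier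
      i∙ = (i ∘ π₂) ∙ (i ∘ π₁)

      d∙i∙ : d∙ ∙ i∙ ≈ ε
      d∙i∙ = cancel (at (direct-inverse M)) (at (direct-inverse M))

      i∙d∙ : i∙ ∙ d∙ ≈ ε
      i∙d∙ = cancel (at (inverse-direct M)) (at (inverse-direct M))

      mult : Units M ⊗ Units M ⇒ Units M
      mult = unitElement d∙ i∙ d∙i∙ i∙d∙

      unit : 𝟏 ⇒ Units M
      unit = unitElement η η η-η η-η
        where
        η-η : η ∙ η ≈ η ∘ !
        η-η = ≈.trans (∙-cong (≈.sym (≈.trans (∘-resp-≈ʳ (!-unique _)) identityʳ)) ≈.refl)
          (≈.trans (∙-identityˡ _) (≈.trans (≈.sym identityʳ) (∘-resp-≈ʳ (≈.sym (!-unique _)))))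

      inv : Units M ⇒ Units M
      inv = unitElement i d (inverse-direct M) (direct-inverse M)

    direct-mult : ∀ {Z} {x y : Z ⇒ Units M} {x′ y′} → d ∘ x ≈ x′ → d ∘ y ≈ y′ →
                  d ∘ (mult ∘ ⟨ x , y ⟩) ≈ x′ ∙ y′
    direct-mult p q = ≈.trans (≈.sym assoc) (≈.trans (∘-resp-≈ˡ (direct-β d∙i∙ i∙d∙))
      (≈.trans ∙∘ (∙-cong (≈.trans assoc (≈.trans (∘-resp-≈ʳ project₁) p))
                          (≈.trans assoc (≈.trans (∘-resp-≈ʳ project₂) q)))))

    inverse-mult : ∀ {Z} {x y : Z ⇒ Units M} {x′ y′} → i ∘ x ≈ x′ → i ∘ y ≈ y′ →
                   i ∘ (mult ∘ ⟨ x , y ⟩) ≈ y′ ∙ x′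
    inverse-mult p q = ≈.trans (≈.sym assoc) (≈.trans (∘-resp-≈ˡ (inverse-β d∙i∙ i∙d∙))
      (≈.trans ∙∘ (∙-cong (≈.trans assoc (≈.trans (∘-resp-≈ʳ project₂) q))
                          (≈.trans assoc (≈.trans (∘-resp-≈ʳ project₁) p)))))

    direct-unit : d ∘ unit ≈ η
    direct-unit = direct-β _ _

    inverse-unit : i ∘ unit ≈ η
    inverse-unit = inverse-β _ _

    private
      ε-direct : ∀ {Z} → d ∘ (unit ∘ ! {Z}) ≈ ε
      ε-direct = ≈.trans (≈.sym assoc) (∘-resp-≈ˡ direct-unit)

      ε-inverse : ∀ {Z} → i ∘ (unit ∘ ! {Z}) ≈ ε
      ε-inverse = ≈.trans (≈.sym assoc) (∘-resp-≈ˡ inverse-unit)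

    unitMonoid : MonoidObject cD
    unitMonoid = record
      { Carrier = Units M
      ; μ = mult
      ; η = unit
      ; μ-assoc = unit-monic
          (≈.trans (direct-mult (direct-mult ≈.refl ≈.refl) ≈.refl) (≈.trans (∙-assoc _ _ _)
            (≈.sym (direct-mult ≈.refl (direct-mult ≈.refl ≈.refl)))))
          (≈.trans (inverse-mult (inverse-mult ≈.refl ≈.refl) ≈.refl) (≈.trans (≈.sym (∙-assoc _ _ _))
            (≈.sym (inverse-mult ≈.refl (inverse-mult ≈.refl ≈.refl)))))
      ; μ-identityˡ = unit-monic
          (≈.trans (direct-mult ε-direct ≈.refl) (∙-identityˡ _))
          (≈.trans (inverse-mult ε-inverse ≈.refl) (∙-identityʳ _))
      ; μ-identityʳ = unit-monic
          (≈.trans (direct-mult ≈.refl ε-direct) (∙-identityʳ _))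
          (≈.trans (inverse-mult ≈.refl ε-inverse) (∙-identityˡ _)) }

    unitGroup : GroupObject cD
    unitGroup = record
      { monoid = unitMonoid
      ; ι = inv
      ; μ-inverseˡ = unit-monic
          (≈.trans (direct-mult (direct-β _ _) identityʳ) (≈.trans (inverse-direct M) (≈.sym ε-direct)))
          (≈.trans (inverse-mult (inverse-β _ _) identityʳ) (≈.trans (inverse-direct M) (≈.sym ε-inverse)))
      ; μ-inverseʳ = unit-monic
          (≈.trans (direct-mult identityʳ (direct-β _ _)) (≈.trans (direct-inverse M) (≈.sym ε-direct)))
          (≈.trans (inverse-mult identityʳ (inverse-β _ _)) (≈.trans (direct-inverse M) (≈.sym ε-inverse))) }

    direct-hom : MonoidObjectHom cD unitMonoid M
    direct-hom = record
      { hom = d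
      ; hom-μ = direct-β _ _
      ; hom-η = direct-unit }

    direct-ι : d ∘ inv ≈ i
    direct-ι = direct-β _ _

  module _ {M N : MonoidObject cD} (f : MonoidObjectHom cD M N) where
    private
      module M = MonoidElements cD M
      module N = MonoidElements cD N
    open MonoidObjectHom f
    open HomElements cD {M} {N} f

    private
      preserves : ∀ {Z} {x y : Z ⇒ MonoidObject.Carrier M} → x M.∙ y ≈ M.ε → (hom ∘ x) N.∙ (hom ∘ y) ≈ N.ε
      preserves p = ≈.trans (≈.sym hom-∙) (≈.trans (∘-resp-≈ʳ p) hom-ε)

    unitMap : Units M ⇒ Units N
    unitMap = I.unitElement N (hom ∘ direct M) (hom ∘ inverse M)
      (preserves (direct-inverse M)) (preserves (inverse-direct M))

    unitMap-direct : direct N ∘ unitMap ≈ hom ∘ direct M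
    unitMap-direct = I.direct-β N _ _

    unitMap-inverse : inverse N ∘ unitMap ≈ hom ∘ inverse M
    unitMap-inverse = I.inverse-β N _ _

    private
      slideᵈ : ∀ {Z} {x : Z ⇒ Units M} → direct N ∘ (unitMap ∘ x) ≈ hom ∘ (direct M ∘ x)
      slideᵈ = ≈.trans (≈.sym assoc) (≈.trans (∘-resp-≈ˡ unitMap-direct) assoc)

      slideⁱ : ∀ {Z} {x : Z ⇒ Units M} → inverse N ∘ (unitMap ∘ x) ≈ hom ∘ (inverse M ∘ x)
      slideⁱ = ≈.trans (≈.sym assoc) (≈.trans (∘-resp-≈ˡ unitMap-inverse) assoc)

    unitHom : MonoidObjectHom cD (unitMonoid M) (unitMonoid N)
    unitHom = record
      { hom = unitMap
      ; hom-μ = I.unit-monic N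
          (≈.trans slideᵈ (≈.trans (∘-resp-≈ʳ (I.direct-β M _ _)) (≈.trans hom-∙
            (≈.sym (≈.trans (direct-mult N ≈.refl ≈.refl) (N.∙-cong slideᵈ slideᵈ))))))
          (≈.trans slideⁱ (≈.trans (∘-resp-≈ʳ (I.inverse-β M _ _)) (≈.trans hom-∙
            (≈.sym (≈.trans (inverse-mult N ≈.refl ≈.refl) (N.∙-cong slideⁱ slideⁱ))))))
      ; hom-η = I.unit-monic N
          (≈.trans slideᵈ (≈.trans (∘-resp-≈ʳ (direct-unit M))
            (≈.trans hom-η (≈.sym (direct-unit N)))))
          (≈.trans slideⁱ (≈.trans (∘-resp-≈ʳ (inverse-unit M))
            (≈.trans hom-η (≈.sym (inverse-unit N))))) }

  units : Functor (Mon cD) (Grp cD)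
  units = record
    { F₀ = unitGroup
    ; F₁ = unitHom
    ; identity = λ {M} → I.unit-monic M
        (≈.trans (unitMap-direct (Category.id (Mon cD) {M})) (≈.trans identityˡ (≈.sym identityʳ)))
        (≈.trans (unitMap-inverse (Category.id (Mon cD) {M})) (≈.trans identityˡ (≈.sym identityʳ)))
    ; homomorphism = λ {L} {M} {N} {f} {g} → I.unit-monic N
        (≈.trans (unitMap-direct (Category._∘_ (Mon cD) {L} {M} {N} g f)) (≈.trans assoc
          (≈.sym (≈.trans (≈.sym assoc) (≈.trans (∘-resp-≈ˡ (unitMap-direct g))
            (≈.trans assoc (∘-resp-≈ʳ (unitMap-direct f))))))))
        (≈.trans (unitMap-inverse (Category._∘_ (Mon cD) {L} {M} {N} g f)) (≈.trans assoc
          (≈.sym (≈.trans (≈.sym assoc) (≈.trans (∘-resp-≈ˡ (unitMap-inverse g))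
            (≈.trans assoc (∘-resp-≈ʳ (unitMap-inverse f))))))))
    ; F-resp-≈ = λ {M} {N} {f} {g} e → I.unit-monic N
        (≈.trans (unitMap-direct f) (≈.trans (∘-resp-≈ˡ e) (≈.sym (unitMap-direct g))))
        (≈.trans (unitMap-inverse f) (≈.trans (∘-resp-≈ˡ e) (≈.sym (unitMap-inverse g)))) }

-- Points of the objects of units as invertible points.

module _ (M : Monoid o κ) where
  open Monoid M
  open import Relation.Binary.Reasoning.Setoid setoid

  inverses-unique : ∀ {x y x′ y′} → y ∙ x ≈ ε → x′ ∙ y′ ≈ ε → x ≈ x′ → y ≈ y′
  inverses-unique {x} {y} {x′} {y′} p q e = begin
    y               ≈⟨ identityʳ y ⟨
    y ∙ ε           ≈⟨ ∙-congˡ q ⟨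
    y ∙ (x′ ∙ y′)   ≈⟨ assoc _ _ _ ⟨
    y ∙ x′ ∙ y′     ≈⟨ ∙-congʳ (∙-congˡ (sym e)) ⟩
    y ∙ x ∙ y′      ≈⟨ ∙-congʳ p ⟩
    ε ∙ y′          ≈⟨ identityˡ y′ ⟩
    y′              ∎

module UnitPoints {D : Category o κ} {D′ : Category o′ κ} (cD : Cartesian D) (cD′ : Cartesian D′)
                  (equalizers : Equalizers D)
                  (isEqualizer : PreservesEqualizers equalizers (idF {D = D}))
                  (F : Functor D D′) (pres : PreservesProducts cD F)
                  (F-eq : PreservesEqualizers equalizers F) (N : ProMonoid cD) where
  open UnitObjects cD equalizers isEqualizer
  open Category D′
  open Cartesian cD′
  open Functor F
  private
    module D = Category D
    module cD = Cartesian cD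
    module N = IndObject N
    module T = IsTerminal (PreservesProducts.F-terminal pres)
    module P {A B : D.Obj} = IsProduct (PreservesProducts.F-product pres {A} {B})

  N′ : ProMonoid cD′
  N′ = Functor.F₀ (mapPro (mapMon cD′ {F = F} pres)) N

  G′ : ProGroup cD′
  G′ = Functor.F₀ (mapPro (mapGrp cD′ {F = F} pres)) (Functor.F₀ (mapPro units) N)

  private
    ∣N′∣ ∣G′∣ : Category.Obj (Pro D′)
    ∣N′∣ = Functor.F₀ (mapPro (Mon⇒C cD′)) N′
    ∣G′∣ = Functor.F₀ (mapPro (Mon⇒C cD′)) (Functor.F₀ (mapPro (Grp⇒Mon cD′)) G′)

    module Γ = Monoid (Γᴹ cD′ N′)
    module Γᵍ = Group (Γᴳ cD′ G′)
    module Q = ProPoints cD′ ∣N′∣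
    module R = ProPoints cD′ ∣G′∣
    module E j = UnitElements F pres F-eq (N.F₀ j)

    F-square : ∀ {W A B B′ C} {f : B D.⇒ C} {g : A D.⇒ B} {f′ : B′ D.⇒ C} {g′ : A D.⇒ B′}
               {k : W ⇒ F₀ A} → f D.∘ g D.≈ f′ D.∘ g′ → F₁ f ∘ (F₁ g ∘ k) ≈ F₁ f′ ∘ (F₁ g′ ∘ k)
    F-square p = ≈.trans (≈.sym assoc) (≈.trans (∘-resp-≈ˡ (≈.trans (≈.sym homomorphism)
      (≈.trans (F-resp-≈ p) homomorphism))) assoc)

    module _ {x y : Γ.Carrier} where
      inverses : (x Γ.∙ y) Γ.≈ Γ.ε → ∀ j → E.Inverses j (Q.at x j) (Q.at y j)
      inverses e j = ≈.trans (∘-resp-≈ʳ (≈.sym (φ∘⟨⟩ cD′ pres))) (≈.trans (≈.sym assoc)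
        (≈.trans (Q.at-cong {x Γ.∙ y} {Γ.ε} e j)
          (≈.trans assoc (∘-resp-≈ʳ (≈.sym (T.!-unique _))))))

  unitPoint : (x y : Γ.Carrier) → (x Γ.∙ y) Γ.≈ Γ.ε → (y Γ.∙ x) Γ.≈ Γ.ε → Γᵍ.Carrier
  unitPoint x y p q = R.point z z-compatible
    where
    z : ∀ j → 𝟏 ⇒ F₀ (Units (N.F₀ j))
    z j = E.unitElement j (Q.at x j) (Q.at y j) (inverses {x} {y} p j) (inverses {y} {x} q j)
    z-compatible : ∀ {i j} (f : i N.J.⇒ j) → F₁ (unitMap (N.F₁ f)) ∘ z j ≈ z i
    z-compatible {i} {j} f = E.unit-monic i
      (≈.trans (F-square (unitMap-direct (N.F₁ f))) (≈.trans (∘-resp-≈ʳ (E.direct-β j _ _))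
        (≈.trans (Q.at-compatible x f) (≈.sym (E.direct-β i _ _)))))
      (≈.trans (F-square (unitMap-inverse (N.F₁ f))) (≈.trans (∘-resp-≈ʳ (E.inverse-β j _ _))
        (≈.trans (Q.at-compatible y f) (≈.sym (E.inverse-β i _ _)))))

  directPoint : Γᵍ.Carrier → Γ.Carrier
  directPoint z = Q.point (λ j → F₁ (direct (N.F₀ j)) ∘ R.at z j) λ {i} {j} f →
    ≈.trans (F-square (D.≈.sym (unitMap-direct (N.F₁ f)))) (∘-resp-≈ʳ (R.at-compatible z f))

  directPoint-unitPoint : ∀ x y p q → directPoint (unitPoint x y p q) Γ.≈ x
  directPoint-unitPoint x y p q = Q.at-injective {directPoint (unitPoint x y p q)} {x}
    λ j → E.direct-β j _ _

  directPoint-cong : ∀ {z w} → z Γᵍ.≈ w → directPoint z Γ.≈ directPoint w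
  directPoint-cong {z} {w} e = Q.at-injective {directPoint z} {directPoint w}
    λ j → ∘-resp-≈ʳ (R.at-cong {z} {w} e j)

  private
    module H j = HomElements cD′ (mapMonoidObjectHom cD′ {F = F} pres (direct-hom (N.F₀ j)))

  directPoint-∙ : ∀ z w → directPoint (z Γᵍ.∙ w) Γ.≈ (directPoint z Γ.∙ directPoint w)
  directPoint-∙ z w = Q.at-injective {directPoint (z Γᵍ.∙ w)} {directPoint z Γ.∙ directPoint w}
    λ j → H.hom-∙ j

  directPoint-ε : directPoint Γᵍ.ε Γ.≈ Γ.ε
  directPoint-ε = Q.at-injective {directPoint Γᵍ.ε} {Γ.ε} λ j → H.hom-ε j

  directPoint-inverseʳ : ∀ z → (directPoint z Γ.∙ directPoint (z Γᵍ.⁻¹)) Γ.≈ Γ.ε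
  directPoint-inverseʳ z = Γ.trans {i} {directPoint (z Γᵍ.∙ z Γᵍ.⁻¹)} {Γ.ε}
    (Γ.sym {directPoint (z Γᵍ.∙ z Γᵍ.⁻¹)} {i} (directPoint-∙ z (z Γᵍ.⁻¹)))
    (Γ.trans {directPoint (z Γᵍ.∙ z Γᵍ.⁻¹)} {directPoint Γᵍ.ε} {Γ.ε}
      (directPoint-cong {z Γᵍ.∙ z Γᵍ.⁻¹} {Γᵍ.ε} (Γᵍ.inverseʳ z)) directPoint-ε)
    where
    i = directPoint z Γ.∙ directPoint (z Γᵍ.⁻¹)

  directPoint-inverseˡ : ∀ z → (directPoint (z Γᵍ.⁻¹) Γ.∙ directPoint z) Γ.≈ Γ.ε
  directPoint-inverseˡ z = Γ.trans {i} {directPoint (z Γᵍ.⁻¹ Γᵍ.∙ z)} {Γ.ε}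
    (Γ.sym {directPoint (z Γᵍ.⁻¹ Γᵍ.∙ z)} {i} (directPoint-∙ (z Γᵍ.⁻¹) z))
    (Γ.trans {directPoint (z Γᵍ.⁻¹ Γᵍ.∙ z)} {directPoint Γᵍ.ε} {Γ.ε}
      (directPoint-cong {z Γᵍ.⁻¹ Γᵍ.∙ z} {Γᵍ.ε} (Γᵍ.inverseˡ z)) directPoint-ε)
    where
    i = directPoint (z Γᵍ.⁻¹) Γ.∙ directPoint z

  -- By `direct-ι`, the second half of `z` is the first half of its inverse. The latter is an
  -- inverse of `directPoint z` among the points of the monoid, hence determined by it.
  directPoint-injective : ∀ {z w} → directPoint z Γ.≈ directPoint w → z Γᵍ.≈ w
  directPoint-injective {z} {w} e = R.at-injective {z} {w} λ j → E.unit-monic j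
      (Q.at-cong {directPoint z} {directPoint w} e j)
      (≈.trans (inverse-at z j) (≈.trans
        (Q.at-cong {directPoint (z Γᵍ.⁻¹)} {directPoint (w Γᵍ.⁻¹)} e⁻¹ j) (≈.sym (inverse-at w j))))
    where
    e⁻¹ : directPoint (z Γᵍ.⁻¹) Γ.≈ directPoint (w Γᵍ.⁻¹)
    e⁻¹ = inverses-unique (Γᴹ cD′ N′)
      {directPoint z} {directPoint (z Γᵍ.⁻¹)} {directPoint w} {directPoint (w Γᵍ.⁻¹)}
      (directPoint-inverseˡ z) (directPoint-inverseʳ w) e
    inverse-at : ∀ z j → F₁ (inverse (N.F₀ j)) ∘ R.at z j ≈ Q.at (directPoint (z Γᵍ.⁻¹)) j
    inverse-at z j = ≈.sym (≈.trans (≈.sym assoc) (∘-resp-≈ˡ (≈.trans (≈.sym homomorphism)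
      (F-resp-≈ (direct-ι (N.F₀ j))))))

-- Equalizers as finite limits.

data Arrow : Fin 2 → Fin 2 → Set where
  stay     : ∀ {i} → Arrow i i
  one two : Arrow fzero (fsuc fzero)

ParallelPair : Category 0ℓ 0ℓ
ParallelPair = record
  { Obj = Fin 2 ; _⇒_ = Arrow ; _≈_ = _≡_ ; id = stay ; _∘_ = compose
  ; equiv = ≡ₚ.isEquivalence
  ; assoc = λ {_} {_} {_} {_} {f} {g} {h} → assoc f g h
  ; identityˡ = ≡.refl
  ; identityʳ = identityʳ
  ; ∘-resp-≈ = ≡.cong₂ compose }
  where
  compose : ∀ {i j k} → Arrow j k → Arrow i j → Arrow i k
  compose stay f = f
  compose one stay = one
  compose two stay = two
  assoc : ∀ {i j k l} (f : Arrow i j) (g : Arrow j k) (h : Arrow k l) →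
          compose (compose h g) f ≡ compose h (compose g f)
  assoc f g stay = ≡.refl
  assoc f stay one = ≡.refl
  assoc f stay two = ≡.refl
  identityʳ : ∀ {i j} {f : Arrow i j} → compose f stay ≡ f
  identityʳ {f = stay} = ≡.refl
  identityʳ {f = one} = ≡.refl
  identityʳ {f = two} = ≡.refl

ParallelPair-finite : IsFinite ParallelPair
ParallelPair-finite = record
  { #Obj = 2 ; obj = Identity.↔-id (Fin 2)
  ; #hom = λ i j → proj₁ (homs i j) ; hom = λ i j → proj₂ (homs i j) }
  where
  homs : ∀ i j → Σ[ n ∈ ℕ ] Inverse (≡ₚ.setoid (Fin n)) (≡ₚ.setoid (Arrow i j))
  homs fzero fzero = 1 , record
    { to = λ _ → stay ; from = λ _ → fzero ; to-cong = λ _ → ≡.refl ; from-cong = λ _ → ≡.refl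
    ; inverse = (λ { {stay} _ → ≡.refl }) , (λ { {fzero} _ → ≡.refl }) }
  homs (fsuc fzero) (fsuc fzero) = 1 , record
    { to = λ _ → stay ; from = λ _ → fzero ; to-cong = λ _ → ≡.refl ; from-cong = λ _ → ≡.refl
    ; inverse = (λ { {stay} _ → ≡.refl }) , (λ { {fzero} _ → ≡.refl }) }
  homs fzero (fsuc fzero) = 2 , record
    { to = to ; from = from ; to-cong = ≡.cong to ; from-cong = ≡.cong from
    ; inverse = (λ { ≡.refl → to-from _ }) , (λ { ≡.refl → from-to _ }) }
    where
    to : Fin 2 → Arrow fzero (fsuc fzero)
    to fzero = one
    to (fsuc fzero) = two
    from : Arrow fzero (fsuc fzero) → Fin 2
    from one = fzero
    from two = fsuc fzero
    to-from : ∀ x → to (from x) ≡ x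
    to-from one = ≡.refl
    to-from two = ≡.refl
    from-to : ∀ x → from (to x) ≡ x
    from-to fzero = ≡.refl
    from-to (fsuc fzero) = ≡.refl
  homs (fsuc fzero) fzero = 0 , record
    { to = λ () ; from = λ () ; to-cong = λ { {()} } ; from-cong = λ { {()} }
    ; inverse = (λ { {()} }) , (λ { {()} }) }

module _ {C : Category o κ} where
  open Category C

  parallel : ∀ {A B} → A ⇒ B → A ⇒ B → Functor ParallelPair C
  parallel {A} {B} f g = record
    { F₀ = F₀ ; F₁ = F₁ ; identity = ≈.refl
    ; homomorphism = λ {_} {_} {_} {u} {v} → homomorphism u v
    ; F-resp-≈ = λ { ≡.refl → ≈.refl } }
    where
    F₀ : Fin 2 → Obj
    F₀ fzero = A
    F₀ (fsuc fzero) = B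
    F₁ : ∀ {i j} → Arrow i j → F₀ i ⇒ F₀ j
    F₁ stay = id
    F₁ one = f
    F₁ two = g
    homomorphism : ∀ {i j k} (u : Arrow i j) (v : Arrow j k) →
                   F₁ (Category._∘_ ParallelPair v u) ≈ F₁ v ∘ F₁ u
    homomorphism u stay = ≈.sym identityˡ
    homomorphism stay one = ≈.sym identityʳ
    homomorphism stay two = ≈.sym identityʳ

  limit⇒equalizer : {F : Functor ParallelPair C} {L : Cone F} → IsLimit L →
                    IsEqualizer C (Functor.F₁ F one) (Functor.F₁ F two) (Cone.ψ L fzero)
  limit⇒equalizer {F} {L} lim = record
    { equality = ≈.trans (commute one) (≈.sym (commute two))
    ; factor = λ h p → factor (cone h p)
    ; factor-β = λ p → factor-ψ (cone _ p) fzero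
    -- Both maps factor the cone obtained by restricting the limit cone along `k`; its leg at the
    -- codomain is forced by the leg at the domain.
    ; monic = λ {_} {h} {k} e → ≈.trans (≈.sym (unique (restricted k) h (along e)))
        (unique (restricted k) k (along ≈.refl)) }
    where
    open IsLimit lim
    open Cone L using (apex; ψ; commute)
    open Functor F
    cone : ∀ {Z} (h : Z ⇒ F₀ fzero) → F₁ one ∘ h ≈ F₁ two ∘ h → Cone F
    cone {Z} h p = record
      { apex = Z
      ; ψ = λ { fzero → h ; (fsuc fzero) → F₁ one ∘ h }
      ; commute = λ
        { {fzero} stay → ≈.trans (∘-resp-≈ˡ identity) identityˡ
        ; {fsuc fzero} stay → ≈.trans (∘-resp-≈ˡ identity) identityˡ
        ; one → ≈.refl ; two → ≈.sym p } }
    restricted : ∀ {Z} → Z ⇒ apex → Cone F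
    restricted k = record
      { apex = _ ; ψ = λ i → ψ i ∘ k
      ; commute = λ u → ≈.trans (≈.sym assoc) (∘-resp-≈ˡ (commute u)) }
    along : ∀ {Z} {h k : Z ⇒ apex} → ψ fzero ∘ h ≈ ψ fzero ∘ k → ∀ i → ψ i ∘ h ≈ ψ i ∘ k
    along e fzero = e
    along e (fsuc fzero) = ≈.trans (∘-resp-≈ˡ (≈.sym (commute one))) (≈.trans assoc
      (≈.trans (∘-resp-≈ʳ e) (≈.trans (≈.sym assoc) (∘-resp-≈ˡ (commute one)))))

module _ {C : Category o κ} (lim : HasFiniteLimits C) where
  private
    limit : ∀ {A B} (f g : Category._⇒_ C A B) → Σ (Cone (parallel {C = C} f g)) IsLimit
    limit f g = lim ParallelPair ParallelPair-finite (parallel f g)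

  limit-equalizers : Equalizers C
  limit-equalizers = record
    { Eq = λ f g → Cone.apex (proj₁ (limit f g))
    ; arr = λ f g → Cone.ψ (proj₁ (limit f g)) fzero }

  limit-isEqualizer : PreservesEqualizers limit-equalizers (idF {D = C})
  limit-isEqualizer f g = limit⇒equalizer (proj₂ (limit f g))

  preservesEqualizers : {E : Category o′ κ} {H : Functor C E} → PreservesFiniteLimits H →
                        PreservesEqualizers limit-equalizers H
  preservesEqualizers pres f g = limit⇒equalizer
    (pres ParallelPair ParallelPair-finite (parallel f g) (proj₁ (limit f g)) (proj₂ (limit f g)))

-- Equalizers of ind-objects.

module TermwiseEqualizer {C : Category o κ} {V W K : IndObject C} (f g : IndHom V W) (e : IndHom K V)
  where
  open Category C
  private
    module V = IndObject V
    module W = IndObject W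
    module K = IndObject K
    module f = IndHom f
    module g = IndHom g
    module e k = Germ (IndHom.comp e k)

  -- A criterion in terms of germs, usable both before and after `H` is applied. By `lifting`, an
  -- equalizing arrow factors through some term of `K` after a transition in `V`; by `dominate`, two
  -- terms of `K` lying below one index `j` of `V` pass to a term of `K` beyond `j`, compatibly with
  -- the transitions.
  module _
    (equality : Ind C [ Category._∘_ (Ind C) {K} {V} {W} f e ≈ Category._∘_ (Ind C) {K} {V} {W} g e ])
    (monic : ∀ k {Z} {h h′ : Z ⇒ K.F₀ k} → e.arr k ∘ h ≈ e.arr k ∘ h′ → h ≈ h′)
    (lifting : ∀ {Z} i (h : Z ⇒ V.F₀ i) → f.comp i · h ∼ g.comp i · h →
      Σ[ k ∈ K.J.Obj ] Σ[ c ∈ i V.J.⇒ e.at k ] Σ[ h′ ∈ Z ⇒ K.F₀ k ] e.arr k ∘ h′ ≈ V.F₁ c ∘ h)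
    (dominate : ∀ {j} k k′ (a : e.at k V.J.⇒ j) (b : e.at k′ V.J.⇒ j) →
      Σ[ m ∈ K.J.Obj ] Σ[ a′ ∈ k K.J.⇒ m ] Σ[ b′ ∈ k′ K.J.⇒ m ] Σ[ c ∈ j V.J.⇒ e.at m ]
      (e.arr m ∘ K.F₁ a′ ≈ V.F₁ c ∘ (V.F₁ a ∘ e.arr k)) ×
      (e.arr m ∘ K.F₁ b′ ≈ V.F₁ c ∘ (V.F₁ b ∘ e.arr k′)))
    where
    private
      -- The images in `V` agree at some index. By `dominate` the comparison moves to a single term
      -- of `K`, where `e` is given by a monomorphism of `C`.
      germ-monic : ∀ {Z} {x y : Germ Z K} → e ⊙ x ∼ e ⊙ y → x ∼ y
      germ-monic {x = germ k s} {germ k′ s′} (agree a b p)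
        with m , a′ , b′ , c , q , q′ ← dominate k k′ a b = agree a′ b′ (monic m
          (≈.trans (along q) (≈.trans (∘-resp-≈ʳ p) (≈.sym (along q′)))))
        where
        along : ∀ {Z A B j} {r : A ⇒ K.F₀ m} {t : A ⇒ B} {v : B ⇒ V.F₀ j} {c : V.F₀ j ⇒ V.F₀ (e.at m)}
                {s : Z ⇒ A} → e.arr m ∘ r ≈ c ∘ (v ∘ t) → e.arr m ∘ (r ∘ s) ≈ c ∘ (v ∘ (t ∘ s))
        along q = ≈.trans (≈.sym assoc) (≈.trans (∘-resp-≈ˡ q)
          (≈.trans assoc (∘-resp-≈ʳ assoc)))

      module Factor {Z : IndObject C} (h : IndHom Z V)
        (p : Ind C [ Category._∘_ (Ind C) {Z} {V} {W} f h ≈ Category._∘_ (Ind C) {Z} {V} {W} g h ]) where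
        private
          module h = IndHom h
          module Z = IndObject Z

          lifted : ∀ z → _
          lifted z = lifting (Germ.at (h.comp z)) (Germ.arr (h.comp z)) (p z)

        comp : ∀ z → Germ (Z.F₀ z) K
        comp z = germ (proj₁ (lifted z)) (proj₁ (proj₂ (proj₂ (lifted z))))

        comp-β : ∀ z → e ⊙ comp z ∼ h.comp z
        comp-β z = ∼-trans (≈⇒∼ (proj₂ (proj₂ (proj₂ (lifted z)))))
          (transition (proj₁ (proj₂ (lifted z))))

        factor : IndHom Z K
        factor = record
          { comp = comp
          ; natural = λ {i} {j} u → germ-monic (∼-trans (≈⇒∼ (≈.sym assoc))
              (∼-trans (·-resp (comp-β j) ≈.refl) (∼-trans (h.natural u) (∼-sym (comp-β i))))) }

    isEqualizer : IsEqualizer (Ind C) f g e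
    isEqualizer = record
      { equality = equality
      ; factor = λ {Z} h p → Factor.factor {Z} h p
      ; factor-β = λ {Z} {h} p → Factor.comp-β {Z} h p
      ; monic = λ q i → germ-monic (q i) }

module IndEqualizers {C : Category o κ} (equalizers : Equalizers C)
                     (isEq : PreservesEqualizers equalizers (idF {D = C})) where
  open Category C
  open Equalizers equalizers

  module Construction {V W : IndObject C} (f g : IndHom V W) where
    private
      module V = IndObject V
      module W = IndObject W
      module f = IndHom f
      module g = IndHom g
      module fᵍ i = Germ (f.comp i)
      module gᵍ i = Germ (g.comp i)

    -- At a stage, f and g are represented by two arrows from a term of V to
    -- the same term of W.
    record Stage : Set κ where
      constructor stage
      field
        base  : V.J.Obj
        level : W.J.Obj
        left  : fᵍ.at base W.J.⇒ level
        right : gᵍ.at base W.J.⇒ level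

      leftArrow rightArrow : V.F₀ base ⇒ W.F₀ level
      leftArrow  = W.F₁ left ∘ fᵍ.arr base
      rightArrow = W.F₁ right ∘ gᵍ.arr base

      object : Obj
      object = Eq leftArrow rightArrow

      inclusion : object ⇒ V.F₀ base
      inclusion = arr leftArrow rightArrow

      module Eq = IsEqualizer (isEq leftArrow rightArrow)

    -- It records that a transition of `V` carries one equalizer into the other, with no map between
    -- the levels in `W`. As inclusions are monic, `index` determines `restrict`; comparing arrows
    -- by `index` makes coequalizing them a question about the index category of `V`.
    record StageHom (k k′ : Stage) : Set κ where
      private
        module k = Stage k
        module k′ = Stage k′
      field
        index      : k.base V.J.⇒ k′.base
        restrict   : k.object ⇒ k′.object
        restrict-β : k′.inclusion ∘ restrict ≈ V.F₁ index ∘ k.inclusion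

    open StageHom

    Stages : Category κ κ
    Stages = record
      { Obj = Stage
      ; _⇒_ = StageHom
      ; _≈_ = λ a b → index a V.J.≈ index b
      ; id = record
        { index = V.J.id ; restrict = id
        ; restrict-β = ≈.trans identityʳ (≈.sym (≈.trans (∘-resp-≈ˡ V.identity) identityˡ)) }
      ; _∘_ = λ b a → record
        { index = index b V.J.∘ index a
        ; restrict = restrict b ∘ restrict a
        ; restrict-β = ≈.trans (≈.sym assoc) (≈.trans (∘-resp-≈ˡ (restrict-β b)) (≈.trans assoc
            (≈.trans (∘-resp-≈ʳ (restrict-β a)) (≈.trans (≈.sym assoc)
              (∘-resp-≈ˡ (≈.sym V.homomorphism)))))) }
      ; equiv = record { refl = V.J.≈.refl ; sym = V.J.≈.sym ; trans = V.J.≈.trans }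
      ; assoc = V.J.assoc ; identityˡ = V.J.identityˡ ; identityʳ = V.J.identityʳ
      ; ∘-resp-≈ = V.J.∘-resp-≈ }

    private
      Equalizing : ∀ {i Z} → Z ⇒ V.F₀ i → Set κ
      Equalizing {i} z = f.comp i · z ∼ g.comp i · z

      inclusion-equalizing : ∀ k → Equalizing (Stage.inclusion k)
      inclusion-equalizing k = agree left right (≈.trans (≈.sym assoc) (≈.trans Eq.equality assoc))
        where open Stage k

      transport-equalizing : ∀ {i j Z} {z : Z ⇒ V.F₀ i} (a : i V.J.⇒ j) →
                             Equalizing z → Equalizing (V.F₁ a ∘ z)
      transport-equalizing a e = ∼-trans (≈⇒∼ (≈.sym assoc)) (∼-trans (·-resp (f.natural a) ≈.refl)
        (∼-trans e (∼-trans (·-resp (∼-sym (g.natural a)) ≈.refl) (≈⇒∼ assoc))))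

      opaque
        -- Each of the two arrows is equalized through transitions of its own; a single stage must
        -- admit both, so one pair of transitions has to serve for the two.
        common : ∀ {i Z Z′} (z : Z ⇒ V.F₀ i) (z′ : Z′ ⇒ V.F₀ i) → Equalizing z → Equalizing z′ →
          Σ[ l ∈ W.J.Obj ] Σ[ v ∈ fᵍ.at i W.J.⇒ l ] Σ[ w ∈ gᵍ.at i W.J.⇒ l ]
          ((W.F₁ v ∘ fᵍ.arr i) ∘ z ≈ (W.F₁ w ∘ gᵍ.arr i) ∘ z) ×
          ((W.F₁ v ∘ fᵍ.arr i) ∘ z′ ≈ (W.F₁ w ∘ gᵍ.arr i) ∘ z′)
        common z z′ (agree {m} L R p) (agree {m′} L′ R′ p′)
          -- Beyond both levels, `c` makes the two left transitions equal, and then `c′` the two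
          -- right ones.
          with n , a , a′ ← W.bound m m′
          with n₁ , c , q ← W.coeq (a W.J.∘ L) (a′ W.J.∘ L′)
          with n₂ , c′ , q′ ← W.coeq (c W.J.∘ (a W.J.∘ R)) (c W.J.∘ (a′ W.J.∘ R′)) =
            n₂ , (c′ W.J.∘ (c W.J.∘ (a W.J.∘ L))) , (c′ W.J.∘ (c W.J.∘ (a W.J.∘ R))) ,
            ≈.trans (push W.J.≈.refl) (≈.trans (∘-resp-≈ʳ p) (≈.sym (push W.J.≈.refl))) ,
            ≈.trans (push (W.J.∘-resp-≈ʳ q)) (≈.trans (∘-resp-≈ʳ p′) (≈.sym (push q′)))
          where
          push : ∀ {Z B i m n n₁ n₂} {L : i W.J.⇒ m} {a : m W.J.⇒ n} {c : n W.J.⇒ n₁} {c′ : n₁ W.J.⇒ n₂}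
                 {r : i W.J.⇒ n₂} {s : B ⇒ W.F₀ i} {z : Z ⇒ B} → r W.J.≈ c′ W.J.∘ (c W.J.∘ (a W.J.∘ L)) →
                 (W.F₁ r ∘ s) ∘ z ≈ W.F₁ (c′ W.J.∘ (c W.J.∘ a)) ∘ (W.F₁ L ∘ (s ∘ z))
          push e = ≈.trans assoc (≈.trans (∘-resp-≈ˡ (≈.trans (W.F-resp-≈ (W.J.≈.trans e
            (W.J.≈.trans (W.J.∘-resp-≈ʳ (W.J.≈.sym W.J.assoc)) (W.J.≈.sym W.J.assoc)))) W.homomorphism)) assoc)

    private
      over : ∀ {j} k (a : Stage.base k V.J.⇒ j) {l} (v : fᵍ.at j W.J.⇒ l) (w : gᵍ.at j W.J.⇒ l) →
             (W.F₁ v ∘ fᵍ.arr j) ∘ (V.F₁ a ∘ Stage.inclusion k)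
             ≈ (W.F₁ w ∘ gᵍ.arr j) ∘ (V.F₁ a ∘ Stage.inclusion k) →
             StageHom k (stage j l v w)
      over {j} k a {l} v w p = record
        { index = a
        ; restrict = Stage.Eq.factor (stage j l v w) (V.F₁ a ∘ Stage.inclusion k) p
        ; restrict-β = Stage.Eq.factor-β (stage j l v w) {h = V.F₁ a ∘ Stage.inclusion k} p }

    opaque
      -- Both inclusions, moved to index `j`, are still equalized by `f` and `g`, and `common`
      -- provides a stage with base `j` that receives both. Hence the identity serves as `c`.
      dominate : ∀ {j} k k′ (a : Stage.base k V.J.⇒ j) (b : Stage.base k′ V.J.⇒ j) →
        Σ[ m ∈ Stage ] Σ[ c ∈ j V.J.⇒ Stage.base m ] Σ[ a′ ∈ StageHom k m ] Σ[ b′ ∈ StageHom k′ m ]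
        (index a′ V.J.≈ c V.J.∘ a) × (index b′ V.J.≈ c V.J.∘ b)
      dominate {j} k k′ a b =
        let l , v , w , p , q = common (V.F₁ a ∘ Stage.inclusion k) (V.F₁ b ∘ Stage.inclusion k′)
              (transport-equalizing a (inclusion-equalizing k))
              (transport-equalizing b (inclusion-equalizing k′))
        in stage j l v w , V.J.id , over k a v w p , over k′ b v w q
           , V.J.≈.sym V.J.identityˡ , V.J.≈.sym V.J.identityˡ

    Stages-filtered : IsFiltered Stages
    Stages-filtered = record
      { point = let l , v , w = W.bound (fᵍ.at V.point) (gᵍ.at V.point) in stage V.point l v w
      ; bound = λ k k′ →
          let j , a , b = V.bound (Stage.base k) (Stage.base k′)
              m , _ , a′ , b′ , _ = dominate k k′ a b
          in m , a′ , b′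
      ; coeq = λ {_} {k} a b → coequalize k a b }
      where
      coequalize : ∀ {k} k′ (a b : StageHom k k′) →
                   Σ[ m ∈ Stage ] Σ[ c ∈ StageHom k′ m ] (index c V.J.∘ index a V.J.≈ index c V.J.∘ index b)
      coequalize k′ a b =
        -- An arrow out of the base of `k′` need not lift to stages by itself; `dominate`, applied
        -- to `k′` twice, produces a stage to which it lifts.
        let j , c , q = V.coeq (index a) (index b)
            m , d , c′ , _ , r , _ = dominate k′ k′ c c
        in m , c′ , V.J.≈.trans (V.J.≈.trans (V.J.∘-resp-≈ˡ r) V.J.assoc)
          (V.J.≈.trans (V.J.∘-resp-≈ʳ q)
            (V.J.≈.sym (V.J.≈.trans (V.J.∘-resp-≈ˡ r) V.J.assoc)))

    equalizer : IndObject C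
    equalizer = record
      { index = Stages
      ; filtered = Stages-filtered
      ; diagram = record
        { F₀ = Stage.object
        ; F₁ = restrict
        ; identity = ≈.refl
        ; homomorphism = ≈.refl
        ; F-resp-≈ = λ {_} {k} {a} {b} e → Stage.Eq.monic k (≈.trans (restrict-β a)
            (≈.trans (∘-resp-≈ˡ (V.F-resp-≈ e)) (≈.sym (restrict-β b)))) } }

    inclusion : IndHom equalizer V
    inclusion = record
      { comp = λ k → germ (Stage.base k) (Stage.inclusion k)
      ; natural = λ a → ∼-trans (≈⇒∼ (restrict-β a)) (transition (index a)) }

    equality : ∀ k → f ⊙ IndHom.comp inclusion k ∼ g ⊙ IndHom.comp inclusion k
    equality = inclusion-equalizing

    isEqualizer : IsEqualizer (Ind C) f g inclusion
    isEqualizer = TermwiseEqualizer.isEqualizer {V = V} {W} {equalizer} f g inclusion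
      equality
      (λ k → Stage.Eq.monic k)
      (λ { i h (agree L R p) → stage i _ L R , V.J.id
         , Stage.Eq.factor (stage i _ L R) h (≈.trans assoc (≈.trans p (≈.sym assoc)))
         , ≈.trans (Stage.Eq.factor-β (stage i _ L R) _)
             (≈.sym (≈.trans (∘-resp-≈ˡ V.identity) identityˡ)) })
      (λ k k′ a b → let m , c , a′ , b′ , r , r′ = dominate k k′ a b
                    in m , a′ , b′ , c , reshape a′ r , reshape b′ r′)
      where
      reshape : ∀ {j k m} {a : Stage.base k V.J.⇒ j} {c : j V.J.⇒ Stage.base m} (a′ : StageHom k m) →
                index a′ V.J.≈ c V.J.∘ a →
                Stage.inclusion m ∘ restrict a′ ≈ V.F₁ c ∘ (V.F₁ a ∘ Stage.inclusion k)
      reshape a′ r = ≈.trans (restrict-β a′) (≈.trans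
        (∘-resp-≈ˡ (≈.trans (V.F-resp-≈ r) V.homomorphism)) assoc)

    module _ {E : Category o′ κ} (H : Functor C E) (H-eq : PreservesEqualizers equalizers H) where
      private
        module E = Category E
        module H = Functor H
        module Eqᴴ k = IsEqualizer (H-eq (Stage.leftArrow k) (Stage.rightArrow k))

      -- The same stages work in `E`: a stage depends only on transitions of `V` and `W`, which are
      -- unchanged by `H`, and `H` preserves the equalizer at each stage.
      mapped-isEqualizer : IsEqualizer (Ind E) (Functor.F₁ (mapInd H) {V} {W} f)
        (Functor.F₁ (mapInd H) {V} {W} g) (Functor.F₁ (mapInd H) {equalizer} {V} inclusion)
      mapped-isEqualizer = TermwiseEqualizer.isEqualizer
        {V = mapIndObject H V} {mapIndObject H W} {mapIndObject H equalizer}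
        (Functor.F₁ (mapInd H) {V} {W} f) (Functor.F₁ (mapInd H) {V} {W} g)
        (Functor.F₁ (mapInd H) {equalizer} {V} inclusion)
        (λ k → ∼-trans (≈⇒∼ (E.≈.sym H.homomorphism)) (∼-trans
          (mapGerm-resp H (equality k)) (≈⇒∼ H.homomorphism)))
        (λ k → Eqᴴ.monic k)
        (λ { i h (agree L R p) → stage i _ L R , V.J.id
           , Eqᴴ.factor (stage i _ L R) h (E.≈.trans (E.≈.trans (E.∘-resp-≈ˡ H.homomorphism) E.assoc)
               (E.≈.trans p (E.≈.sym (E.≈.trans (E.∘-resp-≈ˡ H.homomorphism) E.assoc))))
           , E.≈.trans (Eqᴴ.factor-β (stage i _ L R) _)
               (E.≈.sym (E.≈.trans (E.∘-resp-≈ˡ (E.≈.trans (H.F-resp-≈ V.identity) H.identity)) E.identityˡ)) })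
        (λ k k′ a b → let m , c , a′ , b′ , r , r′ = dominate k k′ a b
                      in m , a′ , b′ , c , reshape a′ r , reshape b′ r′)
        where
        reshape : ∀ {j k m} {a : Stage.base k V.J.⇒ j} {c : j V.J.⇒ Stage.base m} (a′ : StageHom k m) →
          index a′ V.J.≈ c V.J.∘ a →
          H.F₁ (Stage.inclusion m) E.∘ H.F₁ (restrict a′)
          E.≈ H.F₁ (V.F₁ c) E.∘ (H.F₁ (V.F₁ a) E.∘ H.F₁ (Stage.inclusion k))
        reshape a′ r = E.≈.trans (E.≈.sym H.homomorphism) (E.≈.trans
          (H.F-resp-≈ (≈.trans (restrict-β a′) (≈.trans
            (∘-resp-≈ˡ (≈.trans (V.F-resp-≈ r) V.homomorphism)) assoc)))
          (E.≈.trans H.homomorphism (E.∘-resp-≈ʳ H.homomorphism)))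

module _ {o κ : Level} {C : Category o κ} (equalizers : Equalizers C)
         (isEq : PreservesEqualizers equalizers (idF {D = C})) where

  Ind-equalizers : Equalizers (Ind C)
  Ind-equalizers = record
    { Eq = λ {V} {W} f g → IndEqualizers.Construction.equalizer equalizers isEq {V} {W} f g
    ; arr = λ {V} {W} f g → IndEqualizers.Construction.inclusion equalizers isEq {V} {W} f g }

  Ind-isEqualizer : PreservesEqualizers Ind-equalizers (idF {D = Ind C})
  Ind-isEqualizer {V} {W} f g = IndEqualizers.Construction.isEqualizer equalizers isEq {V} {W} f g

  mapInd-preservesEqualizers : ∀ {o′ : Level} {E : Category o′ κ} (H : Functor C E) →
    PreservesEqualizers equalizers H → PreservesEqualizers Ind-equalizers (mapInd H)
  mapInd-preservesEqualizers H H-eq {V} {W} f g =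
    IndEqualizers.Construction.mapped-isEqualizer equalizers isEq {V} {W} f g H H-eq

-- Internal Homs with ind-objects as parameters.

module _ {E : Category o κ} where
  open Category E

  -- More general than `y₀`: the image of `y₀ C A` under `H` has a diagram acting by `H` of the
  -- identity, which equals the identity only up to `≈`.
  constantly : Functor (One {κ}) E → IndObject E
  constantly U = record { index = One ; filtered = One-filtered ; diagram = U }

  module _ (U : Functor (One {κ}) E) where
    open Functor U
    opaque
      constantly-injective : ∀ {Z} {f g : Z ⇒ F₀ tt} →
                             _∼_ {W = constantly U} (germ tt f) (germ tt g) → f ≈ g
      constantly-injective (agree _ _ p) = ≈.trans (≈.sym identityˡ) (≈.trans
        (∘-resp-≈ˡ (≈.sym identity)) (≈.trans p (≈.trans (∘-resp-≈ˡ identity) identityˡ)))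

-- An ind-map from `W ⊗ᵢ constantly U` is a compatible family of arrows out of the terms of `W`,
-- each with the parameter `U`. Through `θ` it becomes a compatible family of germs into `A`, that
-- is, an ind-map from `W` to `A`. Here `θ` is the representation for `Ind C`, and the comparison
-- map for a closed functor.
module IndExponential {o κ : Level} {E : Category o κ} (cE : Cartesian E) (A : IndObject E)
    (U U′ : Functor (One {κ}) E)
    (θ : NatTrans ⟦ A ⟧ (Hom cE (Functor.F₀ U tt) (Functor.F₀ U′ tt))) (θ-iso : IsNatIso θ) where
  open Category E
  open Cartesian cE
  private
    module U = Functor U
    open module Cᴵ = Cartesian (Ind-cartesian cE) using () renaming (_⊗_ to _⊗ᵢ_)
    module θ Z = Func (NatTrans.η θ Z)
    module θ⁻¹ Z = Func (Category.IsIso.inv (θ-iso Z))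

    θ-injective : ∀ {Z} {x y : Germ Z A} → θ.to Z x ≈ θ.to Z y → x ∼ y
    θ-injective {Z} {x} {y} e = ∼-trans (∼-sym (Category.IsIso.isoˡ (θ-iso Z) x))
      (∼-trans (θ⁻¹.cong Z e) (Category.IsIso.isoˡ (θ-iso Z) y))

    θ-β : ∀ {Z} f → θ.to Z (θ⁻¹.to Z f) ≈ f
    θ-β {Z} = Category.IsIso.isoʳ (θ-iso Z)

    component : ∀ W → IndHom (W ⊗ᵢ constantly U) (constantly U′) →
                ∀ w → IndObject.F₀ W w ⊗ U.F₀ tt ⇒ Functor.F₀ U′ tt
    component W s w = Germ.arr (IndHom.comp s (w , tt))

  module _ (T : ∀ {W} → IndHom W A → IndHom (W ⊗ᵢ constantly U) (constantly U′))
           (T-component : ∀ {W} (x : IndHom W A) w →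
              component W (T x) w ≈ θ.to (IndObject.F₀ W w) (IndHom.comp x w)) where

    curryᵢ : ∀ {W} → IndHom (W ⊗ᵢ constantly U) (constantly U′) → IndHom W A
    curryᵢ {W} s = record
      { comp = λ w → θ⁻¹.to (W.F₀ w) (component W s w)
      ; natural = λ {w} {w′} u → θ-injective (≈.trans
          (NatTrans.commute θ (W.F₁ u) (θ⁻¹.to (W.F₀ w′) (component W s w′)))
          (≈.trans (∘-resp-≈ˡ (θ-β (component W s w′)))
          (≈.trans (∘-resp-≈ʳ (⟨⟩-cong ≈.refl (∘-resp-≈ˡ (≈.sym U.identity))))
          (≈.trans (constantly-injective U′ (IndHom.natural s (u , tt)))
            (≈.sym (θ-β (component W s w))))))) }
      where module W = IndObject W

    curryᵢ-β : ∀ {W} (s : IndHom (W ⊗ᵢ constantly U) (constantly U′)) →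
               Ind E [ T {W} (curryᵢ {W} s) ≈ s ]
    curryᵢ-β {W} s (w , tt) = ≈⇒∼ (≈.trans (T-component {W} (curryᵢ {W} s) w) (θ-β (component W s w)))

    T-monic : ∀ {W} {x y : IndHom W A} → Ind E [ T {W} x ≈ T {W} y ] → Ind E [ x ≈ y ]
    T-monic {W} {x} {y} e w = θ-injective (≈.trans (≈.sym (T-component {W} x w))
      (≈.trans (constantly-injective U′ (e (w , tt))) (T-component {W} y w)))

module IndExponentials {o κ : Level} {C : Category o κ} (closed : IndClosed C)
                       {V : Set κ} (ob : V → Category.Obj C) where
  private
    module C = Category C
  open IndClosed closed

  vertexObject : V → IndObject C
  vertexObject a = y₀ C (ob a)

  Ind-exponentials : Exponentials cartᵢ vertexObject
  Ind-exponentials = record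
    { hom = λ a b → hom (ob a) (ob b) ; ev = λ {a} {b} → eval (ob a) (ob b) }

  private
    module Id (a b : V) where
      module T = Transport cartᵢ cartᵢ (idF {D = Ind C}) (idF-preserves× cartᵢ)
      open C
      open Cartesian cart
      open NatTrans (represents (ob a) (ob b))

      T : ∀ {W} → IndHom W (hom (ob a) (ob b)) →
          IndHom (Cartesian._⊗_ cartᵢ W (vertexObject a)) (vertexObject b)
      T {W} x = T._⟪_⟫ {W} {hom (ob a) (ob b)} {vertexObject a} {vertexObject b} (eval (ob a) (ob b)) x

      -- The Yoneda argument: `eval` consists of the images of the identity germs under the
      -- representation, whose naturality then gives the value on an arbitrary germ.
      T-component : ∀ {W} (x : IndHom W (hom (ob a) (ob b))) w →
        Germ.arr (IndHom.comp (T {W} x) (w , tt))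
        ≈ Func.to (η (IndObject.F₀ W w)) (IndHom.comp x w)
      T-component {W} x w = ≈.sym (≈.trans
        (≈.sym (Func.cong (η (IndObject.F₀ W w)) (≈⇒∼ identityˡ)))
        (≈.trans (commute (Germ.arr (IndHom.comp x w)) (germ (Germ.at (IndHom.comp x w)) id))
          (∘-resp-≈ʳ (⟨⟩-cong ≈.refl identityˡ))))

      module X = IndExponential cart (hom (ob a) (ob b)) (const C (ob a)) (const C (ob b))
        (represents (ob a) (ob b)) (represents-iso (ob a) (ob b))

  Ind-isExponential :
    PreservesExponentials cartᵢ cartᵢ (idF {D = Ind C}) (idF-preserves× cartᵢ) Ind-exponentials
  Ind-isExponential = record
    { curry = λ {a} {b} {W} → Id.X.curryᵢ a b
        (λ {W} → Id.T a b {W}) (λ {W} → Id.T-component a b {W}) {W}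
    ; curry-β = λ {a} {b} {W} {s} → Id.X.curryᵢ-β a b
        (λ {W} → Id.T a b {W}) (λ {W} → Id.T-component a b {W}) {W} s
    ; ev-monic = λ {a} {b} {W} {x} {y} → Id.X.T-monic a b
        (λ {W} → Id.T a b {W}) (λ {W} → Id.T-component a b {W}) {W} {x} {y} }

  module _ {o′ : Level} {E : Category o′ κ} (cE : Cartesian E) {H : Functor C E}
           (pres : PreservesProducts cart H)
           (comparison-iso : ∀ X Y → IsNatIso (comparison closed cE pres X Y)) where
    private
      cEᵢ : Cartesian (Ind E)
      cEᵢ = Ind-cartesian cE

      presᵢ : PreservesProducts cartᵢ (mapInd H)
      presᵢ = mapInd-preserves cart {F = H} pres

      module Mapped (a b : V) where
        module T = Transport cartᵢ cEᵢ (mapInd H) presᵢ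
        open Category E
        open Cartesian cE
        open NatTrans (comparison closed cE pres (ob a) (ob b))

        T : ∀ {W} → IndHom W (mapIndObject H (hom (ob a) (ob b))) →
            IndHom (Cartesian._⊗_ cEᵢ W (mapIndObject H (vertexObject a))) (mapIndObject H (vertexObject b))
        T {W} x = T._⟪_⟫ {W} {hom (ob a) (ob b)} {vertexObject a} {vertexObject b} (eval (ob a) (ob b)) x

        T-component : ∀ {W} (x : IndHom W (mapIndObject H (hom (ob a) (ob b)))) w →
          Germ.arr (IndHom.comp (T {W} x) (w , tt))
          ≈ Func.to (η (IndObject.F₀ W w)) (IndHom.comp x w)
        T-component {W} x w = ∘-resp-≈ʳ (≈.sym (≈.trans (φ∘⟨⟩ cE pres)
          (IsProduct.⟨⟩-cong (PreservesProducts.F-product pres) ≈.refl identityˡ)))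

        module X = IndExponential cE (mapIndObject H (hom (ob a) (ob b)))
          (H ∘F const C (ob a)) (H ∘F const C (ob b))
          (comparison closed cE pres (ob a) (ob b)) (comparison-iso (ob a) (ob b))

    mapInd-preservesExponentials : PreservesExponentials cartᵢ cEᵢ (mapInd H) presᵢ Ind-exponentials
    mapInd-preservesExponentials = record
      { curry = λ {a} {b} {W} → Mapped.X.curryᵢ a b
        (λ {W} → Mapped.T a b {W}) (λ {W} → Mapped.T-component a b {W}) {W}
      ; curry-β = λ {a} {b} {W} {s} → Mapped.X.curryᵢ-β a b
        (λ {W} → Mapped.T a b {W}) (λ {W} → Mapped.T-component a b {W}) {W} s
      ; ev-monic = λ {a} {b} {W} {x} {y} → Mapped.X.T-monic a b
        (λ {W} → Mapped.T a b {W}) (λ {W} → Mapped.T-component a b {W}) {W} {x} {y} }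

-- From transformations on vertices to transformations of `H`.

-- The vertices of the second kind, the values of I, are those on which
-- transformations have to be the identity.
module Vertices {o₀ o κ : Level} {C₀ : Category o₀ κ} {C : Category o κ}
                (small₀ : EssentiallySmall C₀) (small : EssentiallySmall C) (I : Functor C₀ C) where
  private
    module small₀ = EssentiallySmall small₀
    module small = EssentiallySmall small

  Vertex : Set κ
  Vertex = small.Index ⊎ small₀.Index

  Fixed : Vertex → Set κ
  Fixed = [ (λ _ → ⊥) , (λ _ → ⊤) ]′

  ob : Vertex → Category.Obj C
  ob = [ small.rep , (λ j → Functor.F₀ I (small₀.rep j)) ]′

module Extension {o₀ o o′ κ : Level} {C₀ : Category o₀ κ} {C : Category o κ} {E : Category o′ κ}
                 (small₀ : EssentiallySmall C₀) (small : EssentiallySmall C)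
                 (I : Functor C₀ C) (H : Functor C E) where
  private
    module C₀ = Category C₀
    module C = Category C
    module I = Functor I
    module small₀ = EssentiallySmall small₀
    module small = EssentiallySmall small
  open Vertices small₀ small I
  open Category E
  open Functor H
  open HomReasoning

  private
    F-iso : ∀ {A B} {f : A C.⇒ B} {g : B C.⇒ A} → f C.∘ g C.≈ C.id → F₁ f ∘ F₁ g ≈ id
    F-iso p = ≈.trans (≈.sym homomorphism) (≈.trans (F-resp-≈ p) identity)

    cancelʳ : ∀ {A B B′} {f : A C.⇒ B} (iso : C.IsIso f) {h k : F₀ B ⇒ B′} →
              h ∘ F₁ f ≈ k ∘ F₁ f → h ≈ k
    cancelʳ iso e = ≈.trans (≈.sym undo) (≈.trans (∘-resp-≈ˡ e) undo)
      where
      undo : ∀ {h} → (h ∘ F₁ _) ∘ F₁ (C.IsIso.inv iso) ≈ h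
      undo = ≈.trans assoc (≈.trans (∘-resp-≈ʳ (F-iso (C.IsIso.isoʳ iso))) identityʳ)

  agree-everywhere : (t s : RelativeEnd H I) →
    (∀ a → RelativeEnd.η t (ob a) ≈ RelativeEnd.η s (ob a)) →
    ∀ X → RelativeEnd.η t X ≈ RelativeEnd.η s X
  agree-everywhere t s e X = let i , c , iso = small.cover X in
    cancelʳ iso (≈.trans (RelativeEnd.commute t c)
      (≈.trans (∘-resp-≈ʳ (e (inj₁ i))) (≈.sym (RelativeEnd.commute s c))))

  module _ (τ : ∀ a → F₀ (ob a) ⇒ F₀ (ob a))
           (natural : ∀ {a b} (f : ob a C.⇒ ob b) → τ b ∘ F₁ f ≈ F₁ f ∘ τ a)
           (fixed : ∀ a → Fixed a → τ a ≈ id) where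
    private
      η : ∀ X → F₀ X ⇒ F₀ X
      η X = let i , c , iso = small.cover X in F₁ c ∘ (τ (inj₁ i) ∘ F₁ (C.IsIso.inv iso))

      -- Allowing any arrow out of any vertex covers all later uses at once: the covering
      -- isomorphism of `X` gives naturality, an identity shows that `η` extends `τ`, and `I` of a
      -- covering isomorphism gives the condition on values of `I`.
      η-natural : ∀ {a X} (g : ob a C.⇒ X) → η X ∘ F₁ g ≈ F₁ g ∘ τ a
      η-natural {a} {X} g = let i , c , iso = small.cover X ; c⁻¹ = C.IsIso.inv iso in begin
        (F₁ c ∘ (τ (inj₁ i) ∘ F₁ c⁻¹)) ∘ F₁ g   ≈⟨ ≈.trans assoc (∘-resp-≈ʳ assoc) ⟩
        F₁ c ∘ (τ (inj₁ i) ∘ (F₁ c⁻¹ ∘ F₁ g))   ≈⟨ ∘-resp-≈ʳ (∘-resp-≈ʳ homomorphism) ⟨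
        F₁ c ∘ (τ (inj₁ i) ∘ F₁ (c⁻¹ C.∘ g))    ≈⟨ ∘-resp-≈ʳ (natural (c⁻¹ C.∘ g)) ⟩
        F₁ c ∘ (F₁ (c⁻¹ C.∘ g) ∘ τ a)           ≈⟨ assoc ⟨
        (F₁ c ∘ F₁ (c⁻¹ C.∘ g)) ∘ τ a           ≈⟨ ∘-resp-≈ˡ homomorphism ⟨
        F₁ (c C.∘ (c⁻¹ C.∘ g)) ∘ τ a
          ≈⟨ ∘-resp-≈ˡ (F-resp-≈ (C.≈.trans (C.≈.sym C.assoc)
               (C.≈.trans (C.∘-resp-≈ˡ (C.IsIso.isoʳ iso)) C.identityˡ))) ⟩
        F₁ g ∘ τ a                              ∎

    extend : RelativeEnd H I
    extend = record
      { transformation = record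
        { η = η
        ; commute = λ {X} {Y} f → let i , c , iso = small.cover X in cancelʳ iso (begin
            (η Y ∘ F₁ f) ∘ F₁ c            ≈⟨ assoc ⟩
            η Y ∘ (F₁ f ∘ F₁ c)            ≈⟨ ∘-resp-≈ʳ homomorphism ⟨
            η Y ∘ F₁ (f C.∘ c)             ≈⟨ η-natural (f C.∘ c) ⟩
            F₁ (f C.∘ c) ∘ τ (inj₁ i)      ≈⟨ ≈.trans (∘-resp-≈ˡ homomorphism) assoc ⟩
            F₁ f ∘ (F₁ c ∘ τ (inj₁ i))     ≈⟨ ∘-resp-≈ʳ (η-natural c) ⟨
            F₁ f ∘ (η X ∘ F₁ c)            ≈⟨ assoc ⟨
            (F₁ f ∘ η X) ∘ F₁ c            ∎) }
      -- The cover is taken in `C₀`: its image under `I` relates the value at `X₀` to the fixed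
      -- vertex `inj₂ j`, which the cover of that value in `C` would not do.
      ; fixes = λ X₀ → let j , c , iso = small₀.cover X₀ in
          cancelʳ {f = I.F₁ c} (record
            { inv = I.F₁ (C₀.IsIso.inv iso)
            ; isoˡ = C.≈.trans (C.≈.sym I.homomorphism) (C.≈.trans (I.F-resp-≈ (C₀.IsIso.isoˡ iso)) I.identity)
            ; isoʳ = C.≈.trans (C.≈.sym I.homomorphism) (C.≈.trans (I.F-resp-≈ (C₀.IsIso.isoʳ iso)) I.identity) })
            (≈.trans (η-natural {inj₂ j} (I.F₁ c)) (≈.trans (∘-resp-≈ʳ (fixed (inj₂ j) tt))
              (≈.trans identityʳ (≈.sym identityˡ)))) }

    extend-extends : ∀ a → RelativeEnd.η extend (ob a) ≈ τ a
    extend-extends a = ≈.trans (≈.sym identityʳ) (≈.trans (∘-resp-≈ʳ (≈.sym identity))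
      (≈.trans (η-natural {a} C.id) (≈.trans (∘-resp-≈ˡ identity) identityˡ)))

-- Automorphisms as invertible endomorphisms.

module Automorphisms {o₀ o o′ κ : Level} {C₀ : Category o₀ κ} {C : Category o κ} {E : Category o′ κ}
    (H : Functor C E) (I : Functor C₀ C) {ℓ₁ ℓ₂ ℓ₃ ℓ₄ : Level}
    (Γ : Monoid ℓ₁ ℓ₂) (Γᵍ : Group ℓ₃ ℓ₄) (iso : End H I ≅ᴹ Γ) where
  private
    module Γ = Monoid Γ
    module Γᵍ = Group Γᵍ
    module End = Monoid (End H I)
    module E = Category E
    module f = MonoidMorphisms.IsMonoidIsomorphism (proj₂ iso)
    f : RelativeEnd H I → Γ.Carrier
    f = proj₁ iso

  -- The hypotheses identify `Γᵍ` with the invertible elements of `Γ`. An automorphism and its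
  -- inverse give the two arguments of `unit`; as `value` is injective, all laws can be checked in
  -- `Γ`.
  module _ (value : Γᵍ.Carrier → Γ.Carrier)
    (value-cong : ∀ {z w} → z Γᵍ.≈ w → value z Γ.≈ value w)
    (value-∙ : ∀ z w → value (z Γᵍ.∙ w) Γ.≈ (value z Γ.∙ value w))
    (value-ε : value Γᵍ.ε Γ.≈ Γ.ε)
    (value-injective : ∀ {z w} → value z Γ.≈ value w → z Γᵍ.≈ w)
    (unit : ∀ x y → (x Γ.∙ y) Γ.≈ Γ.ε → (y Γ.∙ x) Γ.≈ Γ.ε → Γᵍ.Carrier)
    (value-unit : ∀ x y p q → value (unit x y p q) Γ.≈ x) where
    open RelativeAut using (end)

    private
      product-ε : ∀ {t s} → (t End.∙ s) End.≈ End.ε → (f t Γ.∙ f s) Γ.≈ Γ.ε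
      product-ε {t} {s} e = Γ.trans (Γ.sym (f.homo t s)) (Γ.trans (f.⟦⟧-cong {t End.∙ s} {End.ε} e) f.ε-homo)

      module Aut = Group (Aut H I)

      g : RelativeAut H I → Γᵍ.Carrier
      g t = unit (f (end t)) (f (end (t Aut.⁻¹)))
        (product-ε {end t} {end (t Aut.⁻¹)} (RelativeAut.isIso.isoʳ t))
        (product-ε {end (t Aut.⁻¹)} {end t} (RelativeAut.isIso.isoˡ t))

      value-g : ∀ t → value (g t) Γ.≈ f (end t)
      value-g t = value-unit (f (end t)) (f (end (t Aut.⁻¹))) _ _

      g-cong : ∀ {t s} → t Aut.≈ s → g t Γᵍ.≈ g s
      g-cong {t} {s} e = value-injective (Γ.trans (value-g t)
        (Γ.trans (f.⟦⟧-cong {end t} {end s} e) (Γ.sym (value-g s))))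

      g-∙ : ∀ t s → g (t Aut.∙ s) Γᵍ.≈ (g t Γᵍ.∙ g s)
      g-∙ t s = value-injective (Γ.trans (value-g (t Aut.∙ s)) (Γ.trans (f.homo (end t) (end s))
        (Γ.sym (Γ.trans (value-∙ (g t) (g s)) (Γ.∙-cong (value-g t) (value-g s))))))

      g-ε : g Aut.ε Γᵍ.≈ Γᵍ.ε
      g-ε = value-injective (Γ.trans (value-g Aut.ε) (Γ.trans f.ε-homo (Γ.sym value-ε)))

      value-product : ∀ {z w} → (z Γᵍ.∙ w) Γᵍ.≈ Γᵍ.ε → (value z Γ.∙ value w) Γ.≈ Γ.ε
      value-product {z} {w} e = Γ.trans (Γ.sym (value-∙ z w)) (Γ.trans (value-cong e) value-ε)

      preimage : Γ.Carrier → RelativeEnd H I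
      preimage x = proj₁ (f.surjective x)

      f-preimage : ∀ x → f (preimage x) Γ.≈ x
      f-preimage x = proj₂ (f.surjective x) {preimage x} (λ _ → E.≈.refl)

      preimage-product : ∀ {x y} → (x Γ.∙ y) Γ.≈ Γ.ε → (preimage x End.∙ preimage y) End.≈ End.ε
      preimage-product {x} {y} e = f.injective {preimage x End.∙ preimage y} {End.ε}
        (Γ.trans (f.homo (preimage x) (preimage y))
          (Γ.trans (Γ.∙-cong (f-preimage x) (f-preimage y)) (Γ.trans e (Γ.sym f.ε-homo))))

      g⁻¹ : Γᵍ.Carrier → RelativeAut H I
      g⁻¹ z = record
        { end = preimage (value z)
        ; isIso = λ X → record
          { inv = RelativeEnd.η (preimage (value (z Γᵍ.⁻¹))) X
          ; isoˡ = preimage-product (value-product (Γᵍ.inverseˡ z)) X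
          ; isoʳ = preimage-product (value-product (Γᵍ.inverseʳ z)) X } }

    aut-iso : Aut H I ≅ᴳ Γᵍ
    aut-iso = g , record
      { isGroupMonomorphism = record
        { isGroupHomomorphism = record
          { isMonoidHomomorphism = record
            { isMagmaHomomorphism = record
              { isRelHomomorphism = record { cong = λ {t} {s} → g-cong {t} {s} }
              ; homo = g-∙ }
            ; ε-homo = g-ε }
          ; ⁻¹-homo = λ t → GroupProperties.inverseˡ-unique Γᵍ (g (t Aut.⁻¹)) (g t)
              (Γᵍ.trans (Γᵍ.sym (g-∙ (t Aut.⁻¹) t))
                (Γᵍ.trans (g-cong {t Aut.⁻¹ Aut.∙ t} {Aut.ε} (Aut.inverseˡ t)) g-ε)) }
        ; injective = λ {t} {s} e → f.injective {end t} {end s}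
            (Γ.trans (Γ.sym (value-g t)) (Γ.trans (value-cong e) (value-g s))) }
      ; surjective = λ z → g⁻¹ z , λ {t} e → value-injective (Γ.trans (value-g t)
          (Γ.trans (f.⟦⟧-cong {end t} {end (g⁻¹ z)} e) (f-preimage (value z)))) }

-- The isomorphisms for a functor preserving the constructions.

-- A record, so that instances are compared through N and P only: unfolding
-- the isomorphism types makes conversion checking explode.
record RepresentedBy {o₀ o o′ ℓ κ : Level} {C₀ : Category o₀ κ} {C : Category o κ} {E : Category o′ κ}
                     (H : Functor C E) (I : Functor C₀ C) {D : Category ℓ κ} (cD : Cartesian D)
                     (N : ProMonoid cD) (P : ProGroup cD) : Set (o₀ ⊔ o ⊔ o′ ⊔ κ) where
  field
    end : End H I ≅ᴹ Γᴹ cD N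
    aut : Aut H I ≅ᴳ Γᴳ cD P

module Representation {D : Category o κ} {D′ : Category o′ κ} (cD : Cartesian D) (cD′ : Cartesian D′)
    {V : Set κ} {X : V → Category.Obj D} (K : Closed cD X) (Fixed : V → Set κ)
    (F : Functor D D′) (pres : PreservesProducts cD F)
    (F-exp : PreservesExponentials cD cD′ F pres (Closed.exponentials K))
    (F-eq : PreservesEqualizers (Closed.equalizers K) F) where
  open Closed K using (equalizers; isEqualizer)
  open Points cD cD′ K Fixed F pres F-exp F-eq
  open NaturalFamily
  open Category D′
  private
    module Γ = Monoid (Γᴹ cD′ moduli′)
    module Un = UnitPoints cD cD′ equalizers isEqualizer F pres F-eq (ModuliMonoids.moduli cD K Fixed)

  -- Natural families carry no monoid structure of their own, so compatibility of `restrict` with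
  -- composition is expressed at each vertex, as `points-∙` expects it.
  module _ {o₁ o₂ o₃ : Level}
    {C₀ : Category o₁ κ} {C : Category o₂ κ} {E : Category o₃ κ} (H : Functor C E) (I : Functor C₀ C)
    (restrict : RelativeEnd H I → NaturalFamily)
    (restrict-cong : ∀ t s → Monoid._≈_ (End H I) t s → ∀ a → τ (restrict t) a ≈ τ (restrict s) a)
    (restrict-∙ : ∀ t s a → τ (restrict (Monoid._∙_ (End H I) t s)) a ≈ τ (restrict t) a ∘ τ (restrict s) a)
    (restrict-ε : ∀ a → τ (restrict (Monoid.ε (End H I))) a ≈ id)
    (restrict-injective : ∀ t s → (∀ a → τ (restrict t) a ≈ τ (restrict s) a) → Monoid._≈_ (End H I) t s)
    (extension : NaturalFamily → RelativeEnd H I)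
    (restrict-extension : ∀ t a → τ (restrict (extension t)) a ≈ τ t a)
    where
    private
      module End = Monoid (End H I)

      f : RelativeEnd H I → Γ.Carrier
      f t = points (restrict t)

      f-cong : ∀ t s → t End.≈ s → f t Γ.≈ f s
      f-cong t s e = points-cong {restrict t} {restrict s} (restrict-cong t s e)

    end-iso : End H I ≅ᴹ Γᴹ cD′ Un.N′
    end-iso = f , record
      { isMonoidMonomorphism = record
        { isMonoidHomomorphism = record
          { isMagmaHomomorphism = record
            { isRelHomomorphism = record { cong = λ {t} {s} → f-cong t s }
            ; homo = λ t s → points-∙ {restrict (t End.∙ s)} {restrict t} {restrict s} (restrict-∙ t s) }
          ; ε-homo = points-ε {restrict End.ε} restrict-ε }
        ; injective = λ {t} {s} e →
            restrict-injective t s (points-injective {restrict t} {restrict s} e) }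
      ; surjective = λ x → extension (toFamily x) , λ {t} e →
          Γ.trans {f t} {f (extension (toFamily x))} {x}
            (f-cong t (extension (toFamily x)) e)
            (Γ.trans {f (extension (toFamily x))} {points (toFamily x)} {x}
              (points-cong {restrict (extension (toFamily x))} {toFamily x}
                (restrict-extension (toFamily x)))
              (points-toFamily x)) }

    aut-iso : Aut H I ≅ᴳ Γᴳ cD′ Un.G′
    aut-iso = Automorphisms.aut-iso H I (Γᴹ cD′ Un.N′) (Γᴳ cD′ Un.G′) end-iso
      Un.directPoint (λ {z} {w} → Un.directPoint-cong {z} {w}) Un.directPoint-∙ Un.directPoint-ε
      (λ {z} {w} → Un.directPoint-injective {z} {w}) Un.unitPoint Un.directPoint-unitPoint

    represented : RepresentedBy H I cD′ Un.N′ Un.G′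
    represented = record { end = end-iso ; aut = aut-iso }

module _ {o₀ o o′ κ : Level} {C₀ : Category o₀ κ} {C : Category o κ} {E : Category o′ κ}
         (closed : IndClosed C) (limE : HasFiniteLimits E) (H : Functor C E) (I : Functor C₀ C)
         (H-closed : IsClosed closed limE H) where

  -- The two types agree by unfolding `preserves×`, `mapProMonoid` and `mapProGroup`. With `N` and
  -- `P` variables, the comparison does not enter the construction of `M` and `G`.
  represented-closed : ∀ N P → RepresentedBy H I (Ind-cartesian (cartesian limE))
      (Functor.F₀ (mapPro (mapMon (Ind-cartesian (cartesian limE)) {F = mapInd H}
        (mapInd-preserves (IndClosed.cart closed) {F = H}
          (preservesProducts (IndClosed.finiteLimits closed) (IsClosed.preservesLimits H-closed))))) N)
      (Functor.F₀ (mapPro (mapGrp (Ind-cartesian (cartesian limE)) {F = mapInd H}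
        (mapInd-preserves (IndClosed.cart closed) {F = H}
          (preservesProducts (IndClosed.finiteLimits closed) (IsClosed.preservesLimits H-closed))))) P) →
    RepresentedBy H I (Ind-cartesian (cartesian limE))
      (mapProMonoid closed limE H-closed N) (mapProGroup closed limE H-closed P)
  represented-closed N P r = r

-- The universal pro-monoid and pro-group.

module UniversalMonoid {o₀ o κ : Level} {C₀ : Category o₀ κ} {C : Category o κ}
                 (small₀ : EssentiallySmall C₀) (small : EssentiallySmall C)
                 (closed : IndClosed C) (I : Functor C₀ C) where
  open IndClosed closed using (finiteLimits; cart; cartᵢ)
  open Vertices small₀ small I
  open IndExponentials closed ob using (vertexObject; Ind-exponentials; Ind-isExponential;
                                        mapInd-preservesExponentials)
  private
    module C = Category C

  indEqualizers : Equalizers (Ind C)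
  indEqualizers = Ind-equalizers (limit-equalizers finiteLimits) (limit-isEqualizer finiteLimits)

  indIsEqualizer : PreservesEqualizers indEqualizers (idF {D = Ind C})
  indIsEqualizer {V} {W} =
    Ind-isEqualizer (limit-equalizers finiteLimits) (limit-isEqualizer finiteLimits) {V} {W}

  K : Closed cartᵢ vertexObject
  K = record
    { exponentials = Ind-exponentials ; equalizers = indEqualizers
    ; isExponential = Ind-isExponential ; isEqualizer = λ {V} {W} → indIsEqualizer {V} {W} }

  M : ProMonoid cartᵢ
  M = ModuliMonoids.moduli cartᵢ K Fixed

  G : ProGroup cartᵢ
  G = Functor.F₀ (mapPro (UnitObjects.units cartᵢ (Closed.equalizers K) (Closed.isEqualizer K))) M

  module ClosedFunctor {o′ : Level} {E : Category o′ κ} (cE : Cartesian E) (H : Functor C E)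
      (pres : PreservesProducts cart H)
      (H-eq : PreservesEqualizers (limit-equalizers finiteLimits) H)
      (comparison-iso : ∀ X Y → IsNatIso (comparison closed cE pres X Y)) where
    open Category E
    private
      cEᵢ : Cartesian (Ind E)
      cEᵢ = Ind-cartesian cE

      presᵢ : PreservesProducts cartᵢ (mapInd H)
      presᵢ = mapInd-preserves cart {F = H} pres

      F-eq : PreservesEqualizers indEqualizers (mapInd H)
      F-eq {V} {W} = mapInd-preservesEqualizers (limit-equalizers finiteLimits)
        (limit-isEqualizer finiteLimits) H H-eq {V} {W}

      module H = Functor H
      module Pt = Points cartᵢ cEᵢ K Fixed (mapInd H) presᵢ
        (mapInd-preservesExponentials cE pres comparison-iso) (λ {V} {W} → F-eq {V} {W})
      module X = Extension small₀ small I H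
      open Pt.NaturalFamily

      module _ {A B : C.Obj} where
        -- With `arrow`, this makes ind-maps between images of objects of `C` the same as arrows of
        -- `E`, up to `≈`. Natural families for `mapInd H` thus amount to families of arrows of `E`.
        embed : H.F₀ A ⇒ H.F₀ B → IndHom (mapIndObject H (y₀ C A)) (mapIndObject H (y₀ C B))
        embed f = record
          { comp = λ _ → germ tt f
          ; natural = λ _ → ≈⇒∼ (≈.trans (∘-resp-≈ʳ H.identity) identityʳ) }

        arrow : IndHom (mapIndObject H (y₀ C A)) (mapIndObject H (y₀ C B)) → H.F₀ A ⇒ H.F₀ B
        arrow f = Germ.arr (IndHom.comp f tt)

      restrict : RelativeEnd H I → Pt.NaturalFamily
      restrict t = record
        { τ = λ a → embed (RelativeEnd.η t (ob a))
        -- Naturality is required against every ind-map between vertices; each has a single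
        -- component, an arrow of `C`.
        ; natural = λ f _ → ≈⇒∼ (RelativeEnd.commute t (Germ.arr (IndHom.comp f tt)))
        ; fixed = λ { (inj₂ j) _ _ → ≈⇒∼ (RelativeEnd.fixes t (EssentiallySmall.rep small₀ j)) } }

      single : ∀ {A B} → A C.⇒ B → IndHom (y₀ C A) (y₀ C B)
      single f = record
        { comp = λ _ → germ tt f ; natural = λ _ → ≈⇒∼ C.identityʳ }

      module _ (t : Pt.NaturalFamily) where
        τ-natural : ∀ {a b} (f : ob a C.⇒ ob b) → arrow (τ t b) ∘ H.F₁ f ≈ H.F₁ f ∘ arrow (τ t a)
        τ-natural {a} {b} f = constantly-injective (H ∘F const C (ob b)) (natural t {a} {b} (single f) tt)

        τ-fixed : ∀ a → Fixed a → arrow (τ t a) ≈ id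
        τ-fixed a h = constantly-injective (H ∘F const C (ob a)) (fixed t a h tt)

        extension : RelativeEnd H I
        extension = X.extend (λ a → arrow (τ t a)) (λ {a} {b} → τ-natural {a} {b}) τ-fixed

        restrict-extension : ∀ a → Ind E [ τ (restrict extension) a ≈ τ t a ]
        restrict-extension a _ =
          ≈⇒∼ (X.extend-extends (λ a → arrow (τ t a)) (λ {a} {b} → τ-natural {a} {b}) τ-fixed a)

      restrict-injective : ∀ t s → (∀ a → Ind E [ τ (restrict t) a ≈ τ (restrict s) a ]) →
                           ∀ X → RelativeEnd.η t X ≈ RelativeEnd.η s X
      restrict-injective t s e = X.agree-everywhere t s λ a →
        constantly-injective (H ∘F const C (ob a)) (e a tt)

      module Rep = Representation cartᵢ cEᵢ K Fixed (mapInd H) presᵢ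
        (mapInd-preservesExponentials cE pres comparison-iso) (λ {V} {W} → F-eq {V} {W})

    represented : RepresentedBy H I (Ind-cartesian cE)
      (Functor.F₀ (mapPro (mapMon (Ind-cartesian cE) {F = mapInd H} (mapInd-preserves cart {F = H} pres))) M)
      (Functor.F₀ (mapPro (mapGrp (Ind-cartesian cE) {F = mapInd H} (mapInd-preserves cart {F = H} pres))) G)
    represented = Rep.represented H I restrict (λ t s e a _ → ≈⇒∼ (e (ob a)))
      (λ t s a _ → ≈⇒∼ ≈.refl) (λ a _ → ≈⇒∼ ≈.refl) restrict-injective extension restrict-extension

  -- IsClosed.preserves× is unfolded here, as it is in the type of
  -- IsClosed.comparison-iso.
  module _ {o′ : Level} {E : Category o′ κ} (limE : HasFiniteLimits E) (H : Functor C E)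
           (H-closed : IsClosed closed limE H) where
    private
      represented : RepresentedBy H I (Ind-cartesian (cartesian limE))
        (Functor.F₀ (mapPro (mapMon (Ind-cartesian (cartesian limE)) {F = mapInd H}
          (mapInd-preserves cart {F = H}
            (preservesProducts (IndClosed.finiteLimits closed) (IsClosed.preservesLimits H-closed))))) M)
        (Functor.F₀ (mapPro (mapGrp (Ind-cartesian (cartesian limE)) {F = mapInd H}
          (mapInd-preserves cart {F = H}
            (preservesProducts (IndClosed.finiteLimits closed) (IsClosed.preservesLimits H-closed))))) G)
      represented = ClosedFunctor.represented {E = E} (cartesian limE) H
        (preservesProducts (IndClosed.finiteLimits closed) (IsClosed.preservesLimits H-closed))
        (preservesEqualizers (IndClosed.finiteLimits closed) (IsClosed.preservesLimits H-closed))
        (IsClosed.comparison-iso H-closed)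

    result : RepresentedBy H I (Ind-cartesian (cartesian limE))
             (mapProMonoid closed limE H-closed M) (mapProGroup closed limE H-closed G)
    result = represented-closed closed limE H I H-closed M G represented

corollary2p8 : ∀ {o₀ o o′ κ : Level} {C₀ : Category o₀ κ} {C : Category o κ} →
    EssentiallySmall C₀ → EssentiallySmall C →
    (closed : IndClosed C) (I : Functor C₀ C) →
    Σ[ M ∈ ProMonoid (IndClosed.cartᵢ closed) ]
    Σ[ G ∈ ProGroup (IndClosed.cartᵢ closed) ]
    (∀ {E : Category o′ κ} → EssentiallySmall E → (limE : HasFiniteLimits E)
    (H : Functor C E) (H-closed : IsClosed closed limE H) →
    (End H I ≅ᴹ Γᴹ (Ind-cartesian (cartesian limE)) (mapProMonoid closed limE H-closed M))
    × (Aut H I ≅ᴳ Γᴳ (Ind-cartesian (cartesian limE)) (mapProGroup closed limE H-closed G)))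
corollary2p8 small₀ small closed I = M , G , λ _ limE H H-closed →
  end (result limE H H-closed) , aut (result limE H H-closed)
  where
  open UniversalMonoid small₀ small closed I
  open RepresentedBy
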